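{- Let $G_0$ be a plane graph and let $v_1v_2\cdots v_{2n-1}$ ($n\ge 1$) be a path lying on the boundary of the unbounded face of $G_0$, such that each even-indexed vertex $v_2,v_4,\dots,v_{2n-2}$ has degree two in $G_0$. Let $G$ be obtained from $G_0$ by adding a new leaf $v_0$ adjacent to $v_1$ and a new leaf $v_{2n}$ adjacent to $v_{2n-1}$, both drawn in the unbounded face. For $j=1,\dots,2n$ let $m_j$ denote the edge-vertex of $H_G$ corresponding to the edge $v_{j-1}v_j$ of $G$. Let $$G^+=H_G\setminus\{v_0,v_2,\dots,v_{2n},\,m_1,m_3,\dots,m_{2n-1}\},\qquad G^-=H_G\setminus\{v_0,v_2,\dots,v_{2n},\,m_2,m_4,\dots,m_{2n}\}.$$ Then there is a bijection between the set of perfect matchings of $G^+$ and the set of perfect matchings of $G^-$; in particular $\operatorname{M}(G^+)=\operatorname{M}(G^-)$.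
   Context: All graphs have no loops and no multiple edges; the plane graph $G$ is assumed to have no vertex of degree one inside any bounded face. For a plane graph $G$, its dual refinement $H_G$ is the graph whose vertices are: the vertices of $G$ (original vertices), one vertex for each bounded face of $G$ (face-vertices), and one vertex at the midpoint of each edge of $G$ (edge-vertices). For each edge $e$ of $G$, the edge-vertex of $e$ is joined to the two endpoints of $e$ and to the face-vertex of each bounded face of $G$ whose boundary contains $e$; these are all the edges of $H_G$. Removing a vertex from a graph also removes all edges incident to it. $\operatorname{M}(K)$ denotes the number of perfect matchings of a graph $K$. -}

module Defs where

open import Data.Nat using (ℕ; zero; suc; _+_; _*_; _≤_; _<_; _≤ᵇ_)
open import Data.Bool using (Bool; true; false; not; _∧_; _∨_; if_then_else_; T)
open import Data.Fin using (Fin; zero; suc; toℕ; splitAt; inject₁; fromℕ) renaming (_≟_ to _≟ᶠ_)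
open import Data.Maybe using (Maybe; just; nothing)
open import Data.Product using (Σ; ∃; _×_; _,_; proj₁; proj₂)
open import Data.Sum using (_⊎_; inj₁; inj₂)
open import Data.Vec using (Vec; lookup)
open import Relation.Nullary.Decidable using (⌊_⌋)
open import Relation.Binary.PropositionalEquality using (_≡_; _≢_)

_==ᶠ_ : ∀ {n} → Fin n → Fin n → Bool
x ==ᶠ y = ⌊ x ≟ᶠ y ⌋

_==ᵇ_ : Bool → Bool → Bool
true ==ᵇ b = b
false ==ᵇ b = not b

_==ᵐ_ : ∀ {n} → Maybe (Fin n) → Maybe (Fin n) → Bool
just x ==ᵐ just y = x ==ᶠ y
nothing ==ᵐ nothing = true
_ ==ᵐ _ = false

count : ∀ {n} → (Fin n → Bool) → ℕ
count {zero} P = 0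
count {suc n} P = (if P zero then 1 else 0) + count (λ i → P (suc i))

anyF : ∀ {n} → (Fin n → Bool) → Bool
anyF {zero} P = false
anyF {suc n} P = P zero ∨ anyF (λ i → P (suc i))

allBelow : ℕ → (ℕ → Bool) → Bool
allBelow zero P = true
allBelow (suc m) P = allBelow m P ∧ P m

isEven : ℕ → Bool
isEven zero = true
isEven (suc k) = not (isEven k)

iter : {A : Set} → (A → A) → ℕ → A → A
iter f zero x = x
iter f (suc k) x = f (iter f k x)

record Graph : Set where
  field
    nV nE : ℕ
    tl hd : Fin nE → Fin nV
    loopless : ∀ e → tl e ≢ hd e
    simple : ∀ e e′ → ((tl e ≡ tl e′ × hd e ≡ hd e′) ⊎ (tl e ≡ hd e′ × hd e ≡ tl e′)) → e ≡ e′

module GraphOps (G : Graph) where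
  open Graph G

  Dart : Set
  Dart = Fin nE × Bool

  vert : Dart → Fin nV
  vert (e , false) = tl e
  vert (e , true) = hd e

  α : Dart → Dart
  α (e , b) = (e , not b)

  countD : (Dart → Bool) → ℕ
  countD P = count (λ e → P (e , false)) + count (λ e → P (e , true))

  _==ᵈ_ : Dart → Dart → Bool
  (e , b) ==ᵈ (e′ , b′) = (e ==ᶠ e′) ∧ (b ==ᵇ b′)

  code : Dart → ℕ
  code (e , b) = toℕ e * 2 + (if b then 1 else 0)

  deg : Fin nV → ℕ
  deg v = countD (λ d → vert d ==ᶠ v)

  reachStep : ℕ → Fin nV → Fin nV → Bool
  reachStep zero u v = u ==ᶠ v
  reachStep (suc k) u v = reachStep k u v ∨
    anyF (λ e → (reachStep k u (tl e) ∧ (hd e ==ᶠ v)) ∨ (reachStep k u (hd e) ∧ (tl e ==ᶠ v)))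

  sameComp : Fin nV → Fin nV → Bool
  sameComp u v = reachStep nV u v

  compV : Fin nV → ℕ
  compV u = count (λ v → sameComp u v)

  compE : Fin nV → ℕ
  compE u = count (λ e → sameComp u (tl e))

  module Rotation (σ : Dart → Dart) where
    -- face-traversal permutation φ = σ ∘ α; its orbits are the facial walks
    φ : Dart → Dart
    φ d = σ (α d)

    SameOrbit : Dart → Dart → Set
    SameOrbit d d′ = ∃ λ k → iter φ k d ≡ d′

    -- d is the least dart (w.r.t. code) of its φ-orbit (orbits have length ≤ 2 nE)
    orbRep : Dart → Bool
    orbRep d = allBelow (2 * nE) (λ k → code d ≤ᵇ code (iter φ k d))

    compOrbits : Fin nV → ℕ
    compOrbits u = countD (λ d → sameComp u (vert d) ∧ orbRep d)

-- Plane graphs, encoded combinatorially (up to homeomorphism of the plane):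
-- a rotation system σ of genus 0 on every component (Euler's formula per
-- component), a choice of the outer facial walk of each component, and the
-- nesting of components inside faces.  The faces of the plane graph are the
-- unbounded face (face d ≡ nothing) and the bounded faces Fin nF.
-- face d is the face of the plane graph lying to the side of dart d that is
-- traversed by the facial walk through d.

record PlaneGraph : Set₁ where
  field
    graph : Graph
  open Graph graph public
  open GraphOps graph public
  field
    σ σ⁻ : Dart → Dart
    σ-inv₁ : ∀ d → σ⁻ (σ d) ≡ d
    σ-inv₂ : ∀ d → σ (σ⁻ d) ≡ d
    σ-vert : ∀ d → vert (σ d) ≡ vert d
    σ-cyclic : ∀ d d′ → vert d ≡ vert d′ → ∃ λ k → iter σ k d ≡ d′
  open Rotation σ public
  field
    euler : ∀ u → 1 ≤ deg u → compV u + compOrbits u ≡ 2 + compE u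
    nF : ℕ
    face : Dart → Maybe (Fin nF)
    face-φ : ∀ d → face (φ d) ≡ face d
    outer : Dart → Bool
    outer-φ : ∀ d → outer (φ d) ≡ outer d
    outer-exists : ∀ d → ∃ λ d′ → T (sameComp (vert d) (vert d′)) × outer d′ ≡ true
    outer-unique : ∀ d d′ → outer d ≡ true → outer d′ ≡ true →
                   T (sameComp (vert d) (vert d′)) → SameOrbit d d′
    inner-bounded : ∀ d → outer d ≡ false → ∃ λ f → face d ≡ just f
    enclose-exists : ∀ f → ∃ λ d → outer d ≡ false × face d ≡ just f
    enclose-unique : ∀ d d′ → outer d ≡ false → outer d′ ≡ false →
                     face d ≡ face d′ → SameOrbit d d′
    -- the nesting of components is acyclic (rank constant on components)
    rank : Fin nV → ℕ
    rank-edge : ∀ e → rank (tl e) ≡ rank (hd e)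
    nest : ∀ d d′ → outer d ≡ true → outer d′ ≡ false → face d ≡ face d′ →
           rank (vert d′) < rank (vert d)
    -- standing assumption: no vertex of degree one inside a bounded face
    noInnerLeaf : ∀ d → deg (vert d) ≡ 1 → face d ≡ nothing

record SGraph : Set where
  field
    N : ℕ
    adj : Fin N → Fin N → Bool

-- A perfect matching of K minus the vertices x with keep x ≡ false,
-- encoded by its partner map p (p x = x for removed vertices).
isPM : (K : SGraph) → (Fin (SGraph.N K) → Bool) → Vec (Fin (SGraph.N K)) (SGraph.N K) → Bool
isPM K keep p = not (anyF (λ x → not (ok x)))
  where
    open SGraph K
    ok : Fin N → Bool
    ok x with keep x
    ... | true = keep (lookup p x) ∧ not (lookup p x ==ᶠ x)
                 ∧ (lookup p (lookup p x) ==ᶠ x) ∧ adj x (lookup p x)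
    ... | false = lookup p x ==ᶠ x

PerfectMatching : (K : SGraph) → (Fin (SGraph.N K) → Bool) → Set
PerfectMatching K keep = Σ (Vec (Fin (SGraph.N K)) (SGraph.N K)) (λ p → T (isPM K keep p))

module Refinement (P : PlaneGraph) where
  open PlaneGraph P

  HVert : Set
  HVert = Fin (nV + (nF + nE))

  data Kind : Set where
    orig : Fin nV → Kind
    fc : Fin nF → Kind
    ed : Fin nE → Kind

  kind : HVert → Kind
  kind x with splitAt nV x
  ... | inj₁ v = orig v
  ... | inj₂ y with splitAt nF y
  ... | inj₁ f = fc f
  ... | inj₂ e = ed e

  edAdj : Fin nE → Kind → Bool
  edAdj e (orig v) = (tl e ==ᶠ v) ∨ (hd e ==ᶠ v)
  edAdj e (fc f) = (face (e , false) ==ᵐ just f) ∨ (face (e , true) ==ᵐ just f)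
  edAdj e (ed _) = false

  adjK : Kind → Kind → Bool
  adjK (ed e) k = edAdj e k
  adjK k (ed e) = edAdj e k
  adjK _ _ = false

  H : SGraph
  H = record { N = nV + (nF + nE) ; adj = λ x y → adjK (kind x) (kind y) }

  -- Given the path v_0 … v_{2n} (p) and edges m_1 … m_{2n} (pe k = m_{k+1}),
  -- keep-predicates of G⁺ and G⁻.
  module Path (n : ℕ) (p : Fin (suc (2 * n)) → Fin nV) (pe : Fin (2 * n) → Fin nE) where
    evenOrig : Fin nV → Bool
    evenOrig v = anyF (λ i → isEven (toℕ i) ∧ (p i ==ᶠ v))

    -- m_j with j odd (k = j - 1 even) when b = true, j even when b = false
    mRemoved : Bool → Fin nE → Bool
    mRemoved b e = anyF (λ k → (isEven (toℕ k) ==ᵇ b) ∧ (pe k ==ᶠ e))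

    keepWith : Bool → HVert → Bool
    keepWith b x with kind x
    ... | orig v = not (evenOrig v)
    ... | fc f = true
    ... | ed e = not (mRemoved b e)

    keep⁺ keep⁻ : HVert → Bool
    keep⁺ = keepWith true
    keep⁻ = keepWith false

{-# OPTIONS --safe #-}
-- Matching each deleted v₂ⱼ to the deleted m₂ⱼ₊₁ turns a perfect matching of G⁺ into one of H_G
-- minus r = v₂ₙ; it assigns to each edge of G one of its end vertices or bounded side faces.
-- Edges matched to vertices form a graph T, the other ones a dual graph T*.  Walking around
-- the component of r in T one only meets faces joined to the unbounded face in T*, and dually;
-- with Euler's formula this makes T a spanning tree and T* a spanning dual tree.
-- Off the path, T and T* fall into components, each leaving through one edge of the path.
-- A vertex set and a face set have an even number of common boundary edges, which shows that
-- a component of T leaves at its last path vertex and that, after moving the exit of each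
-- component of T to its first path vertex and the exit of each component of T* to its last
-- face along the path, each path edge is again used once: this is a perfect matching of G⁻.
-- The edges of T off the path are unchanged and determine the matching, so the same
-- construction along the reversed path is the inverse.

module Submission where

open import Defs
open import Algebra.Bundles using (CommutativeRing)
import Algebra.Properties.CommutativeMonoid.Sum as CommutativeMonoidSum
open import Data.Nat using (ℕ; zero; suc; _+_; _*_; _∸_; _≤_; _<_; z≤n; s≤s; s≤s⁻¹)
import Data.Nat.Properties as ℕ
open import Data.Nat.Induction using (<-rec)
open import Data.Bool using (Bool; true; false; not; _∧_; _∨_; _xor_; if_then_else_; T)
import Data.Bool.Properties as Bool
open import Data.Empty using (⊥; ⊥-elim)
open import Data.Unit using (⊤; tt)
open import Data.Fin using (Fin; zero; suc; toℕ; inject₁; fromℕ; fromℕ<; splitAt; join; _↑ˡ_; _↑ʳ_) renaming (_≟_ to _≟ᶠ_)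
import Data.Fin.Properties as Fin
open import Data.Maybe using (Maybe; just; nothing)
import Data.Maybe.Properties as Maybe
open import Data.Product using (Σ; ∃; ∃₂; _×_; _,_; proj₁; proj₂)
import Data.Product.Properties as Product
open import Data.Sum using (_⊎_; inj₁; inj₂; [_,_]′; swap)
import Data.Sum.Properties as Sum
open import Data.Vec using (Vec; lookup; tabulate)
import Data.Vec.Properties as Vec
open import Function using (_∘_; id; case_of_)
open import Function.Bundles using (_↔_; _⇔_; mk⇔; Equivalence; mk↔ₛ′)
open import Function.Construct.Composition using (_⇔-∘_)
open import Function.Construct.Identity using (⇔-id)
open import Function.Construct.Symmetry using (⇔-sym)
open import Relation.Binary.Definitions using (DecidableEquality)
open import Relation.Binary.PropositionalEquality using (_≡_; _≢_; refl; sym; trans; cong; cong₂; subst; ≢-sym; module ≡-Reasoning)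
open import Relation.Nullary using (¬_; Dec; yes; no; contradiction; _×-dec_; _⊎-dec_; ¬?)
open import Relation.Nullary.Decidable using (⌊_⌋; isYes≗does; dec-true; dec-false; map′)

open CommutativeMonoidSum (CommutativeRing.+-commutativeMonoid Bool.xor-∧-commutativeRing)
  using (sum; sum-cong-≗; ∑-distrib-+; sum-permute)

-- The main obstacle is that a matching could a priori contain a closed chain of owners, on which no
-- induction is possible. Two statements that feed each other exclude this: the faces around a
-- vertex that reaches the root reach the unbounded face, and the vertices around a face that
-- reaches the unbounded face reach the root. Only then is there a level that drops along every
-- chain.
--
-- Evenness of common boundaries comes from the face permutation: it permutes the darts, keeps their
-- faces and carries the far end of a dart to the near end of the next one.
--
-- The new exits are forced. Reversing the path exchanges the roles of the deleted and the remaining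
-- path edges, so a matching of G⁻ obeys the same law as one of G⁺, and "last on the reversed path"
-- means first. A component of T beginning at an index and a component of T* ending there would
-- claim the same edge; parity forbids this. Since there are n exits and n edges to be claimed,
-- injectivity gives the bijection.

-- Booleans, finite counting, parity sums and iteration.

==ᶠ⇒≡ : ∀ {n} {x y : Fin n} → (x ==ᶠ y) ≡ true → x ≡ y
==ᶠ⇒≡ {x = x} {y} eq with x ≟ᶠ y
... | yes x≡y = x≡y
==ᶠ⇒≡ () | no _

==ᶠ-refl : ∀ {n} (x : Fin n) → (x ==ᶠ x) ≡ true
==ᶠ-refl x = trans (isYes≗does (x ≟ᶠ x)) (dec-true (x ≟ᶠ x) refl)

∨-true : ∀ {a b} → a ∨ b ≡ true → a ≡ true ⊎ b ≡ true
∨-true {true} _ = inj₁ refl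
∨-true {false} eq = inj₂ eq

∨-introˡ : ∀ {a} b → a ≡ true → a ∨ b ≡ true
∨-introˡ b refl = refl

∨-introʳ : ∀ a {b} → b ≡ true → a ∨ b ≡ true
∨-introʳ a refl = Bool.∨-zeroʳ a

∧-true : ∀ {a b} → a ∧ b ≡ true → a ≡ true × b ≡ true
∧-true {true} {true} _ = refl , refl

∧-intro : ∀ {a b} → a ≡ true → b ≡ true → a ∧ b ≡ true
∧-intro refl refl = refl

≢true⇒≡false : ∀ {b} → b ≢ true → b ≡ false
≢true⇒≡false = Bool.¬-not

true≢false : true ≢ false
true≢false ()

anyF-true : ∀ {n} {P : Fin n → Bool} → anyF P ≡ true → ∃ λ i → P i ≡ true
anyF-true {suc n} eq with ∨-true eq
... | inj₁ p = zero , p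
... | inj₂ p with anyF-true {n} p
... | i , q = suc i , q

anyF-intro : ∀ {n} {P : Fin n → Bool} i → P i ≡ true → anyF P ≡ true
anyF-intro {suc n} {P} zero p = ∨-introˡ _ p
anyF-intro {suc n} {P} (suc i) p = ∨-introʳ (P zero) (anyF-intro i p)

-- Exhibits the subset `P` as having exactly `k` elements. In this form the numerical counts of the
-- definitions can be compared by giving injections between subsets of different types.
record Listing {A : Set} (P : A → Bool) (k : ℕ) : Set where
  field
    item : Fin k → A
    sound : ∀ i → P (item i) ≡ true
    item-injective : ∀ {i j} → item i ≡ item j → i ≡ j
    complete : ∀ a → P a ≡ true → ∃ λ i → item i ≡ a

open Listing

count-listing : ∀ {n} (P : Fin n → Bool) → Listing P (count P)
count-listing {zero} P = record
  { item = λ () ; sound = λ () ; item-injective = λ { {()} } ; complete = λ () }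
count-listing {suc n} P with P zero in eq | count-listing (P ∘ suc)
... | false | L = record
  { item = suc ∘ item L
  ; sound = sound L
  ; item-injective = item-injective L ∘ Fin.suc-injective
  ; complete = λ { zero p → contradiction (trans (sym p) eq) true≢false
                 ; (suc i) p → proj₁ (complete L i p) , cong suc (proj₂ (complete L i p)) } }
... | true | L = record
  { item = λ { zero → zero ; (suc i) → suc (item L i) }
  ; sound = λ { zero → eq ; (suc i) → sound L i }
  ; item-injective = λ { {zero} {zero} _ → refl
                       ; {suc i} {suc j} e → cong suc (item-injective L (Fin.suc-injective e)) }
  ; complete = λ { zero p → zero , refl
                 ; (suc i) p → suc (proj₁ (complete L i p)) , cong suc (proj₂ (complete L i p)) } }

⊎-listing : ∀ {A B : Set} {P : A → Bool} {Q : B → Bool} {k l} →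
            Listing P k → Listing Q l → Listing [ P , Q ]′ (k + l)
⊎-listing {P = P} {Q} {k} {l} L M = record
  { item = λ i → pick (splitAt k i)
  ; sound = λ i → pick-sound (splitAt k i)
  ; item-injective = λ {i} {j} e → trans (sym (Fin.join-splitAt k l i))
      (trans (cong (join k l) (pick-injective (splitAt k i) (splitAt k j) e)) (Fin.join-splitAt k l j))
  ; complete = find }
  where
  pick : Fin k ⊎ Fin l → _
  pick (inj₁ i) = inj₁ (item L i)
  pick (inj₂ j) = inj₂ (item M j)
  pick-sound : ∀ x → [ P , Q ]′ (pick x) ≡ true
  pick-sound (inj₁ i) = sound L i
  pick-sound (inj₂ j) = sound M j
  pick-injective : ∀ x y → pick x ≡ pick y → x ≡ y
  pick-injective (inj₁ i) (inj₁ j) e = cong inj₁ (item-injective L (Sum.inj₁-injective e))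
  pick-injective (inj₂ i) (inj₂ j) e = cong inj₂ (item-injective M (Sum.inj₂-injective e))
  find : ∀ c → [ P , Q ]′ c ≡ true → ∃ λ i → pick (splitAt k i) ≡ c
  find (inj₁ a) p with complete L a p
  ... | i , e = i ↑ˡ l , trans (cong pick (Fin.splitAt-↑ˡ k i l)) (cong inj₁ e)
  find (inj₂ b) p with complete M b p
  ... | j , e = k ↑ʳ j , trans (cong pick (Fin.splitAt-↑ʳ k l j)) (cong inj₂ e)

⊤-listing : Listing {⊤} (λ _ → true) 1
⊤-listing = record
  { item = λ _ → tt ; sound = λ _ → refl
  ; item-injective = λ { {zero} {zero} _ → refl } ; complete = λ _ _ → zero , refl }

Fin-listing : ∀ n → Listing {Fin n} (λ _ → true) n
Fin-listing n = record
  { item = id ; sound = λ _ → refl ; item-injective = id ; complete = λ i _ → i , refl }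

listing-≤ : ∀ {A B : Set} {P : A → Bool} {Q : B → Bool} {k l} →
            Listing P k → Listing Q l → (f : ∀ a → P a ≡ true → B) →
            (∀ a p → Q (f a p) ≡ true) →
            (∀ a a′ p p′ → f a p ≡ f a′ p′ → a ≡ a′) → k ≤ l
listing-≤ {k = k} {l} L M f f-sound f-injective = Fin.injective⇒≤ {f = g} g-injective
  where
  g : Fin k → Fin l
  g i = proj₁ (complete M _ (f-sound (item L i) (sound L i)))
  g-item : ∀ i → item M (g i) ≡ f (item L i) (sound L i)
  g-item i = proj₂ (complete M _ (f-sound (item L i) (sound L i)))
  g-injective : ∀ {i j} → g i ≡ g j → i ≡ j
  g-injective {i} {j} e = item-injective L (f-injective _ _ (sound L i) (sound L j)
    (trans (sym (g-item i)) (trans (cong (item M) e) (g-item j))))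

-- A missed value could serve as the image of one extra point, giving an injection of `1 + n` points
-- into `n`.
injective⇒surjective : ∀ {n} (f : Fin n → Fin n) → (∀ {i j} → f i ≡ f j → i ≡ j) →
                       ∀ j → ∃ λ i → f i ≡ j
injective⇒surjective {n} f f-inj j with Fin.any? (λ i → f i ≟ᶠ j)
... | yes found = found
... | no missed = contradiction
  (listing-≤ (⊎-listing ⊤-listing (Fin-listing n)) (Fin-listing n)
    (λ { (inj₁ _) _ → j ; (inj₂ i) _ → f i }) (λ _ _ → refl)
    (λ { (inj₁ _) (inj₁ _) _ _ _ → refl
       ; (inj₁ _) (inj₂ i) _ _ e → contradiction (i , sym e) missed
       ; (inj₂ i) (inj₁ _) _ _ e → contradiction (i , e) missed
       ; (inj₂ i) (inj₂ i′) _ _ e → cong inj₂ (f-inj e) }))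
  (ℕ.n≮n n)

sum-false : ∀ {n} (f : Fin n → Bool) → (∀ i → f i ≡ false) → sum f ≡ false
sum-false {zero} f _ = refl
sum-false {suc n} f z = cong₂ _xor_ (z zero) (sum-false (f ∘ suc) (z ∘ suc))

sum-single : ∀ {n} (f : Fin n → Bool) i → f i ≡ true → (∀ j → j ≢ i → f j ≡ false) → sum f ≡ true
sum-single {suc n} f zero p z = cong₂ _xor_ p (sum-false (f ∘ suc) (λ j → z (suc j) λ ()))
sum-single {suc n} f (suc i) p z =
  cong₂ _xor_ (z zero λ ()) (sum-single (f ∘ suc) i p (λ j j≢i → z (suc j) (j≢i ∘ Fin.suc-injective)))

sum-+ : ∀ m {n} (f : Fin (m + n) → Bool) →
        sum f ≡ sum (λ i → f (i ↑ˡ n)) xor sum (λ j → f (m ↑ʳ j))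
sum-+ zero f = refl
sum-+ (suc m) {n} f = trans (cong (f zero xor_) (sum-+ m (f ∘ suc)))
  (sym (Bool.xor-assoc (f zero) (sum (λ i → f (suc i ↑ˡ n))) (sum (λ j → f (suc (m ↑ʳ j))))))

-- Here `sum` is taken with `xor`, so it is the parity of the number of true terms, and a lone true
-- term would make it odd.
sum-true⇒another : ∀ {n} (f : Fin n → Bool) → sum f ≡ false → ∀ i → f i ≡ true →
                   ∃ λ j → j ≢ i × f j ≡ true
sum-true⇒another f even i p with Fin.any? (λ j → ¬? (j ≟ᶠ i) ×-dec (f j Bool.≟ true))
... | yes found = found
... | no none = contradiction
  (trans (sym (sum-single f i p (λ j j≢i → ≢true⇒≡false (λ q → none (j , j≢i , q))))) even)
  true≢false

argmax : ∀ {n} {P : Fin n → Set} → (∀ i → Dec (P i)) → (h : Fin n → ℕ) → ∃ P →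
         ∃ λ i → P i × (∀ j → P j → h j ≤ h i)
argmax {suc n} {P} P? h (i₀ , p₀) with Fin.any? (P? ∘ suc)
argmax P? h (zero , p₀) | no none =
  zero , p₀ , λ { zero _ → ℕ.≤-refl ; (suc j) q → contradiction (j , q) none }
argmax P? h (suc i₀ , p₀) | no none = contradiction (i₀ , p₀) none
argmax P? h _ | yes found with argmax (P? ∘ suc) (h ∘ suc) found | P? zero
... | i , p , m | no ¬p₀ = suc i , p , λ { zero q → contradiction q ¬p₀ ; (suc j) q → m j q }
... | i , p , m | yes p₀ with ℕ.≤-total (h zero) (h (suc i))
... | inj₁ le = suc i , p , λ { zero _ → le ; (suc j) q → m j q }
... | inj₂ ge = zero , p₀ , λ { zero _ → ℕ.≤-refl ; (suc j) q → ℕ.≤-trans (m j q) ge }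

iter-+ : ∀ {A : Set} (f : A → A) k l x → iter f (k + l) x ≡ iter f k (iter f l x)
iter-+ f zero l x = refl
iter-+ f (suc k) l x = cong f (iter-+ f k l x)

-- Bridges the gap between `orbRep`, which inspects only the first `2 * nE` iterates, and
-- `SameOrbit`, which allows any number: a repetition among the first `N + 1` iterates can be cut
-- out.
iter-shorten : ∀ {A : Set} {N} → Listing {A} (λ _ → true) N → (f : A → A) (x : A) →
               ∀ k → ∃ λ j → j < N × iter f j x ≡ iter f k x
iter-shorten {A} {N} L f x = <-rec _ shorten
  where
  position : A → Fin N
  position a = proj₁ (complete L a refl)
  shorten : ∀ k → (∀ {i} → i < k → ∃ λ j → j < N × iter f j x ≡ iter f i x) →
            ∃ λ j → j < N × iter f j x ≡ iter f k x
  shorten k rec with k ℕ.<? N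
  ... | yes k<N = k , k<N , refl
  ... | no k≮N with Fin.pigeonhole (ℕ.n<1+n N) (λ i → position (iter f (toℕ i) x))
  ... | i , j , i<j , eq = proj₁ shorter , proj₁ (proj₂ shorter) , trans (proj₂ (proj₂ shorter)) same
    where
    j≤k : toℕ j ≤ k
    j≤k = ℕ.≤-trans (s≤s⁻¹ (Fin.toℕ<n j)) (ℕ.≮⇒≥ k≮N)
    repeat : iter f (toℕ i) x ≡ iter f (toℕ j) x
    repeat = trans (sym (proj₂ (complete L _ refl)))
                   (trans (cong (item L) eq) (proj₂ (complete L _ refl)))
    shorter = rec (subst (k ∸ toℕ j + toℕ i <_) (ℕ.m∸n+n≡m j≤k) (ℕ.+-monoʳ-< (k ∸ toℕ j) i<j))
    same : iter f (k ∸ toℕ j + toℕ i) x ≡ iter f k x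
    same = trans (iter-+ f (k ∸ toℕ j) (toℕ i) x)
      (trans (cong (iter f (k ∸ toℕ j)) repeat)
      (trans (sym (iter-+ f (k ∸ toℕ j) (toℕ j) x)) (cong (λ m → iter f m x) (ℕ.m∸n+n≡m j≤k))))

allBelow-true : ∀ m {P k} → allBelow m P ≡ true → k < m → P k ≡ true
allBelow-true (suc m) {P} {k} all k<1+m with ∧-true {allBelow m P} all | ℕ.m<1+n⇒m<n∨m≡n k<1+m
... | below , _ | inj₁ k<m = allBelow-true m below k<m
... | _ , last | inj₂ refl = last

-- Darts, reachability and connected components.

module Components (G : Graph) where
  open Graph G
  open GraphOps G

  Ends : Fin nE → Fin nV → Fin nV → Set
  Ends e u v = (tl e ≡ u × hd e ≡ v) ⊎ (tl e ≡ v × hd e ≡ u)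

  α-involutive : ∀ d → α (α d) ≡ d
  α-involutive (e , b) = cong (e ,_) (Bool.not-involutive b)

  countD-listing : (P : Dart → Bool) → Listing P (countD P)
  countD-listing P = record
    { item = dart ∘ item L
    ; sound = λ i → dart-sound (item L i) (sound L i)
    ; item-injective = item-injective L ∘ dart-injective _ _
    ; complete = λ { (e , false) p → proj₁ (complete L (inj₁ e) p) , cong dart (proj₂ (complete L (inj₁ e) p))
                   ; (e , true) p → proj₁ (complete L (inj₂ e) p) , cong dart (proj₂ (complete L (inj₂ e) p)) } }
    where
    L = ⊎-listing (count-listing (λ e → P (e , false))) (count-listing (λ e → P (e , true)))
    dart : Fin nE ⊎ Fin nE → Dart
    dart (inj₁ e) = e , false
    dart (inj₂ e) = e , true
    dart-sound : ∀ x → [ (λ e → P (e , false)) , (λ e → P (e , true)) ]′ x ≡ true → P (dart x) ≡ true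
    dart-sound (inj₁ e) p = p
    dart-sound (inj₂ e) p = p
    dart-injective : ∀ x y → dart x ≡ dart y → x ≡ y
    dart-injective (inj₁ e) (inj₁ .e) refl = refl
    dart-injective (inj₂ e) (inj₂ .e) refl = refl

  dart-listing : Listing {Dart} (λ _ → true) (2 * nE)
  dart-listing = subst (Listing _) sizes (countD-listing (λ _ → true))
    where
    all : ∀ n → count {n} (λ _ → true) ≡ n
    all zero = refl
    all (suc n) = cong suc (all n)
    sizes : countD (λ _ → true) ≡ 2 * nE
    sizes rewrite all nE | ℕ.+-identityʳ nE = refl

  distinct-darts-≤deg : ∀ {k} v (f : Fin k → Dart) → (∀ i → vert (f i) ≡ v) →
                        (∀ i j → f i ≡ f j → i ≡ j) → k ≤ deg v
  distinct-darts-≤deg v f f-at f-inj =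
    listing-≤ (Fin-listing _) (countD-listing (λ d → vert d ==ᶠ v)) (λ i _ → f i)
      (λ i _ → trans (cong (_==ᶠ v) (f-at i)) (==ᶠ-refl v)) (λ i j _ _ → f-inj i j)

  code-injective : ∀ d d′ → code d ≡ code d′ → d ≡ d′
  code-injective (e , b) (e′ , b′) eq = help b b′ eq
    where
    normal : ∀ m c → m * 2 + (if c then 1 else 0) ≡ (if c then suc (2 * m) else 2 * m)
    normal m true = trans (ℕ.+-comm (m * 2) 1) (cong suc (ℕ.*-comm m 2))
    normal m false = trans (ℕ.+-identityʳ (m * 2)) (ℕ.*-comm m 2)
    normal-eq : ∀ c c′ → toℕ e * 2 + (if c then 1 else 0) ≡ toℕ e′ * 2 + (if c′ then 1 else 0) →
                (if c then suc (2 * toℕ e) else 2 * toℕ e) ≡ (if c′ then suc (2 * toℕ e′) else 2 * toℕ e′)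
    normal-eq c c′ q = trans (sym (normal (toℕ e) c)) (trans q (normal (toℕ e′) c′))
    help : ∀ c c′ → code (e , c) ≡ code (e′ , c′) → (e , c) ≡ (e′ , c′)
    help false false q = cong (_, false) (Fin.toℕ-injective (ℕ.*-cancelˡ-≡ _ _ 2 (normal-eq false false q)))
    help true true q = cong (_, true) (Fin.toℕ-injective (ℕ.*-cancelˡ-≡ _ _ 2 (ℕ.suc-injective (normal-eq true true q))))
    help false true q = contradiction (normal-eq false true q) (ℕ.even≢odd (toℕ e) (toℕ e′))
    help true false q = contradiction (sym (normal-eq true false q)) (ℕ.even≢odd (toℕ e′) (toℕ e))

  reach-invariant : (Q : Fin nV → Set) → (∀ e → Q (tl e) ⇔ Q (hd e)) →
                    ∀ k u v → reachStep k u v ≡ true → Q u ⇔ Q v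
  reach-invariant Q inv zero u v p with ==ᶠ⇒≡ {x = u} {v} p
  ... | refl = ⇔-id _
  reach-invariant Q inv (suc k) u v p with ∨-true {reachStep k u v} p
  ... | inj₁ q = reach-invariant Q inv k u v q
  ... | inj₂ q with anyF-true {nE} q
  ... | e , s with ∨-true {reachStep k u (tl e) ∧ (hd e ==ᶠ v)} s
  ... | inj₁ t with ∧-true {reachStep k u (tl e)} t
  ... | r , h with ==ᶠ⇒≡ {x = hd e} h
  ... | refl = inv e ⇔-∘ reach-invariant Q inv k u (tl e) r
  reach-invariant Q inv (suc k) u v p | inj₂ q | e , s | inj₂ t
    with ∧-true {reachStep k u (hd e)} t
  ... | r , h with ==ᶠ⇒≡ {x = tl e} h
  ... | refl = ⇔-sym (inv e) ⇔-∘ reach-invariant Q inv k u (hd e) r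

  reach-suc : ∀ k u v → reachStep k u v ≡ true → reachStep (suc k) u v ≡ true
  reach-suc k u v p = ∨-introˡ _ p

  reach-hd : ∀ k u e → reachStep k u (tl e) ≡ true → reachStep (suc k) u (hd e) ≡ true
  reach-hd k u e p = ∨-introʳ (reachStep k u (hd e)) (anyF-intro {nE} e
    (∨-introˡ _ (∧-intro p (==ᶠ-refl (hd e)))))

  reach-tl : ∀ k u e → reachStep k u (hd e) ≡ true → reachStep (suc k) u (tl e) ≡ true
  reach-tl k u e p = ∨-introʳ (reachStep k u (tl e)) (anyF-intro {nE} e
    (∨-introʳ (reachStep k u (tl e) ∧ _) (∧-intro p (==ᶠ-refl (tl e)))))

  Stable : ℕ → Fin nV → Set
  Stable k u = ∀ v → reachStep (suc k) u v ≡ true → reachStep k u v ≡ true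

  Stable-suc : ∀ k u → Stable k u → Stable (suc k) u
  Stable-suc k u st v p with ∨-true {reachStep (suc k) u v} p
  ... | inj₁ q = q
  ... | inj₂ q with anyF-true {nE} q
  ... | e , s with ∨-true {reachStep (suc k) u (tl e) ∧ (hd e ==ᶠ v)} s
  ... | inj₁ t with ∧-true {reachStep (suc k) u (tl e)} t
  ... | r , h with ==ᶠ⇒≡ {x = hd e} h
  ... | refl = reach-hd k u e (st (tl e) r)
  Stable-suc k u st v p | inj₂ q | e , s | inj₂ t with ∧-true {reachStep (suc k) u (hd e)} t
  ... | r , h with ==ᶠ⇒≡ {x = tl e} h
  ... | refl = reach-tl k u e (st (hd e) r)

  -- Each round that is not yet stable adds a vertex. There are only `nV` vertices, so round `nV` is
  -- stable, which makes the bounded search `sameComp` closed under edges.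
  stable-or-large : ∀ k u → Stable k u ⊎ suc k ≤ count (reachStep k u)
  stable-or-large zero u = inj₂ (listing-≤ ⊤-listing (count-listing (reachStep 0 u)) (λ _ _ → u)
    (λ _ _ → ==ᶠ-refl u) (λ _ _ _ _ _ → refl))
  stable-or-large (suc k) u with stable-or-large k u
  ... | inj₁ st = inj₁ (Stable-suc k u st)
  ... | inj₂ large
    with Fin.any? (λ v → (reachStep (suc k) u v Bool.≟ true) ×-dec ¬? (reachStep k u v Bool.≟ true))
  ... | no none = inj₁ (Stable-suc k u stable)
    where
    stable : Stable k u
    stable v p with reachStep k u v Bool.≟ true
    ... | yes q = q
    ... | no ¬q = contradiction (v , p , ¬q) none
  ... | yes (v , p , ¬q) = inj₂ (ℕ.≤-trans (s≤s large)
    (listing-≤ (⊎-listing ⊤-listing (count-listing (reachStep k u))) (count-listing (reachStep (suc k) u))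
      (λ { (inj₁ _) _ → v ; (inj₂ x) _ → x })
      (λ { (inj₁ _) _ → p ; (inj₂ x) r → reach-suc k u x r })
      (λ { (inj₁ _) (inj₁ _) _ _ _ → refl
         ; (inj₁ _) (inj₂ _) _ r refl → contradiction r ¬q
         ; (inj₂ _) (inj₁ _) r _ refl → contradiction r ¬q
         ; (inj₂ _) (inj₂ _) _ _ e → cong inj₂ e })))

  sameComp-stable : ∀ u → Stable nV u
  sameComp-stable u with stable-or-large nV u
  ... | inj₁ st = st
  ... | inj₂ large = contradiction (ℕ.≤-trans large
    (listing-≤ (count-listing (reachStep nV u)) (Fin-listing nV) (λ v _ → v) (λ _ _ → refl)
      (λ _ _ _ _ e → e))) (ℕ.n≮n nV)

  sameComp-edge : ∀ u e → sameComp u (tl e) ≡ true ⇔ sameComp u (hd e) ≡ true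
  sameComp-edge u e = mk⇔ (λ p → sameComp-stable u (hd e) (reach-hd nV u e p))
                          (λ p → sameComp-stable u (tl e) (reach-tl nV u e p))

  sameComp-refl : ∀ u → sameComp u u ≡ true
  sameComp-refl u = go nV
    where
    go : ∀ k → reachStep k u u ≡ true
    go zero = ==ᶠ-refl u
    go (suc k) = reach-suc k u u (go k)

  sameComp-cong : ∀ {u v} → sameComp u v ≡ true → ∀ x → sameComp x u ≡ true ⇔ sameComp x v ≡ true
  sameComp-cong {u} {v} p x = reach-invariant (λ y → sameComp x y ≡ true) (sameComp-edge x) nV u v p

  sameComp-vert : ∀ u e b b′ → sameComp u (vert (e , b)) ≡ true → sameComp u (vert (e , b′)) ≡ true
  sameComp-vert u e false false p = p
  sameComp-vert u e false true p = Equivalence.to (sameComp-edge u e) p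
  sameComp-vert u e true false p = Equivalence.from (sameComp-edge u e) p
  sameComp-vert u e true true p = p

-- Matchings as ownership of edges; connectedness of the graph.

module Matchings (G : PlaneGraph) where
  open PlaneGraph G
  open Components graph public

  Black : Set
  Black = Fin nV ⊎ Fin nF

  _≟ᵇ_ : DecidableEquality Black
  _≟ᵇ_ = Sum.≡-dec _≟ᶠ_ _≟ᶠ_

  Sides : Fin nE → Maybe (Fin nF) → Maybe (Fin nF) → Set
  Sides e x y = (face (e , false) ≡ x × face (e , true) ≡ y) ⊎ (face (e , false) ≡ y × face (e , true) ≡ x)

  -- The edge e is incident with the first argument; the second one is the vertex
  -- or face on the other side of e (nothing being the unbounded face).
  data Across (e : Fin nE) : Black → Maybe Black → Set where
    ends : ∀ {u v} → Ends e u v → Across e (inj₁ u) (just (inj₁ v))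
    sides : ∀ {f g} → Sides e (just f) (just g) → Across e (inj₂ f) (just (inj₂ g))
    outside : ∀ {f} → Sides e (just f) nothing → Across e (inj₂ f) nothing

  -- A perfect matching of H minus the original vertex r, read from the side of
  -- the edge-vertices.
  record Temperley (r : Fin nV) : Set where
    field
      owner : Fin nE → Black
      across : ∀ e → ∃ (Across e (owner e))
      owner-injective : ∀ {e e′} → owner e ≡ owner e′ → e ≡ e′
      owner≢root : ∀ e → owner e ≢ inj₁ r
      edgeOf : ∀ x → x ≢ inj₁ r → ∃ λ e → owner e ≡ x

  φ-α : ∀ d → φ (α d) ≡ σ d
  φ-α d = cong σ (α-involutive d)

  face-σ : ∀ d → face (σ d) ≡ face (α d)
  face-σ d = trans (cong face (sym (φ-α d))) (face-φ (α d))

  vert-φ : ∀ d → vert (φ d) ≡ vert (α d)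
  vert-φ d = σ-vert (α d)

  dart-at : ∀ {e v m} → Across e (inj₁ v) m → ∃ λ b → vert (e , b) ≡ v
  dart-at (ends (inj₁ (p , _))) = false , p
  dart-at (ends (inj₂ (_ , p))) = true , p

  dart-along : ∀ {e f m} → Across e (inj₂ f) m → ∃ λ b → face (e , b) ≡ just f
  dart-along (sides (inj₁ (p , _))) = false , p
  dart-along (sides (inj₂ (_ , p))) = true , p
  dart-along (outside (inj₁ (p , _))) = false , p
  dart-along (outside (inj₂ (_ , p))) = true , p

  orbit-comp : ∀ {d d′} u → SameOrbit d d′ → sameComp u (vert d) ≡ true → sameComp u (vert d′) ≡ true
  orbit-comp u (k , refl) = go k
    where
    go : ∀ {d} k → sameComp u (vert d) ≡ true → sameComp u (vert (iter φ k d)) ≡ true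
    go zero p = p
    go {d} (suc k) p with iter φ k d | go {d} k p
    ... | (e , b) | q = subst (λ v → sameComp u v ≡ true) (sym (vert-φ (e , b))) (sameComp-vert u e b (not b) q)

  orbit-face : ∀ {d d′} → SameOrbit d d′ → face d ≡ face d′
  orbit-face (k , refl) = go k
    where
    go : ∀ {d} k → face d ≡ face (iter φ k d)
    go zero = refl
    go (suc k) = trans (go k) (sym (face-φ _))

  rep-code≤ : ∀ {d d′} → orbRep d ≡ true → SameOrbit d d′ → code d ≤ code d′
  rep-code≤ {d} rep (k , eq) with iter-shorten dart-listing φ d k
  ... | j , j<2nE , eq′ = subst (λ x → code d ≤ code x) (trans eq′ eq)
    (ℕ.≤ᵇ⇒≤ _ _ (Equivalence.from Bool.T-≡ (allBelow-true (2 * nE) rep j<2nE)))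

  rep-unique : ∀ {d d′} → orbRep d ≡ true → orbRep d′ ≡ true → SameOrbit d d′ → SameOrbit d′ d → d ≡ d′
  rep-unique {d} {d′} rep rep′ o o′ =
    code-injective d d′ (ℕ.≤-antisym (rep-code≤ rep o) (rep-code≤ rep′ o′))

  -- A walk that is not outer borders a bounded face, so a dart on the unbounded face is outer. The
  -- component has only one outer walk, and all darts of a walk see the same face.
  bounded⇒inner : ∀ {d f} → face d ≡ just f → outer d ≡ true → ∀ {d′} → face d′ ≡ nothing →
                  sameComp (vert d) (vert d′) ≡ true → ⊥
  bounded⇒inner {d} {f} fd od {d′} fd′ comp = case trans (sym fd) (trans (orbit-face orbit) fd′) of λ ()
    where
    od′ : outer d′ ≡ true
    od′ with outer d′ in eq
    ... | true = refl
    ... | false = case trans (sym fd′) (proj₂ (inner-bounded d′ eq)) of λ ()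
    orbit = outer-unique d d′ od od′ (Equivalence.from Bool.T-≡ comp)

  -- Count the component K of largest rank among those missing r: its vertices and
  -- inner faces own distinct edges of K, one more than Euler's formula allows.
  module Connectedness {r : Fin nV} (M : Temperley r) (d₀ : Dart) (at-root : vert d₀ ≡ r)
                       (d₀-outside : face d₀ ≡ nothing) where
    open Temperley M

    rank-comp : ∀ {u v} → sameComp u v ≡ true → rank u ≡ rank v
    rank-comp {u} {v} p = Equivalence.to
      (reach-invariant (λ x → rank u ≡ rank x)
        (λ e → mk⇔ (λ q → trans q (rank-edge e)) (λ q → trans q (sym (rank-edge e)))) nV u v p) refl

    module Other (u : Fin nV) (far : sameComp r u ≢ true)
                 (top : ∀ v → sameComp r v ≢ true → rank v ≤ rank u) where

      far-comp : ∀ {v} → sameComp u v ≡ true → sameComp r v ≢ true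
      far-comp p q = far (Equivalence.from (sameComp-cong p r) q)

      v≢r : ∀ {v} → sameComp u v ≡ true → _≢_ {A = Black} (inj₁ v) (inj₁ r)
      v≢r p refl = far-comp p (sameComp-refl r)

      InnerRep : Dart → Bool
      InnerRep d = (sameComp u (vert d) ∧ orbRep d) ∧ not (outer d)

      innerRep : ∀ d → InnerRep d ≡ true →
                 sameComp u (vert d) ≡ true × orbRep d ≡ true × outer d ≡ false
      innerRep d p with ∧-true {sameComp u (vert d) ∧ orbRep d} p
      ... | q , o with ∧-true {sameComp u (vert d)} q
      ... | c , rep with outer d
      ... | false = c , rep , refl

      label : Bool → Dart → ⊤ ⊎ Dart
      label true d = inj₁ tt
      label false d = inj₂ d

      -- The outer walk of a component is unique, so sending outer representatives to a single point
      -- identifies no two of them.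
      orbits≤ : compOrbits u ≤ 1 + countD InnerRep
      orbits≤ = listing-≤ (countD-listing (λ d → sameComp u (vert d) ∧ orbRep d))
        (⊎-listing ⊤-listing (countD-listing InnerRep)) (λ d _ → label (outer d) d) snd inj
        where
        snd : ∀ d → sameComp u (vert d) ∧ orbRep d ≡ true → [ (λ _ → true) , InnerRep ]′ (label (outer d) d) ≡ true
        snd d p with outer d in o
        ... | true = refl
        ... | false = ∧-intro p (cong not o)
        inj : ∀ d d′ → sameComp u (vert d) ∧ orbRep d ≡ true → sameComp u (vert d′) ∧ orbRep d′ ≡ true →
              label (outer d) d ≡ label (outer d′) d′ → d ≡ d′
        inj d d′ p p′ eq with outer d in o | outer d′ in o′
        ... | false | false = Sum.inj₂-injective eq
        ... | true | true with ∧-true {sameComp u (vert d)} p | ∧-true {sameComp u (vert d′)} p′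
        ... | c , rep | c′ , rep′ = rep-unique rep rep′
          (outer-unique d d′ o o′ (Equivalence.from Bool.T-≡ (joined c c′)))
          (outer-unique d′ d o′ o (Equivalence.from Bool.T-≡ (joined c′ c)))
          where
          joined : ∀ {x y} → sameComp u x ≡ true → sameComp u y ≡ true → sameComp x y ≡ true
          joined {x} p q = Equivalence.to (sameComp-cong q x) (Equivalence.from (sameComp-cong p x) (sameComp-refl x))

      inner-face : ∀ d → InnerRep d ≡ true → ∃ λ f → face d ≡ just f
      inner-face d p = inner-bounded d (proj₂ (proj₂ (innerRep d p)))

      edge : ∀ x → [ sameComp u , InnerRep ]′ x ≡ true → Fin nE
      edge (inj₁ v) p = proj₁ (edgeOf (inj₁ v) (v≢r p))
      edge (inj₂ d) p = proj₁ (edgeOf (inj₂ (proj₁ (inner-face d p))) λ ())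

      edge-owner₁ : ∀ v p → owner (edge (inj₁ v) p) ≡ inj₁ v
      edge-owner₁ v p = proj₂ (edgeOf (inj₁ v) (v≢r p))

      edge-owner₂ : ∀ d p → owner (edge (inj₂ d) p) ≡ inj₂ (proj₁ (inner-face d p))
      edge-owner₂ d p = proj₂ (edgeOf (inj₂ (proj₁ (inner-face d p))) λ ())

      edge-sound : ∀ x p → sameComp u (tl (edge x p)) ≡ true
      edge-sound (inj₁ v) p with edge (inj₁ v) p | edge-owner₁ v p
      ... | e | o with dart-at (subst (λ x → Across e x _) o (proj₂ (across e)))
      ... | b , refl = sameComp-vert u e b false p
      edge-sound (inj₂ d) p with edge (inj₂ d) p | edge-owner₂ d p
      ... | e | o with dart-along (subst (λ x → Across e x _) o (proj₂ (across e)))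
      ... | b , fd with outer (e , b) in oe
      ... | false = sameComp-vert u e b false
        (orbit-comp u (enclose-unique d (e , b) (proj₂ (proj₂ (innerRep d p))) oe (trans (proj₂ (inner-face d p)) (sym fd))) (proj₁ (innerRep d p)))
      -- Here the owned edge lies on the outer walk of a component nested in the face. That
      -- component has larger rank, against the choice of `u`; it cannot be the component of `r`,
      -- which touches the unbounded face at `d₀`.
      ... | true = contradiction
        (ℕ.≤-trans (nest (e , b) d oe (proj₂ (proj₂ (innerRep d p))) (trans fd (sym (proj₂ (inner-face d p)))))
          (ℕ.≤-trans (top (vert (e , b)) not-root) (ℕ.≤-reflexive (rank-comp (proj₁ (innerRep d p)))))) (ℕ.n≮n _)
        where
        not-root : sameComp r (vert (e , b)) ≢ true
        not-root q = bounded⇒inner fd oe d₀-outside (subst (λ x → sameComp (vert (e , b)) x ≡ true) (sym at-root)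
          (Equivalence.from (sameComp-cong q _) (sameComp-refl _)))

      edge-injective : ∀ x y p q → edge x p ≡ edge y q → x ≡ y
      edge-injective (inj₁ v) (inj₁ v′) p q eq =
        cong inj₁ (Sum.inj₁-injective (trans (sym (edge-owner₁ v p)) (trans (cong owner eq) (edge-owner₁ v′ q))))
      edge-injective (inj₁ v) (inj₂ d) p q eq =
        case trans (sym (edge-owner₁ v p)) (trans (cong owner eq) (edge-owner₂ d q)) of λ ()
      edge-injective (inj₂ d) (inj₁ v) p q eq =
        case trans (sym (edge-owner₂ d p)) (trans (cong owner eq) (edge-owner₁ v q)) of λ ()
      edge-injective (inj₂ d) (inj₂ d′) p q eq =
        cong inj₂ (rep-unique (rep d p) (rep d′ q) (enclose-unique d d′ (inner d p) (inner d′ q) same)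
          (enclose-unique d′ d (inner d′ q) (inner d p) (sym same)))
        where
        rep : ∀ x → InnerRep x ≡ true → orbRep x ≡ true
        rep x s = proj₁ (proj₂ (innerRep x s))
        inner : ∀ x → InnerRep x ≡ true → outer x ≡ false
        inner x s = proj₂ (proj₂ (innerRep x s))
        same : face d ≡ face d′
        same = trans (proj₂ (inner-face d p)) (trans
          (cong just (Sum.inj₂-injective (trans (sym (edge-owner₂ d p)) (trans (cong owner eq) (edge-owner₂ d′ q)))))
          (sym (proj₂ (inner-face d′ q))))

      owned≤ : compV u + countD InnerRep ≤ compE u
      owned≤ = listing-≤ (⊎-listing (count-listing (sameComp u)) (countD-listing InnerRep))
        (count-listing (λ e → sameComp u (tl e))) edge edge-sound edge-injective

      1≤deg : 1 ≤ deg u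
      1≤deg with edgeOf (inj₁ u) (v≢r (sameComp-refl u))
      ... | e , o with dart-at (subst (λ x → Across e x _) o (proj₂ (across e)))
      ... | b , at = distinct-darts-≤deg {1} u (λ _ → e , b) (λ _ → at) (λ { zero zero _ → refl })

      impossible : ⊥
      impossible = ℕ.n≮n (suc (compE u)) (begin
        suc (suc (compE u))            ≡⟨ euler u 1≤deg ⟨
        compV u + compOrbits u         ≤⟨ ℕ.+-monoʳ-≤ (compV u) orbits≤ ⟩
        compV u + suc (countD InnerRep) ≡⟨ ℕ.+-suc (compV u) _ ⟩
        suc (compV u + countD InnerRep) ≤⟨ s≤s owned≤ ⟩
        suc (compE u)                  ∎)
        where open ℕ.≤-Reasoning

    connected : ∀ v → sameComp r v ≡ true
    connected v with sameComp r v Bool.≟ true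
    ... | yes p = p
    ... | no ¬p with argmax (λ x → ¬? (sameComp r x Bool.≟ true)) rank (v , ¬p)
    ... | u , far , top = ⊥-elim (Other.impossible u far top)

-- Walking around a rooted tree in a rotation system.

-- Out x d says that d is the dart along which x is joined to its parent; P is
-- an invariant of the walk around the tree formed by these darts.  Around a vertex
-- each dart links to the next one, through the excursion into a child if need be, and
-- only the link at the dart to the parent is missing: one gap does not disconnect
-- the cyclic order.
module Contour
  {D X : Set} (_≟D_ : DecidableEquality D) (_≟X_ : DecidableEquality X)
  (N : ℕ) (index : X → Fin N) (index-injective : ∀ {x y} → index x ≡ index y → x ≡ y)
  (flip : D → D) (flip-involutive : ∀ d → flip (flip d) ≡ d)
  (s : D → D) (at : D → X) (at-s : ∀ d → at (s d) ≡ at d)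
  (s-cyclic : ∀ d d′ → at d ≡ at d′ → ∃ λ k → iter s k d ≡ d′)
  (root : X) (Out : X → D → Set) (out-at : ∀ {x d} → Out x d → at d ≡ x)
  (out-unique : ∀ {x d d′} → Out x d → Out x d′ → d ≡ d′)
  (out-exists : ∀ x → x ≢ root → ∃ (Out x)) (root-out : ∀ {d} → ¬ Out root d)
  where

  -- Being inductive, it excludes every point whose chain of parents runs into a cycle. The points
  -- with a depth form the tree component of the root.
  data Depth : X → ℕ → Set where
    stop : Depth root 0
    go : ∀ {x d t} → Out x d → Depth (at (flip d)) t → Depth x (suc t)

  Depth-unique : ∀ {x t t′} → Depth x t → Depth x t′ → t ≡ t′
  Depth-unique stop stop = refl
  Depth-unique stop (go o _) = contradiction o root-out
  Depth-unique (go o _) stop = contradiction o root-out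
  Depth-unique (go o p) (go o′ q) with out-unique o o′
  ... | refl = cong suc (Depth-unique p q)

  Depth-parent : ∀ {x d t} → Out x d → Depth x t → ∃ λ t′ → t ≡ suc t′ × Depth (at (flip d)) t′
  Depth-parent o stop = contradiction o root-out
  Depth-parent o (go o′ p) with out-unique o o′
  ... | refl = _ , refl , p

  ancestor : ∀ {x t} → Depth x t → ∀ i → i ≤ t → ∃ λ y → Depth y i
  ancestor p i i≤t with ℕ.m≤n⇒m<n∨m≡n i≤t
  ancestor p i i≤t | inj₂ refl = _ , p
  ancestor (go o p) i i≤t | inj₁ i<t = ancestor p i (s≤s⁻¹ i<t)

  -- The `t + 1` points on the chain to the root have different depths, so they are distinct.
  Depth-bound : ∀ {x t} → Depth x t → t < N
  Depth-bound {t = t} p = listing-≤ (Fin-listing (suc t)) (Fin-listing N)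
    (λ i _ → index (proj₁ (anc i))) (λ _ _ → refl)
    (λ i j _ _ eq → Fin.toℕ-injective (Depth-unique (proj₂ (anc i))
      (subst (λ y → Depth y (toℕ j)) (sym (index-injective eq)) (proj₂ (anc j)))))
    where
    anc : (i : Fin (suc t)) → ∃ λ y → Depth y (toℕ i)
    anc i = ancestor p (toℕ i) (s≤s⁻¹ (Fin.toℕ<n i))

  -- `along` carries `P` along the two sides of a tree edge. `cross` carries it past a dart, unless
  -- the dart belongs to a tree edge, seen from the child or from the parent.
  module Invariant
    (P : D → Set) (along : ∀ {x o} → Out x o → (P o ⇔ P (s (flip o))) × (P (flip o) ⇔ P (s o)))
    (cross : ∀ d → (P d ⇔ P (s d)) ⊎ Out (at d) d ⊎ Out (at (flip d)) (flip d))
    where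

    -- The alternative `s y ≡ b` closes the turn: the walk is back at `b`, where the equivalence is
    -- trivial. One missing link just before `b` therefore does no harm.
    turn : ∀ {x} b → at b ≡ x → (∀ y → at y ≡ x → (P y ⇔ P (s y)) ⊎ s y ≡ b) →
           ∀ k → at (iter s k b) ≡ x × (P b ⇔ P (iter s k b))
    turn b at-b links zero = at-b , ⇔-id _
    turn b at-b links (suc k) with turn b at-b links k
    ... | at-y , link with links (iter s k b) at-y
    ... | inj₁ next = trans (at-s _) at-y , next ⇔-∘ link
    ... | inj₂ eq = trans (at-s _) at-y , subst (λ y → P b ⇔ P y) (sym eq) (⇔-id _)

    -- The induction starts at the greatest depth and moves towards the root: a point at depth `t`
    -- uses its children at depth `t + 1`.
    constant-above : ∀ m {x t} → Depth x t → t + m ≡ N → ∀ {d d′} → at d ≡ x → at d′ ≡ x → P d ⇔ P d′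
    constant-above zero {t = t} p eq = contradiction (Depth-bound p)
      (subst (λ n → ¬ t < n) (trans (sym (ℕ.+-identityʳ t)) eq) (ℕ.n≮n t))
    constant-above (suc m) {x} {t} p eq {d} {d′} at-d at-d′ = around (x ≟X root)
      where
      link : ∀ y → at y ≡ x → ¬ Out x y → P y ⇔ P (s y)
      link y refl ¬out with cross y
      ... | inj₁ l = l
      ... | inj₂ (inj₁ o) = contradiction o ¬out
      -- The dart `y` leads to a child: go there along one side of the tree edge, turn around the
      -- child by induction, and return along the other side.
      ... | inj₂ (inj₂ o) = subst (λ z → P (flip y) ⇔ P (s z)) (flip-involutive y) (proj₁ (along o))
        ⇔-∘ (constant-above m (go o (subst (λ z → Depth (at z) t) (sym (flip-involutive y)) p))
               (trans (sym (ℕ.+-suc t m)) eq) (at-s _) refl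
        ⇔-∘ subst (λ z → P z ⇔ P (s (flip y))) (flip-involutive y) (proj₂ (along o)))
      spin : ∀ b → at b ≡ x → (∀ y → at y ≡ x → (P y ⇔ P (s y)) ⊎ s y ≡ b) → ∀ c → at c ≡ x → P b ⇔ P c
      spin b at-b links c at-c with s-cyclic b c (trans at-b (sym at-c))
      ... | k , refl = proj₂ (turn b at-b links k)
      around : Dec (x ≡ root) → P d ⇔ P d′
      around (yes refl) = spin d at-d (λ y at-y → inj₁ (link y at-y root-out)) d′ at-d′
      around (no x≢root) with out-exists x x≢root
      -- Both darts are reached from the one after the parent dart `o`; the only unlinked turn, past
      -- `o`, leads back to that starting dart.
      ... | o , out = from-o d′ at-d′ ⇔-∘ ⇔-sym (from-o d at-d)
        where
        links : ∀ y → at y ≡ x → (P y ⇔ P (s y)) ⊎ s y ≡ s o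
        links y at-y with y ≟D o
        ... | yes refl = inj₂ refl
        ... | no y≢o = inj₁ (link y at-y (λ out′ → y≢o (out-unique out′ out)))
        from-o : ∀ c → at c ≡ x → P (s o) ⇔ P c
        from-o = spin (s o) (trans (at-s o) (out-at out)) links

    constant : ∀ {x t} → Depth x t → ∀ {d d′} → at d ≡ x → at d′ ≡ x → P d ⇔ P d′
    constant {t = t} p = constant-above (N ∸ t) p (ℕ.m+[n∸m]≡n (ℕ.<⇒≤ (Depth-bound p)))

    constant-to-root : ∀ {x t} → Depth x t → ∀ {d d₀} → at d ≡ x → at d₀ ≡ root → P d ⇔ P d₀
    constant-to-root stop at-d at-d₀ = constant stop at-d at-d₀
    constant-to-root (go o p) at-d at-d₀ =
      constant-to-root p (at-s _) at-d₀ ⇔-∘ (proj₁ (along o) ⇔-∘ constant (go o p) at-d (out-at o))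

-- Every chain of owners ends: levels of vertices and faces.

module Flow (G : PlaneGraph) where
  open PlaneGraph G
  open Matchings G

  record Levels {r : Fin nV} (M : Temperley r) : Set where
    open Temperley M
    field
      level : Black → ℕ
      level-step : ∀ {e x y} → owner e ≡ x → Across e x (just y) → level x ≡ suc (level y)
      height : ℕ
      level≤height : ∀ x → level x ≤ height

  module _ {r : Fin nV} (M : Temperley r) (d₀ : Dart) (at-root : vert d₀ ≡ r)
           (d₀-outside : face d₀ ≡ nothing) where
    open Temperley M

    connected : ∀ u v → sameComp u v ≡ true
    connected u v = Equivalence.to (sameComp-cong (C.connected v) u)
      (Equivalence.from (sameComp-cong (C.connected u) u) (sameComp-refl u))
      where module C = Connectedness M d₀ at-root d₀-outside

    -- With a connected graph every face, the unbounded one included, is bordered by a single walk.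
    -- Hence `φ` is cyclic at each face and can play the part of the rotation in the dual tree.
    same-face⇒same-orbit : ∀ d d′ → face d ≡ face d′ → SameOrbit d d′
    same-face⇒same-orbit d d′ same with outer d in o | outer d′ in o′
    ... | false | false = enclose-unique d d′ o o′ same
    ... | true | true = outer-unique d d′ o o′ (Equivalence.from Bool.T-≡ (connected _ _))
    ... | true | false = ⊥-elim (bounded⇒inner (trans same (proj₂ (inner-bounded d′ o′))) o d₀-outside (connected _ _))
    ... | false | true =
      ⊥-elim (bounded⇒inner (trans (sym same) (proj₂ (inner-bounded d o))) o′ d₀-outside (connected _ _))

    record VertexOut (v : Fin nV) (d : Dart) : Set where
      constructor _,_
      field
        owned : owner (proj₁ d) ≡ inj₁ v
        at : vert d ≡ v

    -- If e borders f on both sides, the dart (e , false) is chosen.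
    data FaceOut : Maybe (Fin nF) → Dart → Set where
      chosen : ∀ {f d} → owner (proj₁ d) ≡ inj₂ f → face d ≡ just f →
               (proj₂ d ≡ true → face (α d) ≢ just f) → FaceOut (just f) d

    owned-dart : ∀ v e → owner e ≡ inj₁ v → ∃ λ b → vert (e , b) ≡ v
    owned-dart v e o = dart-at (subst (λ x → Across e x _) o (proj₂ (across e)))

    vertexOut-unique : ∀ {v d d′} → VertexOut v d → VertexOut v d′ → d ≡ d′
    vertexOut-unique {d = e , b} {e′ , b′} (o , p) (o′ , p′) with owner-injective (trans o (sym o′))
    vertexOut-unique {d = e , false} {e′ , false} _ _ | refl = refl
    vertexOut-unique {d = e , true} {e′ , true} _ _ | refl = refl
    vertexOut-unique {d = e , false} {e′ , true} (_ , p) (_ , p′) | refl = contradiction (trans p (sym p′)) (loopless e)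
    vertexOut-unique {d = e , true} {e′ , false} (_ , p) (_ , p′) | refl = contradiction (trans p′ (sym p)) (loopless e)

    vertexOut-exists : ∀ v → v ≢ r → ∃ (VertexOut v)
    vertexOut-exists v v≢r with edgeOf (inj₁ v) (v≢r ∘ Sum.inj₁-injective)
    ... | e , o with owned-dart v e o
    ... | b , p = (e , b) , o , p

    faceOut-along : ∀ {x d} → FaceOut x d → face d ≡ x
    faceOut-along (chosen _ p _) = p

    faceOut-unique : ∀ {x d d′} → FaceOut x d → FaceOut x d′ → d ≡ d′
    faceOut-unique {just f} {e , b} {e′ , b′} (chosen o _ _) (chosen o′ _ _) with owner-injective (trans o (sym o′))
    faceOut-unique {just f} {e , false} {e′ , false} _ _ | refl = refl
    faceOut-unique {just f} {e , true} {e′ , true} _ _ | refl = refl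
    faceOut-unique {just f} {e , false} {e′ , true} (chosen _ p _) (chosen _ _ n) | refl = contradiction p (n refl)
    faceOut-unique {just f} {e , true} {e′ , false} (chosen _ _ n) (chosen _ p _) | refl = contradiction p (n refl)

    owned-faceOut : ∀ f e → owner e ≡ inj₂ f → ∃ λ b → FaceOut (just f) (e , b)
    owned-faceOut f e o with Maybe.≡-dec _≟ᶠ_ (face (e , false)) (just f)
    ... | yes p = false , chosen o p λ ()
    ... | no ¬p with dart-along (subst (λ x → Across e x _) o (proj₂ (across e)))
    ... | false , p = contradiction p ¬p
    ... | true , p = true , chosen o p λ _ → ¬p

    faceOut-exists : ∀ x → x ≢ nothing → ∃ (FaceOut x)
    faceOut-exists nothing x≢ = contradiction refl x≢
    faceOut-exists (just f) _ with edgeOf (inj₂ f) (λ ())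
    ... | e , o with owned-faceOut f e o
    ... | b , out = (e , b) , out

    faceOut-nothing : ∀ {d} → ¬ FaceOut nothing d
    faceOut-nothing ()

    faceIndex : Maybe (Fin nF) → Fin (suc nF)
    faceIndex nothing = zero
    faceIndex (just f) = suc f

    faceIndex-injective : ∀ {x y} → faceIndex x ≡ faceIndex y → x ≡ y
    faceIndex-injective {nothing} {nothing} _ = refl
    faceIndex-injective {just f} {just .f} refl = refl

    _≟D_ : DecidableEquality Dart
    _≟D_ = Product.≡-dec _≟ᶠ_ Bool._≟_

    root-out : ∀ {d} → ¬ VertexOut r d
    root-out {e , _} (o , _) = owner≢root e o

    vertexOut-at : ∀ {v d} → VertexOut v d → vert d ≡ v
    vertexOut-at = VertexOut.at

    module Primal = Contour _≟D_ _≟ᶠ_ nV id id α α-involutive σ vert σ-vert σ-cyclic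
      r VertexOut vertexOut-at vertexOut-unique vertexOut-exists root-out
    module Dual = Contour _≟D_ (Maybe.≡-dec _≟ᶠ_) (suc nF) faceIndex faceIndex-injective α α-involutive
      φ face face-φ same-face⇒same-orbit nothing FaceOut faceOut-along faceOut-unique faceOut-exists faceOut-nothing

    Drains : Fin nV → Set
    Drains v = ∃ (Primal.Depth v)

    Drainsᶠ : Maybe (Fin nF) → Set
    Drainsᶠ x = ∃ (Dual.Depth x)

    drains-out : ∀ {v d} → VertexOut v d → Drains v ⇔ Drains (vert (α d))
    drains-out out = mk⇔ (λ (_ , p) → _ , proj₂ (proj₂ (Primal.Depth-parent out p))) (λ (_ , p) → _ , Primal.go out p)

    drainsᶠ-out : ∀ {x d} → FaceOut x d → Drainsᶠ x ⇔ Drainsᶠ (face (α d))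
    drainsᶠ-out out = mk⇔ (λ (_ , p) → _ , proj₂ (proj₂ (Dual.Depth-parent out p))) (λ (_ , p) → _ , Dual.go out p)

    same-edge : ∀ e b b′ → (e , b) ≡ (e , b′) ⊎ (e , b) ≡ α (e , b′)
    same-edge e false false = inj₁ refl
    same-edge e true true = inj₁ refl
    same-edge e false true = inj₂ refl
    same-edge e true false = inj₂ refl

    drains-across : ∀ {v} d → owner (proj₁ d) ≡ inj₁ v → Drains (vert d) ⇔ Drains (vert (α d))
    drains-across (e , b) o with owned-dart _ e o
    ... | b′ , refl with same-edge e b b′
    ... | inj₁ refl = drains-out {d = e , b′} (o , refl)
    ... | inj₂ refl = ⇔-sym (subst (λ d → Drains (vert d) ⇔ Drains (vert (α (e , b′)))) (sym (α-involutive (e , b′)))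
      (drains-out {d = e , b′} (o , refl)))

    drainsᶠ-across : ∀ {f} d → owner (proj₁ d) ≡ inj₂ f → Drainsᶠ (face d) ⇔ Drainsᶠ (face (α d))
    drainsᶠ-across {f} (e , b) o with owned-faceOut f e o
    ... | b′ , out with same-edge e b b′ | subst (λ x → Drainsᶠ x ⇔ Drainsᶠ (face (α (e , b′)))) (sym (faceOut-along out)) (drainsᶠ-out out)
    ... | inj₁ refl | equiv = equiv
    ... | inj₂ refl | equiv =
      ⇔-sym (subst (λ d → Drainsᶠ (face d) ⇔ Drainsᶠ (face (α (e , b′)))) (sym (α-involutive (e , b′))) equiv)

    primal-along : ∀ {v o} → VertexOut v o → (Drainsᶠ (face o) ⇔ Drainsᶠ (face (σ (α o)))) ×
                   (Drainsᶠ (face (α o)) ⇔ Drainsᶠ (face (σ o)))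
    primal-along {o = o} _ =
        subst (λ y → Drainsᶠ (face o) ⇔ Drainsᶠ y) (sym (face-φ o)) (⇔-id _)
      , subst (λ y → Drainsᶠ (face (α o)) ⇔ Drainsᶠ y) (sym (face-σ o)) (⇔-id _)

    -- An edge owned by a face joins its two sides in the dual graph, so both drain or neither does.
    -- An edge owned by a vertex is the parent edge of one of its ends.
    primal-crossing : ∀ d → (Drainsᶠ (face d) ⇔ Drainsᶠ (face (σ d))) ⊎ VertexOut (vert d) d ⊎ VertexOut (vert (α d)) (α d)
    primal-crossing (e , b) with owner e in o
    ... | inj₂ f = inj₁ (subst (λ y → Drainsᶠ (face (e , b)) ⇔ Drainsᶠ y) (sym (face-σ (e , b))) (drainsᶠ-across (e , b) o))
    ... | inj₁ v with owned-dart v e o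
    ... | b′ , p with same-edge e b′ b
    ... | inj₁ refl = inj₂ (inj₁ (trans o (cong inj₁ (sym p)) , refl))
    ... | inj₂ refl = inj₂ (inj₂ (trans o (cong inj₁ (sym p)) , refl))

    module PrimalInvariant = Primal.Invariant (Drainsᶠ ∘ face) primal-along primal-crossing

    dual-along : ∀ {x o} → FaceOut x o → (Drains (vert o) ⇔ Drains (vert (φ (α o)))) ×
                 (Drains (vert (α o)) ⇔ Drains (vert (φ o)))
    dual-along {o = o} _ =
        subst (λ v → Drains (vert o) ⇔ Drains v) (sym (trans (vert-φ (α o)) (cong vert (α-involutive o)))) (⇔-id _)
      , subst (λ v → Drains (vert (α o)) ⇔ Drains v) (sym (vert-φ o)) (⇔-id _)

    dual-crossing : ∀ d → (Drains (vert d) ⇔ Drains (vert (φ d))) ⊎ FaceOut (face d) d ⊎ FaceOut (face (α d)) (α d)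
    dual-crossing (e , b) with owner e in o
    ... | inj₁ v = inj₁ (subst (λ y → Drains (vert (e , b)) ⇔ Drains y) (sym (vert-φ (e , b))) (drains-across (e , b) o))
    ... | inj₂ f with owned-faceOut f e o
    ... | b′ , out with same-edge e b′ b
    ... | inj₁ refl = inj₂ (inj₁ (subst (λ x → FaceOut x (e , b)) (sym (faceOut-along out)) out))
    ... | inj₂ refl = inj₂ (inj₂ (subst (λ x → FaceOut x (α (e , b))) (sym (faceOut-along out)) out))

    module DualInvariant = Dual.Invariant (Drains ∘ vert) dual-along dual-crossing

    -- If a face owns the edge, the detour is through the faces: the contour of the tree at the root
    -- shows that `face d` drains, and then the contour of the dual tree shows that every vertex on
    -- that face drains, among them the far end of `d`.
    drains-edge : ∀ d → Drains (vert d) → Drains (vert (α d))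
    drains-edge (e , b) flow with owner e in o
    ... | inj₁ v = Equivalence.to (drains-across (e , b) o) flow
    ... | inj₂ f = subst Drains (vert-φ (e , b))
      (Equivalence.from (DualInvariant.constant-to-root (proj₂ face-drains) (face-φ (e , b)) d₀-outside)
        (subst Drains (sym at-root) (0 , Primal.stop)))
      where
      face-drains : Drainsᶠ (face (e , b))
      face-drains = Equivalence.from (PrimalInvariant.constant-to-root (proj₂ flow) refl at-root)
        (subst Drainsᶠ (sym d₀-outside) (0 , Dual.stop))

    drains : ∀ v → Drains v
    drains v = Equivalence.to (reach-invariant Drains
      (λ e → mk⇔ (drains-edge (e , false)) (drains-edge (e , true))) nV r v (connected r v)) (0 , Primal.stop)

    drainsᶠ : ∀ x → Drainsᶠ x
    drainsᶠ nothing = 0 , Dual.stop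
    drainsᶠ (just f) with enclose-exists f
    ... | d , _ , refl′ = subst Drainsᶠ refl′
      (Equivalence.from (PrimalInvariant.constant-to-root (proj₂ (drains (vert d))) refl at-root)
        (subst Drainsᶠ (sym d₀-outside) (0 , Dual.stop)))

    levels : Levels M
    levels = record
      -- Vertex depths are below `nV`, face depths below `suc nF`, where the unbounded face is
      -- counted too; the sum bounds both.
      { level = level ; level-step = step ; height = nV + suc nF ; level≤height = bound }
      where
      level : Black → ℕ
      level (inj₁ v) = proj₁ (drains v)
      level (inj₂ f) = proj₁ (drainsᶠ (just f))
      bound : ∀ x → level x ≤ nV + suc nF
      bound (inj₁ v) = ℕ.≤-trans (ℕ.<⇒≤ (Primal.Depth-bound (proj₂ (drains v)))) (ℕ.m≤m+n nV _)
      bound (inj₂ f) = ℕ.≤-trans (ℕ.<⇒≤ (Dual.Depth-bound (proj₂ (drainsᶠ (just f))))) (ℕ.m≤n+m (suc nF) nV)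
      vertex-step : ∀ {e u v} b → owner e ≡ inj₁ u → vert (e , b) ≡ u → vert (e , not b) ≡ v →
                    level (inj₁ u) ≡ suc (level (inj₁ v))
      vertex-step b o at refl with Primal.Depth-parent {d = _ , b} (o , at) (proj₂ (drains _))
      ... | t , eq , p = trans eq (cong suc (Primal.Depth-unique p (proj₂ (drains _))))
      face-step : ∀ {e f g} → owner e ≡ inj₂ f → Sides e (just f) (just g) → level (inj₂ f) ≡ suc (level (inj₂ g))
      face-step {e} {f} {g} o s with owned-faceOut f e o
      ... | b , out with Dual.Depth-parent out (proj₂ (drainsᶠ (just f)))
      ... | t , eq , p = trans eq (cong suc (Dual.Depth-unique p
          (subst (λ x → Dual.Depth x (level (inj₂ g))) (sym (far b (faceOut-along out) s)) (proj₂ (drainsᶠ (just g))))))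
        where
        far : ∀ b → face (e , b) ≡ just f → Sides e (just f) (just g) → face (e , not b) ≡ just g
        far false _ (inj₁ (_ , q)) = q
        far false p′ (inj₂ (p , q)) = trans q (trans (sym p′) p)
        far true q′ (inj₁ (p , q)) = trans p (trans (sym q′) q)
        far true _ (inj₂ (p , _)) = p
      step : ∀ {e x y} → owner e ≡ x → Across e x (just y) → level x ≡ suc (level y)
      step o (ends (inj₁ (p , q))) = vertex-step false o p q
      step o (ends (inj₂ (p , q))) = vertex-step true o q p
      step o (sides s) = face-step o s

-- Common boundary edges of a vertex set and a face set.

module Parity (G : PlaneGraph) where
  open PlaneGraph G
  open Matchings G

  cut : (Fin nV → Bool) → Fin nE → Bool
  cut A e = A (tl e) xor A (hd e)

  bound : (Maybe (Fin nF) → Bool) → Fin nE → Bool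
  bound Y e = Y (face (e , false)) xor Y (face (e , true))

  dartSum : (Dart → Bool) → Bool
  dartSum h = sum (λ e → h (e , false) xor h (e , true))

  private
    half : Fin nE ⊎ Fin nE → Dart
    half (inj₁ e) = e , false
    half (inj₂ e) = e , true

    decode : Fin (nE + nE) → Dart
    decode = half ∘ splitAt nE

    encode : Dart → Fin (nE + nE)
    encode (e , false) = e ↑ˡ nE
    encode (e , true) = nE ↑ʳ e

    decode-encode : ∀ d → decode (encode d) ≡ d
    decode-encode (e , false) = cong half (Fin.splitAt-↑ˡ nE e nE)
    decode-encode (e , true) = cong half (Fin.splitAt-↑ʳ nE nE e)

    encode-decode : ∀ i → encode (decode i) ≡ i
    encode-decode i = trans (encode-half (splitAt nE i)) (Fin.join-splitAt nE nE i)
      where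
      encode-half : ∀ x → encode (half x) ≡ join nE nE x
      encode-half (inj₁ e) = refl
      encode-half (inj₂ e) = refl

    dartSum-decode : ∀ h → dartSum h ≡ sum (h ∘ decode)
    dartSum-decode h = trans (∑-distrib-+ (λ e → h (e , false)) (λ e → h (e , true)))
      (sym (trans (sum-+ nE (h ∘ decode)) (cong₂ _xor_
        (sum-cong-≗ (λ e → cong h (decode-encode (e , false))))
        (sum-cong-≗ (λ e → cong h (decode-encode (e , true)))))))

  dartSum-permute : ∀ (f g : Dart → Dart) → (∀ d → f (g d) ≡ d) → (∀ d → g (f d) ≡ d) →
                    ∀ h → dartSum (h ∘ f) ≡ dartSum h
  dartSum-permute f g fg gf h = trans (dartSum-decode (h ∘ f)) (sym (trans (dartSum-decode h)
    (trans (sum-permute (h ∘ decode) π) (sum-cong-≗ (λ i → cong h (decode-encode (f (decode i))))))))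
    where
    π : Fin (nE + nE) ↔ Fin (nE + nE)
    π = mk↔ₛ′ (encode ∘ f ∘ decode) (encode ∘ g ∘ decode)
      (λ i → trans (cong (encode ∘ f) (decode-encode (g (decode i)))) (trans (cong encode (fg (decode i))) (encode-decode i)))
      (λ i → trans (cong (encode ∘ g) (decode-encode (f (decode i)))) (trans (cong encode (gf (decode i))) (encode-decode i)))

  -- Expanding the product leaves, for each dart with its face in `Y`, the values of `A` at its two
  -- ends. The far end of `d` is the near end of `φ d`, and `φ` permutes the darts within their
  -- faces, so the two sums cancel.
  cut∧bound-even : ∀ A Y → sum (λ e → cut A e ∧ bound Y e) ≡ false
  cut∧bound-even A Y = begin
    sum (λ e → cut A e ∧ bound Y e)
      ≡⟨ sum-cong-≗ (λ e → regroup (A (tl e)) (A (hd e)) (Y (face (e , false))) (Y (face (e , true)))) ⟩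
    sum (λ e → (here (e , false) xor here (e , true)) xor (there (e , false) xor there (e , true)))
      ≡⟨ ∑-distrib-+ (λ e → here (e , false) xor here (e , true)) (λ e → there (e , false) xor there (e , true)) ⟩
    dartSum here xor dartSum there
      ≡⟨ cong (dartSum here xor_) (trans (sum-cong-≗ (λ e → cong₂ _xor_ (step (e , false)) (step (e , true))))
           (dartSum-permute φ (α ∘ σ⁻) (λ d → trans (cong σ (α-involutive (σ⁻ d))) (σ-inv₂ d))
             (λ d → trans (cong α (σ-inv₁ (α d))) (α-involutive d)) here)) ⟩
    dartSum here xor dartSum here
      ≡⟨ Bool.xor-same (dartSum here) ⟩
    false ∎
    where
    open ≡-Reasoning
    here there : Dart → Bool
    here d = Y (face d) ∧ A (vert d)
    there d = Y (face d) ∧ A (vert (α d))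
    step : ∀ d → there d ≡ here (φ d)
    step d = cong₂ _∧_ (cong Y (sym (face-φ d))) (cong A (sym (vert-φ d)))
    regroup : ∀ a b y z → (a xor b) ∧ (y xor z) ≡ ((y ∧ a) xor (z ∧ b)) xor ((y ∧ b) xor (z ∧ a))
    regroup false false false z = sym (trans (cong (z ∧ false xor_) refl) (Bool.xor-same (z ∧ false)))
    regroup false false true z = sym (Bool.xor-same (z ∧ false))
    regroup false true false false = refl
    regroup false true false true = refl
    regroup false true true false = refl
    regroup false true true true = refl
    regroup true false false false = refl
    regroup true false false true = refl
    regroup true false true false = refl
    regroup true false true true = refl
    regroup true true false z = sym (Bool.xor-same (z ∧ true))
    regroup true true true false = refl
    regroup true true true true = refl

  -- A closed walk around the faces of Y crosses the boundary of A an even number of times.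
  another-crossing : ∀ A Y e → cut A e ≡ true → bound Y e ≡ true →
                     ∃ λ e′ → e′ ≢ e × cut A e′ ≡ true × bound Y e′ ≡ true
  another-crossing A Y e p q with sum-true⇒another (λ e → cut A e ∧ bound Y e) (cut∧bound-even A Y) e (∧-intro p q)
  ... | e′ , e′≢e , r = e′ , e′≢e , ∧-true r

switching : ∀ (s : ℕ → Bool) {x m p} → m ≤ p → s m ≡ x → s p ≡ not x →
            ∃ λ i → m ≤ i × i < p × s i ≡ x × s (suc i) ≡ not x
switching s {x} {m} {p} m≤p sm sp with ℕ.m≤n⇒m<n∨m≡n m≤p
... | inj₂ refl = contradiction (trans (sym sm) sp) (Bool.not-¬ refl)
switching s {x} {m} {suc p} m≤p sm sp | inj₁ m<1+p with s p Bool.≟ x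
... | yes eq = p , s≤s⁻¹ m<1+p , ℕ.n<1+n p , eq , sp
... | no neq with switching s (s≤s⁻¹ m<1+p) sm (Bool.¬-not neq)
... | i , m≤i , i<p , q = i , m≤i , ℕ.m<n⇒m<1+n i<p , q

-- The path as a strip, and where components leave it.

module Strips (G : PlaneGraph) where
  open PlaneGraph G
  open Matchings G
  open Flow G
  open Parity G

  -- The path z₀ w₀ z₁ w₁ … wₙ₋₁ zₙ with edges aⱼ = zⱼwⱼ and bⱼ = wⱼzⱼ₊₁; the faces
  -- around zⱼ are gⱼ and the unbounded one.
  record Strip (n : ℕ) : Set where
    field
      w z : ℕ → Fin nV
      a b : ℕ → Fin nE
      g : ℕ → Maybe (Fin nF)
      0<n : 0 < n
      a-ends : ∀ {j} → j < n → Ends (a j) (z j) (w j)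
      b-ends : ∀ {j} → j < n → Ends (b j) (w j) (z (suc j))
      a-sides : ∀ {j} → j < n → Sides (a j) (g j) nothing
      b-sides : ∀ {j} → j < n → Sides (b j) (g (suc j)) nothing
      g-first : g 0 ≡ nothing
      g-last : g n ≡ nothing
      w-injective : ∀ {i j} → i < n → j < n → w i ≡ w j → i ≡ j
      z-injective : ∀ {i j} → i ≤ n → j ≤ n → z i ≡ z j → i ≡ j
      w≢z : ∀ {i j} → i < n → j ≤ n → w i ≢ z j

    OnStrip : Fin nE → Set
    OnStrip e = ∃ λ j → j < n × (e ≡ a j ⊎ e ≡ b j)

    field
      z-edge : ∀ {j} e → j ≤ n → tl e ≡ z j ⊎ hd e ≡ z j → OnStrip e

    onStrip? : ∀ e → Dec (OnStrip e)
    onStrip? e = ℕ.anyUpTo? (λ j → (e ≟ᶠ a j) ⊎-dec (e ≟ᶠ b j)) n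

    Kept : Black → Set
    Kept x = ∀ {j} → j ≤ n → x ≢ inj₁ (z j)

    kept? : ∀ x → Dec (Kept x)
    kept? x with ℕ.anyUpTo? (λ j → x ≟ᵇ inj₁ (z j)) (suc n)
    ... | yes (j , j<1+n , eq) = no λ kept → kept (s≤s⁻¹ j<1+n) eq
    ... | no none = yes λ {j} j≤n eq → none (j , s≤s j≤n , eq)

    kept-w : ∀ {i} → i < n → Kept (inj₁ (w i))
    kept-w i<n j≤n eq = w≢z i<n j≤n (Sum.inj₁-injective eq)

    kept-face : ∀ f → Kept (inj₂ f)
    kept-face f _ ()

  Ends-cases : ∀ {e u v u′ v′} → Ends e u v → Ends e u′ v′ → (u ≡ u′ × v ≡ v′) ⊎ (u ≡ v′ × v ≡ u′)
  Ends-cases (inj₁ (refl , refl)) (inj₁ (refl , refl)) = inj₁ (refl , refl)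
  Ends-cases (inj₁ (refl , refl)) (inj₂ (refl , refl)) = inj₂ (refl , refl)
  Ends-cases (inj₂ (refl , refl)) (inj₁ (refl , refl)) = inj₂ (refl , refl)
  Ends-cases (inj₂ (refl , refl)) (inj₂ (refl , refl)) = inj₁ (refl , refl)

  Sides-cases : ∀ {e u v u′ v′} → Sides e u v → Sides e u′ v′ → (u ≡ u′ × v ≡ v′) ⊎ (u ≡ v′ × v ≡ u′)
  Sides-cases (inj₁ (refl , refl)) (inj₁ (refl , refl)) = inj₁ (refl , refl)
  Sides-cases (inj₁ (refl , refl)) (inj₂ (refl , refl)) = inj₂ (refl , refl)
  Sides-cases (inj₂ (refl , refl)) (inj₁ (refl , refl)) = inj₂ (refl , refl)
  Sides-cases (inj₂ (refl , refl)) (inj₂ (refl , refl)) = inj₁ (refl , refl)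

  across-unique : ∀ {e x m m′} → Across e x m → Across e x m′ → m ≡ m′
  across-unique (ends p) (ends q) with Ends-cases p q
  ... | inj₁ (_ , refl) = refl
  ... | inj₂ (refl , refl) = refl
  across-unique (sides p) (sides q) with Sides-cases p q
  ... | inj₁ (_ , refl) = refl
  ... | inj₂ (refl , refl) = refl
  across-unique (sides p) (outside q) with Sides-cases p q
  ... | inj₁ (_ , ())
  ... | inj₂ (() , _)
  across-unique (outside p) (sides q) with Sides-cases p q
  ... | inj₁ (_ , ())
  ... | inj₂ (_ , ())
  across-unique (outside p) (outside q) = refl

  across-sym : ∀ {e x y} → Across e x (just y) → Across e y (just x)
  across-sym (ends p) = ends (swap p)
  across-sym (sides p) = sides (swap p)

  cut-ends : ∀ A {e u v} → Ends e u v → cut A e ≡ A u xor A v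
  cut-ends A (inj₁ (refl , refl)) = refl
  cut-ends A {u = u} {v} (inj₂ (refl , refl)) = Bool.xor-comm (A v) (A u)

  bound-sides : ∀ Y {e x y} → Sides e x y → bound Y e ≡ Y x xor Y y
  bound-sides Y (inj₁ (p , q)) = cong₂ (λ x y → Y x xor Y y) p q
  bound-sides Y {x = x} {y} (inj₂ (p , q)) = trans (cong₂ (λ x y → Y x xor Y y) p q) (Bool.xor-comm (Y y) (Y x))

  -- Perfect matchings of G⁺ in terms of edge-vertices: the deleted pairs zⱼ, aⱼ are
  -- matched to each other.
  record Forward {n} (S : Strip n) : Set where
    open Strip S
    field
      matching : Temperley (z n)
    open Temperley matching public
    field
      pinned : ∀ {j} → j < n → owner (a j) ≡ inj₁ (z j)

  module StripFacts {n} (S : Strip n) where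
    open Strip S

    a-injective : ∀ {i j} → i < n → j < n → a i ≡ a j → i ≡ j
    a-injective i<n j<n eq with Ends-cases (a-ends i<n) (subst (λ e → Ends e _ _) (sym eq) (a-ends j<n))
    ... | inj₁ (_ , p) = w-injective i<n j<n p
    ... | inj₂ (_ , p) = contradiction p (w≢z i<n (ℕ.<⇒≤ j<n))

    b-injective : ∀ {i j} → i < n → j < n → b i ≡ b j → i ≡ j
    b-injective i<n j<n eq with Ends-cases (b-ends i<n) (subst (λ e → Ends e _ _) (sym eq) (b-ends j<n))
    ... | inj₁ (p , _) = w-injective i<n j<n p
    ... | inj₂ (p , _) = contradiction p (w≢z i<n j<n)

    a≢b : ∀ {i j} → i < n → j < n → a i ≢ b j
    a≢b {i} {j} i<n j<n eq with Ends-cases (a-ends i<n) (subst (λ e → Ends e _ _) (sym eq) (b-ends j<n))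
    ... | inj₁ (p , _) = w≢z j<n (ℕ.<⇒≤ i<n) (sym p)
    ... | inj₂ (p , q) with w-injective i<n j<n q
    ... | refl = ℕ.1+n≢n (sym (z-injective (ℕ.<⇒≤ i<n) i<n p))

    plain-kept : ∀ {e x m} → ¬ OnStrip e → Across e x m → Kept x
    plain-kept {e} off (ends (inj₁ (refl , _))) j≤n eq = off (z-edge e j≤n (inj₁ (Sum.inj₁-injective eq)))
    plain-kept {e} off (ends (inj₂ (_ , refl))) j≤n eq = off (z-edge e j≤n (inj₂ (Sum.inj₁-injective eq)))

  module Exit {n} {S : Strip n} (F : Forward S) where
    open Strip S
    open StripFacts S
    open Forward F

    private
      last : ℕ
      last = n ∸ 1
      last<n : last < n
      last<n = ℕ.∸-monoʳ-< {n} (s≤s z≤n) 0<n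
      1+last : suc last ≡ n
      1+last = ℕ.m+[n∸m]≡n 0<n

      bare : face (b last , false) ≡ nothing × face (b last , true) ≡ nothing
      bare with b-sides last<n | trans (cong g 1+last) g-last
      ... | inj₁ (p , q) | eq = trans p eq , q
      ... | inj₂ (p , q) | eq = p , trans q eq

      -- The tree argument requires a dart at the deleted vertex that sees the unbounded face. The
      -- last path edge provides it, being bare on both sides.
      root-dart : ∃ λ d → vert d ≡ z n × face d ≡ nothing
      root-dart with b-ends last<n
      ... | inj₁ (_ , q) = (b last , true) , trans q (cong z 1+last) , proj₂ bare
      ... | inj₂ (q , _) = (b last , false) , trans q (cong z 1+last) , proj₁ bare

      abstract
        flow : Levels matching
        flow = levels matching (proj₁ root-dart) (proj₁ (proj₂ root-dart)) (proj₂ (proj₂ root-dart))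

    open Levels flow public

    across-owner : ∀ {e x} → owner e ≡ x → ∃ (Across e x)
    across-owner {e} refl = across e

    b-owner : ∀ {i} → i < n → owner (b i) ≡ inj₁ (w i) ⊎ ∃ λ f → owner (b i) ≡ inj₂ f × g (suc i) ≡ just f
    b-owner {i} i<n with owner (b i) in o
    ... | inj₁ v with across-owner o
    ... | _ , ends p with Ends-cases (b-ends i<n) p
    ... | inj₁ (refl , _) = inj₁ refl
    ... | inj₂ (_ , refl) with suc i ℕ.<? n
    ... | yes 1+i<n = contradiction (owner-injective (trans (pinned 1+i<n) (sym o))) (a≢b 1+i<n i<n)
    ... | no 1+i≮n with ℕ.≤-antisym i<n (ℕ.≮⇒≥ 1+i≮n)
    ... | refl = contradiction o (owner≢root (b i))
    b-owner {i} i<n | inj₂ f with across-owner o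
    ... | _ , sides p with Sides-cases (b-sides i<n) p
    ... | inj₁ (_ , ())
    ... | inj₂ (_ , ())
    b-owner {i} i<n | inj₂ f | _ , outside p with Sides-cases (b-sides i<n) p
    ... | inj₁ (eq , _) = inj₂ (f , refl , eq)
    ... | inj₂ (_ , ())

    -- The index names the strip edge at which the chain of owners leaves its component; `nothing`
    -- marks a chain that reaches the unbounded face through an edge off the strip.
    data Exits : Black → Maybe ℕ → Set where
      atEnd : ∀ {x j} → j < n → owner (b j) ≡ x → Exits x (just j)
      outward : ∀ {e x} → ¬ OnStrip e → owner e ≡ x → Across e x nothing → Exits x nothing
      onward : ∀ {e x y k} → ¬ OnStrip e → owner e ≡ x → Across e x (just y) → Exits y k → Exits x k

    exits-unique : ∀ {x k k′} → Exits x k → Exits x k′ → k ≡ k′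
    exits-unique (atEnd j<n o) (atEnd i<n p) =
      cong just (b-injective j<n i<n (owner-injective (trans o (sym p))))
    exits-unique (atEnd {j = j} j<n o) (outward off p _) = contradiction (j , j<n , inj₂ (owner-injective (trans p (sym o)))) off
    exits-unique (atEnd {j = j} j<n o) (onward off p _ _) = contradiction (j , j<n , inj₂ (owner-injective (trans p (sym o)))) off
    exits-unique (outward off p _) (atEnd {j = j} j<n o) = contradiction (j , j<n , inj₂ (owner-injective (trans p (sym o)))) off
    exits-unique (onward off p _ _) (atEnd {j = j} j<n o) = contradiction (j , j<n , inj₂ (owner-injective (trans p (sym o)))) off
    exits-unique (outward _ _ _) (outward _ _ _) = refl
    exits-unique (outward _ o c) (onward _ p d _) with owner-injective (trans o (sym p))
    ... | refl = case across-unique c d of λ ()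
    exits-unique (onward _ o c _) (outward _ p d) with owner-injective (trans o (sym p))
    ... | refl = case across-unique c d of λ ()
    exits-unique (onward _ o c r) (onward _ p d s) with owner-injective (trans o (sym p))
    ... | refl with across-unique c d
    ... | refl = exits-unique r s

    kept-edge : ∀ {x} → Kept x → ∃ λ e → owner e ≡ x × (¬ OnStrip e ⊎ ∃ λ j → j < n × e ≡ b j)
    kept-edge {x} kept with edgeOf x (kept ℕ.≤-refl)
    ... | e , o with onStrip? e
    ... | no off = e , o , inj₁ off
    ... | yes (j , j<n , inj₁ refl) = contradiction (trans (sym o) (pinned j<n)) (kept (ℕ.<⇒≤ j<n))
    ... | yes (j , j<n , inj₂ eq) = e , o , inj₂ (j , j<n , eq)

    exits-kept : ∀ {x k} → Exits x k → Kept x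
    exits-kept (outward off _ c) = plain-kept off c
    exits-kept (onward off _ c _) = plain-kept off c
    exits-kept (atEnd j<n o) with b-owner j<n
    ... | inj₁ p = subst Kept (trans (sym p) o) (kept-w j<n)
    ... | inj₂ (f , p , _) = subst Kept (trans (sym p) o) (kept-face f)

    abstract
      -- The fuel `m` stays above the level, which drops with every step.
      exits-total : ∀ x → Kept x → ∃ (Exits x)
      exits-total x = go (suc (level x)) x (ℕ.n<1+n _)
        where
        go : ∀ m x → level x < m → Kept x → ∃ (Exits x)
        go (suc m) x lt kept with kept-edge kept
        ... | e , o , inj₂ (j , j<n , refl) = just j , atEnd j<n o
        ... | e , o , inj₁ off with across-owner o
        ... | nothing , c = nothing , outward off o c
        ... | just y , c with go m y (s≤s⁻¹ (subst (_< suc m) (level-step o c) lt)) (plain-kept off (across-sym c))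
        ... | k , r = k , onward off o c r

      exit : Black → Maybe ℕ
      exit x with kept? x
      ... | yes kept = proj₁ (exits-total x kept)
      -- With this default the vertices `z j` lie in no set `vertices k`.
      ... | no _ = nothing

      exit-spec : ∀ {x} → Kept x → Exits x (exit x)
      exit-spec {x} kept with kept? x
      ... | yes kept′ = proj₂ (exits-total x kept′)
      ... | no unkept = contradiction (λ {j} → kept {j}) unkept

    exit-≡ : ∀ {x k} → Exits x k → exit x ≡ k
    exit-≡ r = exits-unique (exit-spec (exits-kept r)) r

    abstract
      exit-z : ∀ {j} → j ≤ n → exit (inj₁ (z j)) ≡ nothing
      exit-z {j} j≤n with kept? (inj₁ (z j))
      ... | yes kept = contradiction refl (kept j≤n)
      ... | no _ = refl

    exitᶠ : Maybe (Fin nF) → Maybe ℕ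
    exitᶠ nothing = nothing
    exitᶠ (just f) = exit (inj₂ f)

    exit-onward : ∀ {e x y} → ¬ OnStrip e → owner e ≡ x → Across e x (just y) → exit x ≡ exit y
    exit-onward off o c = exit-≡ (onward off o c (exit-spec (plain-kept off (across-sym c))))

    exit-ends : ∀ {e v} → ¬ OnStrip e → owner e ≡ inj₁ v → exit (inj₁ (tl e)) ≡ exit (inj₁ (hd e))
    exit-ends off o with across-owner o
    ... | _ , c@(ends (inj₁ (refl , refl))) = exit-onward off o c
    ... | _ , c@(ends (inj₂ (refl , refl))) = sym (exit-onward off o c)

    exit-sides : ∀ {e f} → ¬ OnStrip e → owner e ≡ inj₂ f → exitᶠ (face (e , false)) ≡ exitᶠ (face (e , true))
    exit-sides off o with across-owner o
    ... | _ , c@(sides (inj₁ (p , q))) = trans (cong exitᶠ p) (trans (exit-onward off o c) (sym (cong exitᶠ q)))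
    ... | _ , c@(sides (inj₂ (p , q))) = trans (cong exitᶠ p) (trans (sym (exit-onward off o c)) (sym (cong exitᶠ q)))
    ... | _ , c@(outside (inj₁ (p , q))) = trans (cong exitᶠ p) (trans (exit-≡ (outward off o c)) (sym (cong exitᶠ q)))
    ... | _ , c@(outside (inj₂ (p , q))) = trans (cong exitᶠ p) (trans (sym (exit-≡ (outward off o c))) (sym (cong exitᶠ q)))

    through : ℕ → Maybe ℕ → Bool
    through k m = ⌊ Maybe.≡-dec ℕ._≟_ m (just k) ⌋

    through-true : ∀ {k m} → through k m ≡ true → m ≡ just k
    through-true {k} {m} p with Maybe.≡-dec ℕ._≟_ m (just k)
    ... | yes eq = eq
    through-true () | no _

    through-refl : ∀ k → through k (just k) ≡ true
    through-refl k = trans (isYes≗does (Maybe.≡-dec ℕ._≟_ (just k) (just k))) (dec-true (Maybe.≡-dec ℕ._≟_ (just k) (just k)) refl)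

    vertices : ℕ → Fin nV → Bool
    vertices k v = through k (exit (inj₁ v))

    faces : ℕ → Maybe (Fin nF) → Bool
    faces k x = through k (exitᶠ x)

    -- Off the strip, an edge owned by a face has two sides with the same exit, and an edge owned by
    -- a vertex is uncut by assumption. So a common boundary can only use strip edges. `A` is left
    -- open since it is applied both to `vertices k` and to a set of descendants.
    plain-uncrossed : ∀ {A} k e → ¬ OnStrip e → (∀ {v} → owner e ≡ inj₁ v → cut A e ≡ false) →
                      cut A e ≡ true → bound (faces k) e ≡ true → ⊥
    plain-uncrossed k e off primal p q with owner e in o
    ... | inj₁ v = true≢false (trans (sym p) (primal refl))
    ... | inj₂ f = true≢false (trans (sym q)
      (trans (cong (λ m → through k m xor faces k (face (e , true))) (exit-sides off o)) (Bool.xor-same (faces k (face (e , true))))))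

    a-bound : ∀ k {j} → j < n → bound (faces k) (a j) ≡ faces k (g j)
    a-bound k j<n = trans (bound-sides (faces k) (a-sides j<n)) (Bool.xor-identityʳ _)

    b-bound : ∀ k {j} → j < n → bound (faces k) (b j) ≡ faces k (g (suc j))
    b-bound k j<n = trans (bound-sides (faces k) (b-sides j<n)) (Bool.xor-identityʳ _)

    vertices-z : ∀ k {j} → j ≤ n → vertices k (z j) ≡ false
    vertices-z k j≤n = cong (through k) (exit-z j≤n)

    a-cut : ∀ k {j} → j < n → cut (vertices k) (a j) ≡ vertices k (w j)
    a-cut k j<n = trans (cut-ends (vertices k) (a-ends j<n)) (cong (_xor vertices k (w _)) (vertices-z k (ℕ.<⇒≤ j<n)))

    b-cut : ∀ k {j} → j < n → cut (vertices k) (b j) ≡ vertices k (w j)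
    b-cut k j<n = trans (cut-ends (vertices k) (b-ends j<n))
      (trans (cong (vertices k (w _) xor_) (vertices-z k j<n)) (Bool.xor-identityʳ _))

    -- Otherwise `a i` is a common boundary edge of the two components and has to have a partner.
    -- For a partner `a j` the extremal choices give `i ≤ j ≤ i`, for a partner `b j` they give
    -- `i ≤ j` and `suc j ≤ i`.
    first-and-last : ∀ {i k l} → i < n → exit (inj₁ (w i)) ≡ just k →
      (∀ {j} → j < n → exit (inj₁ (w j)) ≡ just k → i ≤ j) →
      exitᶠ (g i) ≡ just l → (∀ {j} → j ≤ n → exitᶠ (g j) ≡ just l → j ≤ i) → ⊥
    first-and-last {i} {k} {l} i<n wᵢ first gᵢ last-g
      with another-crossing (vertices k) (faces l) (a i)
        (trans (a-cut k i<n) (trans (cong (through k) wᵢ) (through-refl k)))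
        (trans (a-bound l i<n) (trans (cong (through l) gᵢ) (through-refl l)))
    ... | e , e≢a , p , q with onStrip? e
    ... | no off = plain-uncrossed {vertices k} l e off
      (λ o → trans (cong (λ m → through k m xor vertices k (hd e)) (exit-ends off o)) (Bool.xor-same (vertices k (hd e)))) p q
    ... | yes (j , j<n , inj₁ refl) = e≢a (cong a (ℕ.≤-antisym
      (last-g (ℕ.<⇒≤ j<n) (through-true (trans (sym (a-bound l j<n)) q)))
      (first j<n (through-true (trans (sym (a-cut k j<n)) p)))))
    ... | yes (j , j<n , inj₂ refl) = ℕ.n≮n _ (ℕ.≤-trans
      (last-g j<n (through-true (trans (sym (b-bound l j<n)) q)))
      (first j<n (through-true (trans (sym (b-cut k j<n)) p))))

    -- In contrast to `Exits`, these chains also run through strip edges, so they describe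
    -- descendants in the whole tree.
    data Passes : Black → Black → Set where
      here : ∀ {x} → Passes x x
      there : ∀ {e x y t} → owner e ≡ x → Across e x (just y) → Passes y t → Passes x t

    passes-level : ∀ {x t} → Passes x t → level t ≤ level x
    passes-level here = ℕ.≤-refl
    passes-level (there o c p) = subst (_ ≤_) (sym (level-step o c)) (ℕ.m≤n⇒m≤1+n (passes-level p))

    passes-onward : ∀ {e x y t} → owner e ≡ x → Across e x (just y) → x ≢ t → Passes x t → Passes y t
    passes-onward o c x≢t here = contradiction refl x≢t
    passes-onward o c x≢t (there o′ c′ p) with owner-injective (trans o (sym o′))
    ... | refl with across-unique c c′
    ... | refl = p

    abstract
      passes? : ∀ x t → Dec (Passes x t)
      passes? x t = go (suc (level x)) x (ℕ.n<1+n _)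
        where
        go : ∀ m x → level x < m → Dec (Passes x t)
        go (suc m) x lt with x ≟ᵇ t
        ... | yes refl = yes here
        ... | no x≢t with x ≟ᵇ inj₁ (z n)
        ... | yes refl = no λ { here → x≢t refl ; (there o _ _) → owner≢root _ o }
        ... | no x≢root with edgeOf x x≢root
        ... | e , o with across-owner o
        ... | nothing , c = no λ { here → x≢t refl ; (there o′ c′ _) → blocked o′ c′ }
          where
          blocked : ∀ {e′ y} → owner e′ ≡ x → Across e′ x (just y) → ⊥
          blocked o′ c′ with owner-injective (trans o (sym o′))
          ... | refl = case across-unique c c′ of λ ()
        ... | just y , c = map′ (there o c) (passes-onward o c x≢t)
          (go m y (s≤s⁻¹ (subst (_< suc m) (level-step o c) lt)))

    exits-passes : ∀ {x k} → Exits x (just k) → Passes x (owner (b k))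
    exits-passes (atEnd _ refl) = here
    exits-passes (onward _ o c r) = there o c (exits-passes r)

    -- The vertices A flowing through wₖ miss zₖ₊₁ and zₙ.  If A contained wⱼ with j > k, then
    -- two distinct bᵢ owned by faces would cross the boundary of A, and each of them forces the
    -- face at zₖ₊₁ to exit through that bᵢ.
    module _ {k} (k<n : k < n) (owned : owner (b k) ≡ inj₁ (w k)) where
      private
        A : Fin nV → Bool
        A v = ⌊ passes? (inj₁ v) (inj₁ (w k)) ⌋

        A-true : ∀ {v} → Passes (inj₁ v) (inj₁ (w k)) → A v ≡ true
        A-true {v} p = trans (isYes≗does d) (dec-true d p) where d = passes? (inj₁ v) (inj₁ (w k))

        A-false : ∀ {v} → ¬ Passes (inj₁ v) (inj₁ (w k)) → A v ≡ false
        A-false {v} ¬p = trans (isYes≗does d) (dec-false d ¬p) where d = passes? (inj₁ v) (inj₁ (w k))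

        A-onward : ∀ {e u v} → owner e ≡ inj₁ u → Ends e u v → u ≢ w k → A u ≡ A v
        A-onward {u = u} {v} o c u≢w with passes? (inj₁ v) (inj₁ (w k))
        ... | yes p = A-true (there o (ends c) p)
        ... | no ¬p = A-false (λ p → ¬p (passes-onward o (ends c) (u≢w ∘ Sum.inj₁-injective) p))

        A-z : ∀ {j} → j < n → A (z j) ≡ A (w j)
        A-z j<n = A-onward (pinned j<n) (a-ends j<n) (λ eq → w≢z k<n (ℕ.<⇒≤ j<n) (sym eq))

        A-root : A (z n) ≡ false
        A-root = A-false λ p → root-passes p refl
          where
          root-passes : ∀ {x} → Passes x (inj₁ (w k)) → x ≢ inj₁ (z n)
          root-passes here eq = w≢z k<n ℕ.≤-refl (Sum.inj₁-injective eq)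
          root-passes (there o _ _) refl = owner≢root _ o

        -- `z (suc k)` is the parent of `w k`, and levels never rise along a chain.
        A-after : A (z (suc k)) ≡ false
        A-after = A-false λ p → ℕ.n≮n _
          (subst (_≤ level (inj₁ (z (suc k)))) (level-step owned (ends (b-ends k<n))) (passes-level p))

        uncut : ∀ e → e ≢ b k → ∀ {v} → owner e ≡ inj₁ v → cut A e ≡ false
        uncut e e≢b {v} o with across-owner o
        ... | _ , ends {v = u} c = trans (cut-ends A c)
          (trans (cong (_xor A u) (A-onward o c (λ { refl → e≢b (owner-injective (trans o (sym owned))) })))
            (Bool.xor-same (A u)))

        -- Parity is applied to `A` and the faces leaving through `b i`. The second crossing is no
        -- `a j`, whose ends lie on one side of `A`; a `b j` owned by another face has that face
        -- leaving through `b j` itself; only `b k` remains.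
        face-target : ∀ {i} → i < n → i ≢ k → A (w i) xor A (z (suc i)) ≡ true → exitᶠ (g (suc k)) ≡ just i
        face-target {i} i<n i≢k jump with b-owner i<n
        ... | inj₁ o = contradiction (trans (sym jump) (trans (sym (cut-ends A (b-ends i<n)))
                (uncut (b i) (i≢k ∘ b-injective i<n k<n) o))) true≢false
        ... | inj₂ (f , o , gf) with another-crossing A (faces i) (b i) (trans (cut-ends A (b-ends i<n)) jump)
                (trans (b-bound i i<n) (trans (cong (faces i) gf)
                  (trans (cong (through i) (exit-≡ (atEnd i<n o))) (through-refl i))))
        ... | e , e≢b , p , q with onStrip? e
        ... | no off = ⊥-elim (plain-uncrossed {A} i e off (uncut e (λ { refl → off (k , k<n , inj₂ refl) })) p q)
        ... | yes (j , j<n , inj₁ refl) = contradiction (trans (sym p) (trans (cut-ends A (a-ends j<n))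
                (trans (cong (_xor A (w j)) (A-z j<n)) (Bool.xor-same (A (w j)))))) true≢false
        ... | yes (j , j<n , inj₂ refl) with j ℕ.≟ k
        ... | yes refl = through-true (trans (sym (b-bound i j<n)) q)
        ... | no j≢k with b-owner j<n
        ... | inj₁ o′ = contradiction (trans (sym p) (uncut (b j) (j≢k ∘ b-injective j<n k<n) o′)) true≢false
        ... | inj₂ (f′ , o′ , gf′) = contradiction (cong b (Maybe.just-injective (trans
                (sym (trans (cong exitᶠ gf′) (exit-≡ (atEnd j<n o′)))) (through-true (trans (sym (b-bound i j<n)) q))))) e≢b

        jump-in : ∀ {i} → i < n → A (z i) ≡ false → A (z (suc i)) ≡ true → A (w i) xor A (z (suc i)) ≡ true
        jump-in i<n p q = cong₂ _xor_ (trans (sym (A-z i<n)) p) q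

        jump-out : ∀ {i} → i < n → A (z i) ≡ true → A (z (suc i)) ≡ false → A (w i) xor A (z (suc i)) ≡ true
        jump-out i<n p q = cong₂ _xor_ (trans (sym (A-z i<n)) p) q

      exit-last : ∀ {j} → j < n → exit (inj₁ (w j)) ≡ just k → j ≤ k
      exit-last {j} j<n eq with j ℕ.≤? k
      ... | yes j≤k = j≤k
      ... | no j≰k with switching (A ∘ z) (ℕ.≰⇒> j≰k) A-after inside
                      | switching (A ∘ z) (ℕ.<⇒≤ j<n) inside A-root
        where
        inside : A (z j) ≡ true
        inside = trans (A-z j<n) (A-true (subst (Passes _) owned (exits-passes (subst (Exits _) eq (exit-spec (kept-w j<n))))))
      ... | i , k<i , i<j , p , q | l , j≤l , l<n , p′ , q′ = contradiction (Maybe.just-injective (trans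
              (sym (face-target i<n (ℕ.>⇒≢ k<i) (jump-in i<n p q)))
              (face-target l<n (ℕ.>⇒≢ (ℕ.<-≤-trans k<i (ℕ.<⇒≤ i<l))) (jump-out l<n p′ q′)))) (ℕ.<⇒≢ i<l)
        where
        i<l : i < l
        i<l = ℕ.<-≤-trans i<j j≤l
        i<n : i < n
        i<n = ℕ.<-trans i<l l<n

-- Determination of a matching by its tree, reversal of the strip, and rerooting.

∸-suc-involutive : ∀ {n j} → j < n → n ∸ suc (n ∸ suc j) ≡ j
∸-suc-involutive {suc n} (s≤s j≤n) = ℕ.m∸[m∸n]≡n j≤n

least : ∀ {P : ℕ → Set} → (∀ i → Dec (P i)) → ∀ m → P m → ∃ λ i → P i × i ≤ m × (∀ {j} → P j → i ≤ j)
least {P} P? = <-rec _ search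
  where
  search : ∀ m → (∀ {k} → k < m → P k → ∃ λ i → P i × i ≤ k × (∀ {j} → P j → i ≤ j)) →
           P m → ∃ λ i → P i × i ≤ m × (∀ {j} → P j → i ≤ j)
  search m rec p with ℕ.anyUpTo? P? m
  ... | no none = m , p , ℕ.≤-refl , λ {j} q → ℕ.≮⇒≥ λ j<m → none (j , j<m , q)
  ... | yes (k , k<m , q) with rec k<m q
  ... | i , r , i≤k , minimal = i , r , ℕ.≤-trans i≤k (ℕ.<⇒≤ k<m) , minimal

greatest : ∀ {P : ℕ → Set} → (∀ i → Dec (P i)) → ∀ N {m} → m ≤ N → P m →
           ∃ λ i → P i × i ≤ N × (∀ {j} → j ≤ N → P j → j ≤ i)
greatest P? N m≤N p with P? N
... | yes q = N , q , ℕ.≤-refl , λ j≤N _ → j≤N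
greatest P? N m≤N p | no ¬q with ℕ.m≤n⇒m<n∨m≡n m≤N
... | inj₂ refl = contradiction p ¬q
greatest {P} P? (suc N) m≤N p | no ¬q | inj₁ m<N with greatest P? N (s≤s⁻¹ m<N) p
... | i , r , i≤N , maximal = i , r , ℕ.m≤n⇒m≤1+n i≤N , λ {j} j≤1+N s →
  [ (λ j<1+N → maximal (s≤s⁻¹ j<1+N) s) , (λ { refl → contradiction s ¬q }) ]′ (ℕ.m≤n⇒m<n∨m≡n j≤1+N)

module Rerooting (G : PlaneGraph) where
  open PlaneGraph G
  open Matchings G
  open Flow G
  open Strips G

  isVertex : Black → Bool
  isVertex (inj₁ _) = true
  isVertex (inj₂ _) = false

  isVertex-across : ∀ {e x y} → Across e x (just y) → isVertex x ≡ isVertex y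
  isVertex-across (ends _) = refl
  isVertex-across (sides _) = refl

  module _ {n} {S : Strip n} where
    open Strip S
    open StripFacts S

    SameKinds : Forward S → Forward S → Set
    SameKinds F F′ = ∀ e → ¬ OnStrip e → isVertex (Forward.owner F e) ≡ isVertex (Forward.owner F′ e)

    module _ (F : Forward S) where
      open Forward F
      open Exit F

      -- Across an edge owned by a vertex there is again a vertex, so such a chain cannot end in the
      -- unbounded face.
      exits-vertex : ∀ {v m} → Exits (inj₁ v) m →
                     ∃ λ k → k < n × owner (b k) ≡ inj₁ (w k) × Exits (inj₁ v) (just k)
      exits-vertex (atEnd {j = j} j<n o) with b-owner j<n
      ... | inj₁ p = j , j<n , p , atEnd j<n o
      ... | inj₂ (_ , p , _) = case trans (sym o) p of λ ()
      exits-vertex (onward off o c@(ends _) r) with exits-vertex r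
      ... | k , k<n , p , r′ = k , k<n , p , onward off o c r′

    module _ (F F′ : Forward S) (kinds : SameKinds F F′) where
      private
        module F = Forward F
        module F′ = Forward F′
        module X = Exit F
        module X′ = Exit F′

      -- The edges of the chain are owned by vertices in `F′` as well, perhaps in the opposite
      -- direction, and the exit in `F′` is the same at both ends of each.
      exit-transfer : ∀ {v k} → X.Exits (inj₁ v) (just k) → X′.exit (inj₁ v) ≡ X′.exit (inj₁ (w k))
      exit-transfer (X.atEnd j<n o) with X.b-owner j<n
      ... | inj₁ p = cong X′.exit (trans (sym o) p)
      ... | inj₂ (_ , p , _) = case trans (sym o) p of λ ()
      exit-transfer (X.onward {e} off o c@(ends _) r) with F′.owner e in o′ | trans (sym (cong isVertex o)) (kinds e off)
      ... | inj₂ _ | ()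
      exit-transfer (X.onward {e} off o (ends (inj₁ (refl , refl))) r) | inj₁ _ | _ =
        trans (X′.exit-ends off o′) (exit-transfer r)
      exit-transfer (X.onward {e} off o (ends (inj₂ (refl , refl))) r) | inj₁ _ | _ =
        trans (sym (X′.exit-ends off o′)) (exit-transfer r)

    -- The components of T off the strip depend on the kinds alone, and in either matching a
    -- component leaves at its last path vertex.
    exit-owned-by-vertex : ∀ (F F′ : Forward S) → SameKinds F F′ → ∀ {k} → k < n →
      Forward.owner F (b k) ≡ inj₁ (w k) → Forward.owner F′ (b k) ≡ inj₁ (w k)
    exit-owned-by-vertex F F′ kinds {k} k<n o with exits-vertex F′ (Exit.exit-spec F′ (kept-w k<n))
    ... | k′ , k′<n , o′ , r′ = subst (λ i → Forward.owner F′ (b i) ≡ inj₁ (w i)) (ℕ.≤-antisym k′≤k k≤k′) o′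
      where
      k≤k′ : k ≤ k′
      k≤k′ = Exit.exit-last F′ k′<n o′ k<n (Exit.exit-≡ F′ r′)
      k′≤k : k′ ≤ k
      k′≤k = Exit.exit-last F k<n o k′<n (trans (sym (exit-transfer F′ F (λ e off → sym (kinds e off)) r′))
        (Exit.exit-≡ F (Exit.atEnd k<n o)))

    module _ (F F′ : Forward S) (kinds : SameKinds F F′) where
      private
        module F = Forward F
        module F′ = Forward F′
      open Exit F

      all-kinds : ∀ e → isVertex (F.owner e) ≡ isVertex (F′.owner e)
      all-kinds e with onStrip? e
      ... | no off = kinds e off
      ... | yes (j , j<n , inj₁ refl) = cong isVertex (trans (F.pinned j<n) (sym (F′.pinned j<n)))
      ... | yes (j , j<n , inj₂ refl) with b-owner j<n | Exit.b-owner F′ j<n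
      ... | inj₁ o | inj₁ o′ = cong isVertex (trans o (sym o′))
      ... | inj₂ (_ , o , _) | inj₂ (_ , o′ , _) = trans (cong isVertex o) (sym (cong isVertex o′))
      ... | inj₁ o | inj₂ (_ , o′ , _) = case trans (sym (exit-owned-by-vertex F F′ kinds j<n o)) o′ of λ ()
      ... | inj₂ (_ , o , _) | inj₁ o′ =
        case trans (sym (exit-owned-by-vertex F′ F (λ e off → sym (kinds e off)) j<n o′)) o of λ ()

      opposite-end : ∀ {e x y m m′} → Across e x m → Across e y m′ → isVertex x ≡ isVertex y → x ≢ y →
                     Across e y (just x)
      opposite-end (ends p) (ends q) _ x≢y with Ends-cases p q
      ... | inj₁ (refl , _) = contradiction refl x≢y
      ... | inj₂ (refl , refl) = ends q
      opposite-end (sides p) (sides q) _ x≢y with Sides-cases p q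
      ... | inj₁ (refl , _) = contradiction refl x≢y
      ... | inj₂ (refl , refl) = sides q
      opposite-end (sides p) (outside q) _ x≢y with Sides-cases p q
      ... | inj₁ (_ , ())
      ... | inj₂ (() , _)
      opposite-end (outside p) (sides q) _ x≢y with Sides-cases p q
      ... | inj₁ (_ , ())
      ... | inj₂ (_ , ())
      opposite-end (outside p) (outside q) _ x≢y with Sides-cases p q
      ... | inj₁ (refl , _) = contradiction refl x≢y
      ... | inj₂ (() , _)

      -- If x owns e in F and e′ ≠ e in F′, then the owner of e′ in F is one level higher
      -- and disagrees as well.
      climb : ∀ m {x e e′} → height < level x + m → F.owner e ≡ x → F′.owner e′ ≡ x → e ≢ e′ → ⊥
      climb zero {x} lt _ _ _ = ℕ.n≮n height (ℕ.<-≤-trans lt (subst (_≤ height) (sym (ℕ.+-identityʳ _)) (level≤height x)))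
      climb (suc m) {e′ = e′} lt refl o′ e≢e′ with F′.edgeOf (F.owner e′) (F.owner≢root e′)
      ... | e″ , o″ = climb m (subst (height <_) shift lt) refl o″ (λ { refl → x≢y (trans (sym o′) o″) })
        where
        x≢y : F.owner _ ≢ F.owner e′
        x≢y eq = e≢e′ (F.owner-injective eq)
        step : Across e′ (F.owner e′) (just (F.owner _))
        step = opposite-end (subst (λ x → Across e′ x _) o′ (proj₂ (F′.across e′))) (proj₂ (F.across e′))
          (trans (sym (cong isVertex o′)) (sym (all-kinds e′))) x≢y
        shift : level (F.owner _) + suc m ≡ level (F.owner e′) + m
        shift = trans (ℕ.+-suc _ m) (cong (_+ m) (sym (level-step refl step)))

      owner-determined : ∀ e → F.owner e ≡ F′.owner e
      owner-determined e with F.edgeOf (F′.owner e) (F′.owner≢root e)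
      ... | e′ , o with e′ ≟ᶠ e
      ... | yes refl = o
      -- With `suc height` as fuel the climb passes above every level.
      ... | no e′≢e = ⊥-elim (climb (suc height) (ℕ.m≤n+m (suc height) _) o refl e′≢e)

  mirrored : ∀ {n} (S : Strip n) {e} → Strip.OnStrip S e →
             ∃ λ j → j < n × (e ≡ Strip.b S (n ∸ suc j) ⊎ e ≡ Strip.a S (n ∸ suc j))
  mirrored {n} S (j , j<n , inj₁ eq) =
    n ∸ suc j , ℕ.∸-monoʳ-< (s≤s z≤n) j<n , inj₂ (trans eq (cong (Strip.a S) (sym (∸-suc-involutive j<n))))
  mirrored {n} S (j , j<n , inj₂ eq) =
    n ∸ suc j , ℕ.∸-monoʳ-< (s≤s z≤n) j<n , inj₁ (trans eq (cong (Strip.b S) (sym (∸-suc-involutive j<n))))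

  -- Exchanges the edges `a` and `b` and moves the root from `z n` to `z 0`, so that matchings of G⁻
  -- are again of the kind `Forward`.
  reverse : ∀ {n} → Strip n → Strip n
  reverse {n} S = record
    { w = λ j → w (n ∸ suc j)
    ; z = λ j → z (n ∸ j)
    ; a = λ j → b (n ∸ suc j)
    ; b = λ j → a (n ∸ suc j)
    ; g = λ j → g (n ∸ j)
    ; 0<n = 0<n
    ; a-ends = λ {j} j<n → subst (λ i → Ends (b (n ∸ suc j)) (z i) (w (n ∸ suc j))) (up j<n) (swap (b-ends (down j<n)))
    ; b-ends = λ j<n → swap (a-ends (down j<n))
    ; a-sides = λ {j} j<n → subst (λ i → Sides (b (n ∸ suc j)) (g i) nothing) (up j<n) (b-sides (down j<n))
    ; b-sides = λ j<n → a-sides (down j<n)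
    ; g-first = g-last
    ; g-last = trans (cong g (ℕ.n∸n≡0 n)) g-first
    ; w-injective = λ i<n j<n eq → ℕ.suc-injective (ℕ.∸-cancelˡ-≡ i<n j<n (w-injective (down i<n) (down j<n) eq))
    ; z-injective = λ {i} {j} i≤n j≤n eq → ℕ.∸-cancelˡ-≡ i≤n j≤n (z-injective (ℕ.m∸n≤m n i) (ℕ.m∸n≤m n j) eq)
    ; w≢z = λ {_} {j} i<n _ → w≢z (down i<n) (ℕ.m∸n≤m n j)
    ; z-edge = λ {j} e _ at → mirrored S (z-edge e (ℕ.m∸n≤m n j) at)
    }
    where
    open Strip S
    down : ∀ {j} → j < n → n ∸ suc j < n
    down j<n = ℕ.∸-monoʳ-< (s≤s z≤n) j<n
    up : ∀ {j} → j < n → suc (n ∸ suc j) ≡ n ∸ j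
    up {j} j<n = sym (ℕ.+-∸-assoc 1 j<n)

  reverse-onStrip : ∀ {n} (S : Strip n) {e} → Strip.OnStrip (reverse S) e → Strip.OnStrip S e
  reverse-onStrip {n} S (j , j<n , inj₁ eq) = n ∸ suc j , ℕ.∸-monoʳ-< (s≤s z≤n) j<n , inj₂ eq
  reverse-onStrip {n} S (j , j<n , inj₂ eq) = n ∸ suc j , ℕ.∸-monoʳ-< (s≤s z≤n) j<n , inj₁ eq

  module Reroot {n} {S : Strip n} (F : Forward S) where
    open Strip S
    open StripFacts S
    open Forward F
    open Exit F

    -- The component leaving through b k is rerooted at start, which is to own a index:
    -- a component of vertices at its first w, a component of faces at its last g.
    record Start (k : ℕ) : Set where
      field
        index : ℕ
        index<n : index < n
        start : Black
        start-kept : Kept start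
        start-exit : exit start ≡ just k
        start-across : ∃ (Across (a index) start)
        extremal :
          (start ≡ inj₁ (w index) × (∀ {j} → j < n → exit (inj₁ (w j)) ≡ just k → index ≤ j)) ⊎
          (∃ λ f → start ≡ inj₂ f × g index ≡ just f × (∀ {j} → j ≤ n → exitᶠ (g j) ≡ just k → j ≤ index))

    exits? : ∀ m k → Dec (m ≡ just k)
    exits? m k = Maybe.≡-dec ℕ._≟_ m (just k)

    find-start : ∀ {k} → k < n → Start k
    find-start {k} k<n with b-owner k<n
    ... | inj₁ o with least (λ i → exits? (exit (inj₁ (w i))) k) k (exit-≡ (atEnd k<n o))
    ... | i , eq , i≤k , minimal = record
      { index = i ; index<n = ℕ.≤-<-trans i≤k k<n ; start = inj₁ (w i)
      ; start-kept = kept-w (ℕ.≤-<-trans i≤k k<n) ; start-exit = eq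
      ; start-across = _ , ends (swap (a-ends (ℕ.≤-<-trans i≤k k<n)))
      ; extremal = inj₁ (refl , λ _ → minimal) }
    -- The owner of `b k` is the face at `z (suc k)`, so the search has the candidate `suc k`.
    find-start {k} k<n | inj₂ (f , o , gf)
      with greatest (λ i → exits? (exitᶠ (g i)) k) n {suc k} k<n (trans (cong exitᶠ gf) (exit-≡ (atEnd k<n o)))
    ... | i , eq , i≤n , maximal with g i in gᵢ
    ... | just f′ = record
      { index = i ; index<n = i<n ; start = inj₂ f′ ; start-kept = kept-face f′ ; start-exit = eq
      ; start-across = _ , outside (subst (λ x → Sides (a i) x nothing) gᵢ (a-sides i<n))
      ; extremal = inj₂ (f′ , refl , gᵢ , maximal) }
      where
      i<n : i < n
      -- The last index `n` is excluded because `g n` is the unbounded face, while `g i` is a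
      -- bounded one.
      i<n = ℕ.≤∧≢⇒< i≤n λ { refl → case trans (sym gᵢ) g-last of λ () }

    open Start

    starts : ∀ k → Start (toℕ {n} k)
    starts k = find-start (Fin.toℕ<n k)

    -- At a given index two starts of the same kind are the same vertex or face and hence have the
    -- same exit; starts of different kinds are ruled out by `first-and-last`.
    same-index : ∀ {k l} (s : Start k) (t : Start l) → index s ≡ index t → k ≡ l
    same-index s t eq with extremal s | extremal t
    ... | inj₁ (p , _) | inj₁ (q , _) = Maybe.just-injective (trans (sym (start-exit s))
      (trans (cong exit (trans p (trans (cong (inj₁ ∘ w) eq) (sym q)))) (start-exit t)))
    ... | inj₂ (_ , p , gf , _) | inj₂ (_ , q , gf′ , _) = Maybe.just-injective (trans (sym (start-exit s))
      (trans (cong exit p) (trans (cong exitᶠ (trans (sym gf) (trans (cong g eq) gf′)))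
      (trans (sym (cong exit q)) (start-exit t)))))
    ... | inj₁ (p , first) | inj₂ (_ , q , gf , last-g) = ⊥-elim (first-and-last (index<n s)
      (trans (sym (cong exit p)) (start-exit s)) first
      (trans (cong exitᶠ (trans (cong g eq) gf)) (trans (sym (cong exit q)) (start-exit t)))
      (λ j≤n r → subst (_ ≤_) (sym eq) (last-g j≤n r)))
    ... | inj₂ (_ , q , gf , last-g) | inj₁ (p , first) = ⊥-elim (first-and-last (index<n t)
      (trans (sym (cong exit p)) (start-exit t)) first
      (trans (cong exitᶠ (trans (cong g (sym eq)) gf)) (trans (sym (cong exit q)) (start-exit s)))
      (λ j≤n r → subst (_ ≤_) eq (last-g j≤n r)))

    -- As many exits `b k` as edges `a j`: an injective choice of indices misses none.
    starts-onto : ∀ {j} → j < n → ∃ λ k → index (starts k) ≡ j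
    starts-onto {j} j<n with injective⇒surjective (λ k → fromℕ< (index<n (starts k)))
      (λ {k} {l} eq → Fin.toℕ-injective (same-index (starts k) (starts l) (Fin.fromℕ<-injective _ _ _ _ eq)))
      (fromℕ< j<n)
    ... | k , eq = k , Fin.fromℕ<-injective _ _ _ _ eq

    data Path : Black → Black → Set where
      [] : ∀ {x} → Path x x
      step : ∀ {e x y t} → ¬ OnStrip e → owner e ≡ x → Across e x (just y) → Path y t → Path x t

    path-level : ∀ {x t} → Path x t → level t ≤ level x
    path-level [] = ℕ.≤-refl
    path-level (step _ o c p) = subst (_ ≤_) (sym (level-step o c)) (ℕ.m≤n⇒m≤1+n (path-level p))

    path-exit : ∀ {x t} → Path x t → exit x ≡ exit t
    path-exit [] = refl
    path-exit (step off o c p) = trans (exit-onward off o c) (path-exit p)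

    path-unique : ∀ {x t t′} → Path x t → Path x t′ → level t ≡ level t′ → t ≡ t′
    path-unique [] [] _ = refl
    path-unique [] (step _ o c p) eq = contradiction
      (subst (_≤ _) (sym eq) (path-level p)) (ℕ.<⇒≱ (ℕ.≤-reflexive (sym (level-step o c))))
    path-unique (step _ o c p) [] eq = contradiction
      (subst (_≤ _) eq (path-level p)) (ℕ.<⇒≱ (ℕ.≤-reflexive (sym (level-step o c))))
    path-unique (step _ o c p) (step _ o′ c′ p′) eq with owner-injective (trans o (sym o′))
    ... | refl with across-unique c c′
    ... | refl = path-unique p p′ eq

    path-snoc : ∀ {e x y t} → Path x y → ¬ OnStrip e → owner e ≡ y → Across e y (just t) → Path x t
    path-snoc [] off o c = step off o c []
    path-snoc (step off′ o′ c′ p) off o c = step off′ o′ c′ (path-snoc p off o c)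

    path-last : ∀ {x t} → Path x t → x ≡ t ⊎ ∃₂ λ y e → Path x y × ¬ OnStrip e × owner e ≡ y × Across e y (just t)
    path-last [] = inj₁ refl
    path-last (step off o c p) with path-last p
    ... | inj₁ refl = inj₂ (_ , _ , [] , off , o , c)
    ... | inj₂ (y , e , q , rest) = inj₂ (y , e , step off o c q , rest)

    path-to-exit : ∀ {x k} → Exits x (just k) → Path x (owner (b k))
    path-to-exit (atEnd _ refl) = []
    path-to-exit (onward off o c r) = step off o c (path-to-exit r)

    abstract
      path? : ∀ x t → Dec (Path x t)
      path? x t = go (suc (level x)) x (ℕ.n<1+n _)
        where
        go : ∀ m x → level x < m → Dec (Path x t)
        go (suc m) x lt with x ≟ᵇ t
        ... | yes refl = yes []
        ... | no x≢t with x ≟ᵇ inj₁ (z n)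
        ... | yes refl = no λ { [] → x≢t refl ; (step _ o _ _) → owner≢root _ o }
        ... | no x≢root with edgeOf x x≢root
        ... | e , o with onStrip? e | across-owner o
        ... | yes on | _ = no λ { [] → x≢t refl
                                ; (step off o′ _ _) → off (subst OnStrip (owner-injective (trans o (sym o′))) on) }
        ... | no _ | nothing , c = no λ { [] → x≢t refl ; (step _ o′ c′ _) → blocked o′ c′ }
          where
          blocked : ∀ {e′ y} → owner e′ ≡ x → Across e′ x (just y) → ⊥
          blocked o′ c′ with owner-injective (trans o (sym o′))
          ... | refl = case across-unique c c′ of λ ()
        ... | no off | just y , c = map′ (step off o c) onward′
          (go m y (s≤s⁻¹ (subst (_< suc m) (level-step o c) lt)))
          where
          onward′ : Path x t → Path y t
          onward′ [] = contradiction refl x≢t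
          onward′ (step _ o′ c′ p) with owner-injective (trans o (sym o′))
          ... | refl with across-unique c c′
          ... | refl = p

    OnPath : Black → Set
    OnPath x = ∃ λ k → Path (start (starts k)) x

    onPath? : ∀ x → Dec (OnPath x)
    onPath? x = Fin.any? (λ k → path? (start (starts k)) x)

    start-of-exit : ∀ {k x} → Path (start (starts k)) x → exit x ≡ just (toℕ k)
    start-of-exit {k} p = trans (sym (path-exit p)) (start-exit (starts k))

    same-start : ∀ {k l x} → Path (start (starts k)) x → Path (start (starts l)) x → k ≡ l
    same-start p q = Fin.toℕ-injective (Maybe.just-injective (trans (sym (start-of-exit p)) (start-of-exit q)))

    -- The new matching: along the path from a start to its exit each edge passes from
    -- its tail to its head.
    data Owns (e : Fin nE) : Black → Set where
      first : ∀ k → e ≡ a (index (starts k)) → Owns e (start (starts k))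
      pin : ∀ {j} → j < n → e ≡ b j → Owns e (inj₁ (z (suc j)))
      same : ∀ {x} → ¬ OnStrip e → ¬ OnPath x → owner e ≡ x → Owns e x
      moved : ∀ {x y} → ¬ OnStrip e → OnPath x → owner e ≡ x → Across e x (just y) → Owns e y

    owns-total : ∀ e → ∃ (Owns e)
    owns-total e with onStrip? e
    ... | yes (j , j<n , inj₂ eq) = _ , pin j<n eq
    ... | yes (j , j<n , inj₁ eq) with starts-onto j<n
    ... | k , refl = _ , first k eq
    owns-total e | no off with onPath? (owner e)
    ... | no ¬p = _ , same off ¬p refl
    ... | yes (k , p) with across e
    ... | just y , c = _ , moved off (k , p) refl c
    -- A chain on the path of a start leaves through its `b k`, so it does not reach the unbounded
    -- face off the strip.
    ... | nothing , c = case trans (sym (exit-≡ (outward off refl c))) (start-of-exit p) of λ ()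

    owns-unique : ∀ {e x y} → Owns e x → Owns e y → x ≡ y
    owns-unique (first k eq) (first l eq′)
      with Fin.toℕ-injective (same-index (starts k) (starts l)
             (a-injective (index<n (starts k)) (index<n (starts l)) (trans (sym eq) eq′)))
    ... | refl = refl
    owns-unique (first k eq) (pin j<n eq′) = contradiction (trans (sym eq) eq′) (a≢b (index<n (starts k)) j<n)
    owns-unique (first k eq) (same off _ _) = contradiction (_ , index<n (starts k) , inj₁ eq) off
    owns-unique (first k eq) (moved off _ _ _) = contradiction (_ , index<n (starts k) , inj₁ eq) off
    owns-unique (pin j<n eq) (first k eq′) = contradiction (trans (sym eq′) eq) (a≢b (index<n (starts k)) j<n)
    owns-unique (pin j<n eq) (pin i<n eq′) = cong (inj₁ ∘ z ∘ suc) (b-injective j<n i<n (trans (sym eq) eq′))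
    owns-unique (pin j<n eq) (same off _ _) = contradiction (_ , j<n , inj₂ eq) off
    owns-unique (pin j<n eq) (moved off _ _ _) = contradiction (_ , j<n , inj₂ eq) off
    owns-unique (same off _ _) (first k eq) = contradiction (_ , index<n (starts k) , inj₁ eq) off
    owns-unique (same off _ _) (pin j<n eq) = contradiction (_ , j<n , inj₂ eq) off
    owns-unique (same _ _ o) (same _ _ o′) = trans (sym o) o′
    owns-unique (same _ ¬p refl) (moved _ p refl _) = contradiction p ¬p
    owns-unique (moved off _ _ _) (first k eq) = contradiction (_ , index<n (starts k) , inj₁ eq) off
    owns-unique (moved off _ _ _) (pin j<n eq) = contradiction (_ , j<n , inj₂ eq) off
    owns-unique (moved _ p refl _) (same _ ¬p refl) = contradiction p ¬p
    owns-unique (moved _ _ refl c) (moved _ _ refl c′) = Maybe.just-injective (across-unique c c′)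

    owns-kept : ∀ {e x} → ¬ OnStrip e → Owns e x → Kept x
    owns-kept off (first k eq) = contradiction (_ , index<n (starts k) , inj₁ eq) off
    owns-kept off (pin j<n eq) = contradiction (_ , j<n , inj₂ eq) off
    owns-kept off (same {x} _ _ o) = plain-kept off (proj₂ (across-owner o))
    owns-kept off (moved _ _ _ c) = plain-kept off (across-sym c)

    -- The exit identifies the path, so such an edge would lead the path of this start back to the
    -- start itself, although levels fall.
    start≢moved : ∀ k {e x} → ¬ OnStrip e → OnPath x → owner e ≡ x → ¬ Across e x (just (start (starts k)))
    start≢moved k off (l , p) o c with same-start (path-snoc p off o c) []
    ... | refl = ℕ.n≮n _ (subst (_≤ level (start (starts k))) (level-step o c) (path-level p))

    owns-injective : ∀ {e e′ x} → Owns e x → Owns e′ x → e ≡ e′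
    owns-injective p q = go p q refl
      where
      go : ∀ {e e′ x y} → Owns e x → Owns e′ y → x ≡ y → e ≡ e′
      go (first k eq) (first l eq′) s≡s
        with same-start {k} {l} (subst (Path _) s≡s []) []
      ... | refl = trans eq (sym eq′)
      go (first k _) (pin j<n _) s≡z = contradiction s≡z (start-kept (starts k) j<n)
      go (first k _) (same _ ¬p _) refl = contradiction (k , []) ¬p
      go (first k _) (moved off p o c) refl = contradiction c (start≢moved k off p o)
      go (pin j<n _) (first k _) z≡s = contradiction (sym z≡s) (start-kept (starts k) j<n)
      go (pin j<n eq) (pin i<n eq′) z≡z =
        trans eq (trans (cong b (ℕ.suc-injective (z-injective j<n i<n (Sum.inj₁-injective z≡z)))) (sym eq′))
      go (pin j<n _) q@(same off _ _) z≡x = contradiction (sym z≡x) (owns-kept off q j<n)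
      go (pin j<n _) q@(moved off _ _ _) z≡x = contradiction (sym z≡x) (owns-kept off q j<n)
      go (same _ ¬p _) (first k _) refl = contradiction (k , []) ¬p
      go p@(same off _ _) (pin j<n _) x≡z = contradiction x≡z (owns-kept off p j<n)
      go (same _ _ o) (same _ _ o′) refl = owner-injective (trans o (sym o′))
      go (same _ ¬p _) (moved off (k , p) o c) refl = contradiction (k , path-snoc p off o c) ¬p
      go (moved off p o c) (first k _) refl = contradiction c (start≢moved k off p o)
      go p@(moved off _ _ _) (pin j<n _) x≡z = contradiction x≡z (owns-kept off p j<n)
      go (moved off (k , p) o c) (same _ ¬p _) refl = contradiction (k , path-snoc p off o c) ¬p
      go (moved off (k , p) o c) (moved off′ (l , p′) o′ c′) refl
        with same-start (path-snoc p off o c) (path-snoc p′ off′ o′ c′)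
      -- Both tails lie on the same path, one level above the common head, so they coincide.
      ... | refl = owner-injective (trans o (trans
        (path-unique p p′ (trans (level-step o c) (sym (level-step o′ c′)))) (sym o′)))

    owns-onto : ∀ x → x ≢ inj₁ (z 0) → ∃ λ e → Owns e x
    owns-onto x x≢z₀ with ℕ.anyUpTo? (λ j → x ≟ᵇ inj₁ (z j)) (suc n)
    ... | yes (zero , _ , eq) = contradiction eq x≢z₀
    ... | yes (suc j , 1+j<1+n , refl) = b j , pin (s≤s⁻¹ 1+j<1+n) refl
    ... | no none with onPath? x
    ... | yes (k , p) with path-last p
    ... | inj₁ refl = _ , first k refl
    ... | inj₂ (y , e , q , off , o , c) = e , moved off (k , q) o c
    owns-onto x x≢z₀ | no none | no ¬p with kept-edge {x} (λ {j} j≤n eq → none (j , s≤s j≤n , eq))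
    ... | e , o , inj₁ off = e , same off ¬p o
    -- The owner of `b j` is the end of the path from the start with exit `j`, so it is not off all
    -- paths.
    ... | e , o , inj₂ (j , j<n , refl) = contradiction (fromℕ< j<n , subst (Path _) o (path-to-exit
      (subst (Exits _) (trans (start-exit (starts k)) (cong just (Fin.toℕ-fromℕ< j<n))) (exit-spec (start-kept (starts k)))))) ¬p
      where
      k = fromℕ< j<n

    owns-across : ∀ {e x} → Owns e x → ∃ (Across e x)
    owns-across (first k refl) = start-across (starts k)
    owns-across (pin j<n refl) = _ , ends (swap (b-ends j<n))
    owns-across (same _ _ o) = across-owner o
    owns-across (moved _ _ _ c) = _ , across-sym c

    owns≢z₀ : ∀ {e x} → Owns e x → x ≢ inj₁ (z 0)
    owns≢z₀ (first k _) = start-kept (starts k) z≤n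
    owns≢z₀ (pin j<n _) eq = case z-injective j<n z≤n (Sum.inj₁-injective eq) of λ ()
    owns≢z₀ p@(same off _ _) = owns-kept off p z≤n
    owns≢z₀ p@(moved off _ _ _) = owns-kept off p z≤n

    owns-kind : ∀ {e x} → ¬ OnStrip e → Owns e x → isVertex (owner e) ≡ isVertex x
    owns-kind off (first k eq) = contradiction (_ , index<n (starts k) , inj₁ eq) off
    owns-kind off (pin j<n eq) = contradiction (_ , j<n , inj₂ eq) off
    owns-kind off (same _ _ o) = cong isVertex o
    owns-kind off (moved _ _ o c) = trans (cong isVertex o) (isVertex-across c)

    rerooted : Temperley (z 0)
    rerooted = record
      { owner = λ e → proj₁ (owns-total e)
      ; across = λ e → owns-across (proj₂ (owns-total e))
      ; owner-injective = λ {e} {e′} eq →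
          owns-injective (proj₂ (owns-total e)) (subst (Owns e′) (sym eq) (proj₂ (owns-total e′)))
      ; owner≢root = λ e → owns≢z₀ (proj₂ (owns-total e))
      ; edgeOf = λ x x≢z₀ → proj₁ (owns-onto x x≢z₀) ,
          owns-unique (proj₂ (owns-total _)) (proj₂ (owns-onto x x≢z₀))
      }

    -- The kinds are recorded since they determine the matching: an edge off the strip may change
    -- its owner, but only from vertex to vertex or from face to face.
    reroot : Σ (Forward (reverse S)) λ F′ → ∀ e → ¬ OnStrip e → isVertex (Forward.owner F′ e) ≡ isVertex (owner e)
    reroot = record { matching = matching′ ; pinned = pinned′ } , kinds
      where
      matching′ : Temperley (z (n ∸ n))
      -- The root of the reversed strip is `z (n ∸ n)`, which is `z 0` only up to a proof.
      matching′ = subst (λ i → Temperley (z i)) (sym (ℕ.n∸n≡0 n)) rerooted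
      owner′ : ∀ {i} (eq : 0 ≡ i) e →
        Temperley.owner (subst (λ i → Temperley (z i)) eq rerooted) e ≡ Temperley.owner rerooted e
      owner′ refl e = refl
      pinned′ : ∀ {j} → j < n → Temperley.owner matching′ (b (n ∸ suc j)) ≡ inj₁ (z (n ∸ j))
      pinned′ {j} j<n = trans (owner′ (sym (ℕ.n∸n≡0 n)) _) (trans
        (owns-unique (proj₂ (owns-total _)) (pin (ℕ.∸-monoʳ-< (s≤s z≤n) j<n) refl))
        (cong (inj₁ ∘ z) (sym (ℕ.+-∸-assoc 1 j<n))))
      kinds : ∀ e → ¬ OnStrip e → isVertex (Temperley.owner matching′ e) ≡ isVertex (owner e)
      kinds e off = trans (cong isVertex (owner′ (sym (ℕ.n∸n≡0 n)) e)) (sym (owns-kind off (proj₂ (owns-total e))))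

-- Translation between partner maps and ownership.

anyF-false : ∀ {n} {P : Fin n → Bool} → anyF P ≡ false → ∀ i → P i ≡ false
anyF-false {P = P} none i with P i in eq
... | false = refl
... | true = trans (sym (anyF-intro i eq)) none

module PartnerMaps (K : SGraph) (keep : Fin (SGraph.N K) → Bool) where
  open SGraph K

  record Good (q : Vec (Fin N) N) : Set where
    field
      kept : ∀ x → keep x ≡ true →
             keep (lookup q x) ≡ true × lookup q x ≢ x × lookup q (lookup q x) ≡ x × adj x (lookup q x) ≡ true
      removed : ∀ x → keep x ≡ false → lookup q x ≡ x

  isPM⇒Good : ∀ q → T (isPM K keep q) → Good q
  isPM⇒Good q pm = record { kept = kept ; removed = removed }
    where
    fine = anyF-false (trans (sym (Bool.not-involutive _)) (cong not (Equivalence.to Bool.T-≡ pm)))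
    kept : ∀ x → keep x ≡ true →
           keep (lookup q x) ≡ true × lookup q x ≢ x × lookup q (lookup q x) ≡ x × adj x (lookup q x) ≡ true
    kept x k with keep x | fine x
    ... | true | ok with ∧-true {keep (lookup q x)} (trans (sym (Bool.not-involutive _)) (cong not ok))
    ... | k′ , ok′ with ∧-true {not (lookup q x ==ᶠ x)} ok′
    ... | ne , ok″ with ∧-true {lookup q (lookup q x) ==ᶠ x} ok″
    ... | inv , adjacent = k′ , (λ eq → true≢false (trans (sym ne)
      (cong not (trans (cong (_==ᶠ x) eq) (==ᶠ-refl x))))) , ==ᶠ⇒≡ inv , adjacent
    removed : ∀ x → keep x ≡ false → lookup q x ≡ x
    removed x k with keep x | fine x
    ... | false | ok = ==ᶠ⇒≡ (trans (sym (Bool.not-involutive _)) (cong not ok))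

  ==ᶠ-false : ∀ {x y : Fin N} → x ≢ y → (x ==ᶠ y) ≡ false
  ==ᶠ-false x≢y = ≢true⇒≡false (x≢y ∘ ==ᶠ⇒≡)

  Good⇒isPM : ∀ q → Good q → T (isPM K keep q)
  Good⇒isPM q good with isPM K keep q in eq
  ... | true = tt
  ... | false with anyF-true (trans (sym (Bool.not-involutive _)) (cong not eq))
  ... | x , bad with keep x in k | bad
  ... | true | bad′ = let k′ , ne , inv , adjacent = Good.kept good x k in
    true≢false (trans (sym bad′) (cong not (∧-intro k′ (∧-intro (cong not (==ᶠ-false ne))
      (∧-intro (trans (cong (_==ᶠ x) inv) (==ᶠ-refl x)) adjacent)))))
  ... | false | bad′ =
    true≢false (trans (sym bad′) (cong not (trans (cong (_==ᶠ x) (Good.removed good x k)) (==ᶠ-refl x))))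

  matching-≡ : ∀ {q q′} {pm : T (isPM K keep q)} {pm′ : T (isPM K keep q′)} →
               (∀ x → lookup q x ≡ lookup q′ x) → _≡_ {A = PerfectMatching K keep} (q , pm) (q′ , pm′)
  matching-≡ {q} {q′} same with trans (sym (Vec.tabulate∘lookup q)) (trans (Vec.tabulate-cong same) (Vec.tabulate∘lookup q′))
  ... | refl = cong (q ,_) (Bool.T-irrelevant _ _)

module Correspondence (G : PlaneGraph) where
  open PlaneGraph G
  open Matchings G
  open Strips G
  open Rerooting G
  open Refinement G

  place : Kind → HVert
  place (orig v) = v ↑ˡ (nF + nE)
  place (fc f) = nV ↑ʳ (f ↑ˡ nE)
  place (ed e) = nV ↑ʳ (nF ↑ʳ e)

  kind-place : ∀ k → kind (place k) ≡ k
  kind-place (orig v) rewrite Fin.splitAt-↑ˡ nV v (nF + nE) = refl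
  kind-place (fc f) rewrite Fin.splitAt-↑ʳ nV (nF + nE) (f ↑ˡ nE) | Fin.splitAt-↑ˡ nF f nE = refl
  kind-place (ed e) rewrite Fin.splitAt-↑ʳ nV (nF + nE) (nF ↑ʳ e) | Fin.splitAt-↑ʳ nF nE e = refl

  place-kind : ∀ x → place (kind x) ≡ x
  place-kind x with splitAt nV x in eq
  ... | inj₁ v = Fin.splitAt⁻¹-↑ˡ eq
  ... | inj₂ y with splitAt nF y in eq′
  ... | inj₁ f = trans (cong (nV ↑ʳ_) (Fin.splitAt⁻¹-↑ˡ eq′)) (Fin.splitAt⁻¹-↑ʳ eq)
  ... | inj₂ e = trans (cong (nV ↑ʳ_) (Fin.splitAt⁻¹-↑ʳ eq′)) (Fin.splitAt⁻¹-↑ʳ eq)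

  black : Black → Kind
  black (inj₁ v) = orig v
  black (inj₂ f) = fc f

  black-injective : ∀ {x y} → black x ≡ black y → x ≡ y
  black-injective {inj₁ _} {inj₁ _} refl = refl
  black-injective {inj₂ _} {inj₂ _} refl = refl

  ed-injective : ∀ {e e′} → ed e ≡ ed e′ → e ≡ e′
  ed-injective refl = refl

  ==ᵐ⇒≡ : ∀ {m} {x y : Maybe (Fin m)} → (x ==ᵐ y) ≡ true → x ≡ y
  ==ᵐ⇒≡ {x = just _} {just _} eq = cong just (==ᶠ⇒≡ eq)
  ==ᵐ⇒≡ {x = nothing} {nothing} _ = refl

  ==ᵐ-refl : ∀ {m} (x : Maybe (Fin m)) → (x ==ᵐ x) ≡ true
  ==ᵐ-refl (just x) = ==ᶠ-refl x
  ==ᵐ-refl nothing = refl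

  edAdj⇒across : ∀ {e} x → edAdj e (black x) ≡ true → ∃ (Across e x)
  edAdj⇒across {e} (inj₁ v) adj with ∨-true {tl e ==ᶠ v} adj
  ... | inj₁ p = _ , ends (inj₁ (==ᶠ⇒≡ p , refl))
  ... | inj₂ p = _ , ends (inj₂ (refl , ==ᶠ⇒≡ p))
  edAdj⇒across {e} (inj₂ f) adj with ∨-true {face (e , false) ==ᵐ just f} adj
  ... | inj₁ p with face (e , true) in eq
  ... | just g = _ , sides (inj₁ (==ᵐ⇒≡ p , eq))
  ... | nothing = _ , outside (inj₁ (==ᵐ⇒≡ p , eq))
  edAdj⇒across {e} (inj₂ f) adj | inj₂ p with face (e , false) in eq
  ... | just g = _ , sides (inj₂ (eq , ==ᵐ⇒≡ p))
  ... | nothing = _ , outside (inj₂ (eq , ==ᵐ⇒≡ p))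

  across⇒edAdj : ∀ {e x m} → Across e x m → edAdj e (black x) ≡ true
  across⇒edAdj {e} c@(ends {u} _) with dart-at c
  ... | false , p = ∨-introˡ _ (trans (cong (_==ᶠ u) p) (==ᶠ-refl u))
  ... | true , p = ∨-introʳ (tl e ==ᶠ u) (trans (cong (_==ᶠ u) p) (==ᶠ-refl u))
  across⇒edAdj {e} {inj₂ f} c with dart-along c
  ... | false , p = ∨-introˡ _ (trans (cong (_==ᵐ just f) p) (==ᵐ-refl (just f)))
  ... | true , p = ∨-introʳ (face (e , false) ==ᵐ just f) (trans (cong (_==ᵐ just f) p) (==ᵐ-refl (just f)))

  adjK-sym : ∀ x e → adjK (black x) (ed e) ≡ edAdj e (black x)
  adjK-sym (inj₁ v) e = refl
  adjK-sym (inj₂ f) e = refl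

  adjK-edge : ∀ {e} k → adjK (ed e) k ≡ true → ∃ λ x → k ≡ black x
  adjK-edge (orig v) _ = inj₁ v , refl
  adjK-edge (fc f) _ = inj₂ f , refl

  adjK-black : ∀ x k → adjK (black x) k ≡ true → ∃ λ e → k ≡ ed e
  adjK-black (inj₁ v) (ed e) _ = e , refl
  adjK-black (inj₂ f) (ed e) _ = e , refl

  isOrig : Kind → Bool
  isOrig (orig _) = true
  isOrig _ = false

  isOrig-black : ∀ x → isOrig (black x) ≡ isVertex x
  isOrig-black (inj₁ _) = refl
  isOrig-black (inj₂ _) = refl

  -- States which vertices of the refinement remain purely in terms of the strip, so that one
  -- translation serves both G⁺ and G⁻.
  record Keeps {n} (S : Strip n) (keep : HVert → Bool) : Set where
    open Strip S
    field
      keep-vertex : ∀ v → keep (place (orig v)) ≡ true ⇔ (∀ {j} → j ≤ n → v ≢ z j)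
      keep-face : ∀ f → keep (place (fc f)) ≡ true
      keep-edge : ∀ e → keep (place (ed e)) ≡ true ⇔ (∀ {j} → j < n → e ≢ a j)

    keep-black : ∀ x → keep (place (black x)) ≡ true ⇔ Kept x
    keep-black (inj₁ v) = mk⇔ (λ p {j} j≤n eq → Equivalence.to (keep-vertex v) p {j} j≤n (Sum.inj₁-injective eq))
                              (λ kept → Equivalence.from (keep-vertex v) λ {j} j≤n eq → kept {j} j≤n (cong inj₁ eq))
    keep-black (inj₂ f) = mk⇔ (λ _ {j} → kept-face f {j}) (λ _ → keep-face f)

  PM : (HVert → Bool) → Set
  PM keep = PerfectMatching H keep

  -- The indicator of T. Its values off the strip are what both directions of the bijection
  -- preserve.
  vertexMatched : Vec HVert (nV + (nF + nE)) → Fin nE → Bool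
  vertexMatched q e = isOrig (kind (lookup q (place (ed e))))

  module _ {n} {S : Strip n} {keep : HVert → Bool} (keeps : Keeps S keep) where
    open Strip S
    open StripFacts S
    open Keeps keeps
    open PartnerMaps H keep

    removed? : ∀ e → Dec (∃ λ j → j < n × e ≡ a j)
    removed? e = ℕ.anyUpTo? (λ j → e ≟ᶠ a j) n

    edge-kept : ∀ {e} → ¬ (∃ λ j → j < n × e ≡ a j) → keep (place (ed e)) ≡ true
    edge-kept {e} none = Equivalence.from (keep-edge e) λ {j} j<n eq → none (j , j<n , eq)

    edge-removed : ∀ {j} → j < n → keep (place (ed (a j))) ≡ false
    edge-removed {j} j<n = ≢true⇒≡false λ p → Equivalence.to (keep-edge (a j)) p j<n refl

    module Read (M : PM keep) where
      private
        q = proj₁ M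
        good = isPM⇒Good q (proj₂ M)

      partner : Kind → Kind
      partner k = kind (lookup q (place k))

      place-partner : ∀ k → place (partner k) ≡ lookup q (place k)
      place-partner k = place-kind (lookup q (place k))

      partner-kept : ∀ {k} → keep (place k) ≡ true →
        keep (place (partner k)) ≡ true × partner (partner k) ≡ k × adjK k (partner k) ≡ true
      partner-kept {k} p with Good.kept good (place k) p
      ... | p′ , _ , inv , adjacent =
          subst (λ x → keep x ≡ true) (sym (place-partner k)) p′
        , trans (cong (kind ∘ lookup q) (place-partner k)) (trans (cong kind inv) (kind-place k))
        , subst (λ k′ → adjK k′ (partner k) ≡ true) (kind-place k) adjacent

      partner-removed : ∀ {k} → keep (place k) ≡ false → partner k ≡ k
      partner-removed {k} p = trans (cong kind (Good.removed good (place k) p)) (kind-place k)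

      -- `pin` supplies the pairs of deleted vertices that complete the matching of G⁺ to one of H
      -- minus the root.
      data Holds (e : Fin nE) (x : Black) : Set where
        pin : ∀ {j} → j < n → e ≡ a j → x ≡ inj₁ (z j) → Holds e x
        pair : keep (place (ed e)) ≡ true → partner (ed e) ≡ black x → Holds e x

      holds-total : ∀ e → ∃ (Holds e)
      holds-total e with removed? e
      ... | yes (j , j<n , eq) = _ , pin j<n eq refl
      ... | no none with adjK-edge _ (proj₂ (proj₂ (partner-kept {ed e} (edge-kept none))))
      ... | x , eq = x , pair (edge-kept none) eq

      holds-unique : ∀ {e x y} → Holds e x → Holds e y → x ≡ y
      holds-unique (pin i<n eq p) (pin j<n eq′ p′) with a-injective i<n j<n (trans (sym eq) eq′)
      ... | refl = trans p (sym p′)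
      holds-unique (pin i<n refl _) (pair k _) = contradiction (trans (sym k) (edge-removed i<n)) true≢false
      holds-unique (pair k _) (pin i<n refl _) = contradiction (trans (sym k) (edge-removed i<n)) true≢false
      holds-unique (pair _ p) (pair _ p′) = black-injective (trans (sym p) p′)

      pair-kept : ∀ {e x} → keep (place (ed e)) ≡ true → partner (ed e) ≡ black x → Kept x
      pair-kept {e} {x} k p = Equivalence.to (keep-black x)
        (subst (λ k → keep (place k) ≡ true) p (proj₁ (partner-kept {ed e} k)))

      holds-injective : ∀ {e e′ x y} → Holds e x → Holds e′ y → x ≡ y → e ≡ e′
      holds-injective (pin i<n eq refl) (pin j<n eq′ refl) z≡z
        with z-injective (ℕ.<⇒≤ i<n) (ℕ.<⇒≤ j<n) (Sum.inj₁-injective z≡z)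
      ... | refl = trans eq (sym eq′)
      holds-injective (pin i<n _ p) (pair k p′) refl = contradiction p (pair-kept k p′ (ℕ.<⇒≤ i<n))
      holds-injective (pair k p′) (pin i<n _ p) refl = contradiction p (pair-kept k p′ (ℕ.<⇒≤ i<n))
      holds-injective {e} {e′} (pair k p) (pair k′ p′) refl = ed-injective (trans
        (sym (proj₁ (proj₂ (partner-kept {ed e} k))))
        (trans (cong partner (trans p (sym p′))) (proj₁ (proj₂ (partner-kept {ed e′} k′)))))

      holds-onto : ∀ x → x ≢ inj₁ (z n) → ∃ λ e → Holds e x
      holds-onto x x≢zₙ with ℕ.anyUpTo? (λ j → x ≟ᵇ inj₁ (z j)) n
      ... | yes (j , j<n , eq) = a j , pin j<n refl eq
      ... | no none with partner-kept {black x} (Equivalence.from (keep-black x) kept)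
        where
        kept : Kept x
        kept j≤n eq with ℕ.m≤n⇒m<n∨m≡n j≤n
        ... | inj₁ j<n = none (_ , j<n , eq)
        ... | inj₂ refl = x≢zₙ eq
      ... | k , inv , adjacent with adjK-black x _ adjacent
      ... | e , eq = e , pair (subst (λ k → keep (place k) ≡ true) eq k) (trans (cong partner (sym eq)) inv)

      holds-across : ∀ {e x} → Holds e x → ∃ (Across e x)
      holds-across (pin j<n refl refl) = _ , ends (a-ends j<n)
      holds-across {e} {x} (pair k p) = edAdj⇒across x
        (subst (λ k → edAdj e k ≡ true) p (proj₂ (proj₂ (partner-kept {ed e} k))))

      holds≢root : ∀ {e x} → Holds e x → x ≢ inj₁ (z n)
      holds≢root (pin j<n _ refl) eq = ℕ.<⇒≢ j<n (z-injective (ℕ.<⇒≤ j<n) ℕ.≤-refl (Sum.inj₁-injective eq))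
      holds≢root (pair k p) = pair-kept k p ℕ.≤-refl

      toForward : Forward S
      toForward = record
        { matching = record
          { owner = λ e → proj₁ (holds-total e)
          ; across = λ e → holds-across (proj₂ (holds-total e))
          ; owner-injective = λ eq → holds-injective (proj₂ (holds-total _)) (proj₂ (holds-total _)) eq
          ; owner≢root = λ e → holds≢root (proj₂ (holds-total e))
          ; edgeOf = λ x x≢zₙ → proj₁ (holds-onto x x≢zₙ) ,
              holds-unique (proj₂ (holds-total _)) (proj₂ (holds-onto x x≢zₙ)) }
        ; pinned = λ j<n → holds-unique (proj₂ (holds-total _)) (pin j<n refl refl) }

      owner-partner : ∀ {e} → keep (place (ed e)) ≡ true → partner (ed e) ≡ black (Forward.owner toForward e)
      owner-partner {e} k with holds-total e
      ... | _ , pin j<n refl _ = contradiction (trans (sym k) (edge-removed j<n)) true≢false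
      ... | x , pair _ p = p

      plain-kind : ∀ {e} → ¬ OnStrip e → isVertex (Forward.owner toForward e) ≡ vertexMatched (proj₁ M) e
      plain-kind {e} off = trans (sym (isOrig-black _))
        (cong isOrig (sym (owner-partner (edge-kept λ (j , j<n , eq) → off (j , j<n , inj₁ eq)))))

    module _ (F : Forward S) where
      open Forward F

      kept-edgeOf : ∀ x → Kept x → ∃ λ e → owner e ≡ x
      kept-edgeOf x kept = edgeOf x (kept ℕ.≤-refl)

      mate : Kind → Kind
      mateᵇ : Black → Kind
      mate (ed e) with removed? e
      ... | yes _ = ed e
      ... | no _ = black (owner e)
      mate (orig v) = mateᵇ (inj₁ v)
      mate (fc f) = mateᵇ (inj₂ f)
      mateᵇ x with kept? x
      ... | yes kept = ed (proj₁ (kept-edgeOf x kept))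
      ... | no _ = black x

      mate-black : ∀ x → mate (black x) ≡ mateᵇ x
      mate-black (inj₁ _) = refl
      mate-black (inj₂ _) = refl

      mate-owner : ∀ {e} → ¬ (∃ λ j → j < n × e ≡ a j) → mate (ed e) ≡ black (owner e)
      mate-owner {e} none with removed? e
      ... | yes gone = contradiction gone none
      ... | no _ = refl

      owner-kept : ∀ {e} → ¬ (∃ λ j → j < n × e ≡ a j) → Kept (owner e)
      owner-kept {e} none j≤n eq with ℕ.m≤n⇒m<n∨m≡n j≤n
      ... | inj₁ j<n = none (_ , j<n , owner-injective (trans eq (sym (pinned j<n))))
      ... | inj₂ refl = owner≢root e eq

      owned-present : ∀ {e x} → Kept x → owner e ≡ x → ¬ (∃ λ j → j < n × e ≡ a j)
      owned-present kept o (j , j<n , refl) = kept (ℕ.<⇒≤ j<n) (trans (sym o) (pinned j<n))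

      mateᵇ-owner : ∀ {e x} → Kept x → owner e ≡ x → mateᵇ x ≡ ed e
      mateᵇ-owner {e} {x} kept o with kept? x
      ... | yes kept′ = cong ed (owner-injective (trans (proj₂ (kept-edgeOf x kept′)) (sym o)))
      ... | no ¬kept = contradiction (λ {j} → kept {j}) ¬kept

      Matched : Kind → Set
      Matched k = keep (place (mate k)) ≡ true × mate k ≢ k × mate (mate k) ≡ k × adjK k (mate k) ≡ true

      ed≢black : ∀ {e} x → ed e ≢ black x
      ed≢black (inj₁ _) ()
      ed≢black (inj₂ _) ()

      edge-matched : ∀ {e} → ¬ (∃ λ j → j < n × e ≡ a j) → Matched (ed e)
      edge-matched {e} none rewrite mate-owner none | mate-black (owner e) =
          Equivalence.from (keep-black (owner e)) (owner-kept none)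
        , ≢-sym (ed≢black (owner e))
        , mateᵇ-owner (owner-kept none) refl
        , across⇒edAdj (proj₂ (across e))

      black-matched : ∀ x → Kept x → Matched (black x)
      black-matched x kept with kept-edgeOf x kept
      ... | e , refl rewrite mate-black (owner e) | mateᵇ-owner kept refl =
          edge-kept (owned-present kept refl)
        , ed≢black (owner e)
        , mate-owner (owned-present kept refl)
        , trans (adjK-sym (owner e) e) (across⇒edAdj (proj₂ (across e)))

      matched : ∀ k → keep (place k) ≡ true → Matched k
      matched (orig v) p = black-matched (inj₁ v) (Equivalence.to (keep-black (inj₁ v)) p)
      matched (fc f) p = black-matched (inj₂ f) (Equivalence.to (keep-black (inj₂ f)) p)
      matched (ed e) p = edge-matched λ (j , j<n , eq) → Equivalence.to (keep-edge e) p j<n eq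

      mateᵇ-fixed : ∀ x → keep (place (black x)) ≡ false → mateᵇ x ≡ black x
      mateᵇ-fixed x p with kept? x
      ... | yes kept = contradiction (trans (sym (Equivalence.from (keep-black x) kept)) p) true≢false
      ... | no _ = refl

      fixed : ∀ k → keep (place k) ≡ false → mate k ≡ k
      fixed (orig v) p = mateᵇ-fixed (inj₁ v) p
      fixed (fc f) p = mateᵇ-fixed (inj₂ f) p
      fixed (ed e) p with removed? e
      ... | yes _ = refl
      ... | no none = contradiction (trans (sym (edge-kept none)) p) true≢false

      partners : Vec HVert (nV + (nF + nE))
      partners = tabulate (place ∘ mate ∘ kind)

      lookup-partners : ∀ x → lookup partners x ≡ place (mate (kind x))
      lookup-partners = Vec.lookup∘tabulate (place ∘ mate ∘ kind)

      fromForward : PM keep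
      fromForward = partners , Good⇒isPM partners record { kept = kept ; removed = removed }
        where
        kept : ∀ x → keep x ≡ true → keep (lookup partners x) ≡ true × lookup partners x ≢ x ×
               lookup partners (lookup partners x) ≡ x × adjK (kind x) (kind (lookup partners x)) ≡ true
        kept x p with matched (kind x) (subst (λ y → keep y ≡ true) (sym (place-kind x)) p)
        ... | k , ne , inv , adjacent rewrite lookup-partners x
            | lookup-partners (place (mate (kind x))) | kind-place (mate (kind x)) =
            k
          , (λ eq → ne (trans (sym (kind-place _)) (cong kind eq)))
          , trans (cong place inv) (place-kind x)
          , adjacent
        removed : ∀ x → keep x ≡ false → lookup partners x ≡ x
        removed x p = trans (lookup-partners x) (trans
          (cong place (fixed (kind x) (subst (λ y → keep y ≡ false) (sym (place-kind x)) p))) (place-kind x))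

      fromForward-kind : ∀ {e} → ¬ OnStrip e → vertexMatched partners e ≡ isVertex (owner e)
      fromForward-kind {e} off = trans (cong (isOrig ∘ kind) (lookup-partners (place (ed e))))
        (trans (cong isOrig (trans (kind-place _) (trans (cong mate (kind-place (ed e)))
          (mate-owner λ (j , j<n , eq) → off (j , j<n , inj₁ eq))))) (isOrig-black (owner e)))

    vertexMatched-injective : ∀ (M M′ : PM keep) →
      (∀ e → ¬ OnStrip e → vertexMatched (proj₁ M) e ≡ vertexMatched (proj₁ M′) e) → M ≡ M′
    vertexMatched-injective M M′ same = matching-≡ λ x →
      subst (λ y → lookup (proj₁ M) y ≡ lookup (proj₁ M′) y) (place-kind x)
        (trans (sym (R.place-partner (kind x))) (trans (cong place (agree (kind x))) (R′.place-partner (kind x))))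
      where
      module R = Read M
      module R′ = Read M′
      F = R.toForward
      F′ = R′.toForward
      owners : ∀ e → Forward.owner F e ≡ Forward.owner F′ e
      owners = owner-determined F F′ λ e off → trans (R.plain-kind off) (trans (same e off) (sym (R′.plain-kind off)))
      edges : ∀ e → keep (place (ed e)) ≡ true → R.partner (ed e) ≡ R′.partner (ed e)
      edges e k = trans (R.owner-partner k) (trans (cong black (owners e)) (sym (R′.owner-partner k)))
      blacks : ∀ x → keep (place (black x)) ≡ true → R.partner (black x) ≡ R′.partner (black x)
      blacks x k with R.partner-kept {black x} k
      ... | k′ , inv , adjacent with adjK-black x _ adjacent
      -- The first matching joins `x` to `e`; both agree at the edge-vertex `e`, so the second joins
      -- `e` to `x` as well.
      ... | e , eq = trans eq (trans (sym (proj₁ (proj₂ (R′.partner-kept {ed e} kₑ))))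
          (cong R′.partner (trans (sym (edges e kₑ)) (trans (cong R.partner (sym eq)) inv))))
        where
        kₑ : keep (place (ed e)) ≡ true
        kₑ = subst (λ k → keep (place k) ≡ true) eq k′
      kept-agree : ∀ k → keep (place k) ≡ true → R.partner k ≡ R′.partner k
      kept-agree (orig v) = blacks (inj₁ v)
      kept-agree (fc f) = blacks (inj₂ f)
      kept-agree (ed e) = edges e
      agree : ∀ k → R.partner k ≡ R′.partner k
      agree k with keep (place k) in eq
      ... | true = kept-agree k eq
      ... | false = trans (R.partner-removed {k} eq) (sym (R′.partner-removed {k} eq))

  module _ {n} {S : Strip n} {keep keep′ : HVert → Bool}
           (keeps : Keeps S keep) (keeps′ : Keeps (reverse S) keep′) where
    open Strip S

    transport : PM keep → PM keep′
    transport M = fromForward keeps′ (proj₁ (Reroot.reroot (Read.toForward keeps M)))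

    transport-kind : ∀ M {e} → ¬ OnStrip e → ¬ Strip.OnStrip (reverse S) e →
                     vertexMatched (proj₁ (transport M)) e ≡ vertexMatched (proj₁ M) e
    transport-kind M {e} off off′ = trans
      (fromForward-kind keeps′ (proj₁ (Reroot.reroot (Read.toForward keeps M))) off′)
      (trans (proj₂ (Reroot.reroot (Read.toForward keeps M)) e off) (Read.plain-kind keeps M off))

-- The given path as a strip, and the bijection.

-- Makes the path data total on the natural numbers, as `Strip` requires. Out of range the value is
-- the first index, a default on which `g n` relies.
nth : ∀ m → 0 < m → ℕ → Fin m
nth (suc m) _ i with i ℕ.<? suc m
... | yes i<1+m = fromℕ< i<1+m
... | no _ = zero

toℕ-nth : ∀ {m} 0<m {i} → i < m → toℕ (nth m 0<m i) ≡ i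
toℕ-nth {suc m} _ {i} i<1+m with i ℕ.<? suc m
... | yes lt = Fin.toℕ-fromℕ< lt
... | no ¬lt = contradiction i<1+m ¬lt

nth-toℕ : ∀ {m} 0<m (k : Fin m) → nth m 0<m (toℕ k) ≡ k
nth-toℕ 0<m k = Fin.toℕ-injective (toℕ-nth 0<m (Fin.toℕ<n k))

nth-beyond : ∀ {m} 0<m {i} → m ≤ i → toℕ (nth m 0<m i) ≡ 0
nth-beyond {suc m} _ {i} m≤i with i ℕ.<? suc m
... | yes lt = contradiction lt (ℕ.≤⇒≯ m≤i)
... | no _ = refl

isEven-double : ∀ j → isEven (j * 2) ≡ true
isEven-double zero = refl
isEven-double (suc j) = trans (Bool.not-involutive _) (isEven-double j)

halve : ∀ i → (∃ λ j → i ≡ j * 2 × isEven i ≡ true) ⊎ (∃ λ j → i ≡ suc (j * 2) × isEven i ≡ false)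
halve zero = inj₁ (0 , refl , refl)
halve (suc i) with halve i
... | inj₁ (j , refl , even) = inj₂ (j , refl , cong not even)
... | inj₂ (j , refl , odd) = inj₁ (suc j , refl , cong not odd)

double≢suc-double : ∀ i j → i * 2 ≢ suc (j * 2)
double≢suc-double i j eq = ℕ.even≢odd i j
  (trans (ℕ.*-comm 2 i) (trans eq (cong suc (ℕ.*-comm j 2))))

module PathStrip (G : PlaneGraph) (n : ℕ) (1≤n : 1 ≤ n)
  (p : Fin (suc (2 * n)) → Fin (PlaneGraph.nV G)) (pe : Fin (2 * n) → Fin (PlaneGraph.nE G))
  (p-injective : ∀ i j → p i ≡ p j → i ≡ j)
  (pe-ends : ∀ k → (PlaneGraph.tl G (pe k) ≡ p (inject₁ k) × PlaneGraph.hd G (pe k) ≡ p (suc k))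
                 ⊎ (PlaneGraph.tl G (pe k) ≡ p (suc k) × PlaneGraph.hd G (pe k) ≡ p (inject₁ k)))
  (deg-first : PlaneGraph.deg G (p zero) ≡ 1)
  (deg-last : PlaneGraph.deg G (p (fromℕ (2 * n))) ≡ 1)
  (end-faces : ∀ k → (toℕ k ≡ 0 ⊎ suc (toℕ k) ≡ 2 * n) →
     PlaneGraph.face G (pe k , false) ≡ nothing × PlaneGraph.face G (pe k , true) ≡ nothing)
  (inner-faces : ∀ k → 1 ≤ toℕ k → suc (suc (toℕ k)) ≤ 2 * n →
     PlaneGraph.face G (pe k , false) ≡ nothing ⊎ PlaneGraph.face G (pe k , true) ≡ nothing)
  (deg-even : ∀ i → isEven (toℕ i) ≡ true → 0 < toℕ i → toℕ i < 2 * n → PlaneGraph.deg G (p i) ≡ 2)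
  where
  open PlaneGraph G
  open Matchings G
  open Strips G
  open Rerooting G
  open Correspondence G
  open Refinement G using (H; HVert; Kind; orig; fc; ed; kind)
  open Refinement.Path G n p pe

  private
    2n≡n2 : 2 * n ≡ n * 2
    2n≡n2 = ℕ.*-comm 2 n

    0<2n : 0 < 2 * n
    0<2n = ℕ.<-≤-trans 1≤n (ℕ.m≤m+n n _)

    double≤ : ∀ {j} → j ≤ n → j * 2 ≤ 2 * n
    double≤ {j} j≤n = subst (j * 2 ≤_) (sym 2n≡n2) (ℕ.*-monoˡ-≤ 2 j≤n)

    suc-double< : ∀ {j} → j < n → suc (j * 2) < 2 * n
    suc-double< = double≤

    double< : ∀ {j} → j < n → j * 2 < 2 * n
    double< j<n = ℕ.<-trans (ℕ.n<1+n _) (suc-double< j<n)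

    P : ℕ → Fin nV
    P i = p (nth (suc (2 * n)) (s≤s z≤n) i)

    E : ℕ → Fin nE
    E i = pe (nth (2 * n) 0<2n i)

    P-toℕ : ∀ i → p i ≡ P (toℕ i)
    P-toℕ i = cong p (sym (nth-toℕ (s≤s z≤n) i))

    P-injective : ∀ {i j} → i ≤ 2 * n → j ≤ 2 * n → P i ≡ P j → i ≡ j
    P-injective i≤ j≤ eq = trans (sym (toℕ-nth (s≤s z≤n) (s≤s i≤)))
      (trans (cong toℕ (p-injective _ _ eq)) (toℕ-nth (s≤s z≤n) (s≤s j≤)))

    E-ends : ∀ {i} → i < 2 * n → Ends (E i) (P i) (P (suc i))
    E-ends {i} i< = subst (λ v → Ends (E i) v (P (suc i))) source
      (subst (λ v → Ends (E i) (p (inject₁ k)) v) target (pe-ends k))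
      where
      k = nth _ 0<2n i
      source : p (inject₁ k) ≡ P i
      source = trans (P-toℕ _) (cong P (trans (Fin.toℕ-inject₁ k) (toℕ-nth 0<2n i<)))
      target : p (suc k) ≡ P (suc i)
      target = trans (P-toℕ _) (cong (P ∘ suc) (toℕ-nth 0<2n i<))

    E-injective : ∀ {i j} → i < 2 * n → j < 2 * n → E i ≡ E j → i ≡ j
    E-injective i< j< eq with Ends-cases (E-ends i<) (subst (λ e → Ends e _ _) (sym eq) (E-ends j<))
    ... | inj₁ (q , _) = P-injective (ℕ.<⇒≤ i<) (ℕ.<⇒≤ j<) q
    ... | inj₂ (q , r) with P-injective (ℕ.<⇒≤ i<) j< q
    ... | refl = contradiction (P-injective i< (ℕ.<⇒≤ j<) r) (ℕ.>⇒≢ (ℕ.m<n⇒m<1+n (ℕ.n<1+n _)))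

    farFace : Fin nE → Maybe (Fin nF)
    farFace e with face (e , false)
    ... | nothing = face (e , true)
    ... | just f = just f

    farFace-sides : ∀ e → face (e , false) ≡ nothing ⊎ face (e , true) ≡ nothing → Sides e (farFace e) nothing
    farFace-sides e bare with face (e , false)
    ... | nothing = inj₂ (refl , refl)
    farFace-sides e (inj₂ q) | just f = inj₁ (refl , q)

    farFace-nothing : ∀ e → face (e , false) ≡ nothing → face (e , true) ≡ nothing → farFace e ≡ nothing
    farFace-nothing e q r with face (e , false)
    ... | nothing = r

    E-end-faces : ∀ {i} → toℕ (nth _ 0<2n i) ≡ 0 ⊎ suc (toℕ (nth _ 0<2n i)) ≡ 2 * n →
                  face (E i , false) ≡ nothing × face (E i , true) ≡ nothing
    E-end-faces = end-faces _

    E-face : ∀ {i} → i < 2 * n → face (E i , false) ≡ nothing ⊎ face (E i , true) ≡ nothing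
    E-face {zero} i< = inj₁ (proj₁ (E-end-faces (inj₁ (toℕ-nth 0<2n i<))))
    E-face {suc i} i< with ℕ.m≤n⇒m<n∨m≡n i<
    ... | inj₂ eq = inj₁ (proj₁ (E-end-faces (inj₂ (trans (cong suc (toℕ-nth 0<2n i<)) eq))))
    ... | inj₁ lt = inner-faces _ (subst (1 ≤_) (sym (toℕ-nth 0<2n i<)) (s≤s z≤n))
      (subst (λ m → suc (suc m) ≤ 2 * n) (sym (toℕ-nth 0<2n i<)) lt)

    deg-inner : ∀ {j} → 0 < j → j < n → deg (P (j * 2)) ≡ 2
    deg-inner {suc j} 0<j j<n = deg-even k (subst (λ m → isEven m ≡ true) (sym k≡) (isEven-double (suc j)))
      (subst (0 <_) (sym k≡) (s≤s z≤n)) (subst (_< 2 * n) (sym k≡) (double< j<n))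
      where
      k = nth (suc (2 * n)) (s≤s z≤n) (suc j * 2)
      k≡ : toℕ k ≡ suc j * 2
      k≡ = toℕ-nth (s≤s z≤n) (s≤s (double≤ (ℕ.<⇒≤ j<n)))

    end-at : ∀ {e u v} → Ends e u v → ∃ λ b → vert (e , b) ≡ v
    end-at (inj₁ (_ , q)) = true , q
    end-at (inj₂ (q , _)) = false , q

    leaf : ∀ {v d d′} → deg v ≡ 1 → vert d ≡ v → vert d′ ≡ v → d ≡ d′
    leaf {v} {d} {d′} deg1 at at′ with Product.≡-dec _≟ᶠ_ Bool._≟_ d d′
    ... | yes eq = eq
    ... | no d≢d′ = contradiction (distinct-darts-≤deg v (λ { zero → d ; (suc zero) → d′ })
        (λ { zero → at ; (suc zero) → at′ })
        (λ { zero zero _ → refl ; zero (suc zero) eq → contradiction eq d≢d′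
           ; (suc zero) zero eq → contradiction (sym eq) d≢d′ ; (suc zero) (suc zero) _ → refl }))
      (subst (λ m → ¬ 2 ≤ m) (sym deg1) (ℕ.n≮n 1))

    only-two : ∀ {v d d′} → deg v ≡ 2 → vert d ≡ v → vert d′ ≡ v → d ≢ d′ →
               ∀ d″ → vert d″ ≡ v → d″ ≡ d ⊎ d″ ≡ d′
    only-two {v} {d} {d′} deg2 at at′ d≢d′ d″ at″
      with Product.≡-dec _≟ᶠ_ Bool._≟_ d″ d | Product.≡-dec _≟ᶠ_ Bool._≟_ d″ d′
    ... | yes eq | _ = inj₁ eq
    ... | no _ | yes eq = inj₂ eq
    ... | no ≢d | no ≢d′ = contradiction (distinct-darts-≤deg v pick pick-at pick-injective)
      (subst (λ m → ¬ 3 ≤ m) (sym deg2) (ℕ.n≮n 2))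
      where
      pick : Fin 3 → Dart
      pick zero = d
      pick (suc zero) = d′
      pick (suc (suc zero)) = d″
      pick-at : ∀ i → vert (pick i) ≡ v
      pick-at zero = at
      pick-at (suc zero) = at′
      pick-at (suc (suc zero)) = at″
      pick-injective : ∀ i j → pick i ≡ pick j → i ≡ j
      pick-injective zero zero _ = refl
      pick-injective zero (suc zero) eq = contradiction eq d≢d′
      pick-injective zero (suc (suc zero)) eq = contradiction (sym eq) ≢d
      pick-injective (suc zero) zero eq = contradiction (sym eq) d≢d′
      pick-injective (suc zero) (suc zero) _ = refl
      pick-injective (suc zero) (suc (suc zero)) eq = contradiction (sym eq) ≢d′
      pick-injective (suc (suc zero)) zero eq = contradiction eq ≢d
      pick-injective (suc (suc zero)) (suc zero) eq = contradiction eq ≢d′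
      pick-injective (suc (suc zero)) (suc (suc zero)) _ = refl

    -- A rotation fixing `d` would never reach `d′`, against cyclicity at `v`.
    rotates : ∀ {v d d′} → deg v ≡ 2 → vert d ≡ v → vert d′ ≡ v → d ≢ d′ → σ d ≡ d′
    rotates {v} {d} {d′} deg2 at at′ d≢d′ with only-two deg2 at at′ d≢d′ (σ d) (trans (σ-vert d) at)
    ... | inj₂ eq = eq
    ... | inj₁ fixed with σ-cyclic d d′ (trans at (sym at′))
    ... | k , reached = contradiction (trans (sym (stuck k)) reached) d≢d′
      where
      stuck : ∀ k → iter σ k d ≡ d
      stuck zero = refl
      stuck (suc k) = trans (cong σ (stuck k)) fixed

    sides-along : ∀ {e e′ b b′ x y} → face (e′ , b′) ≡ face (e , not b) → face (e′ , not b′) ≡ face (e , b) →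
                  Sides e x y → Sides e′ x y
    sides-along {b = false} {false} q r (inj₁ (s , t)) = inj₂ (trans q t , trans r s)
    sides-along {b = false} {false} q r (inj₂ (s , t)) = inj₁ (trans q t , trans r s)
    sides-along {b = false} {true} q r (inj₁ (s , t)) = inj₁ (trans r s , trans q t)
    sides-along {b = false} {true} q r (inj₂ (s , t)) = inj₂ (trans r s , trans q t)
    sides-along {b = true} {false} q r (inj₁ (s , t)) = inj₁ (trans q s , trans r t)
    sides-along {b = true} {false} q r (inj₂ (s , t)) = inj₂ (trans q s , trans r t)
    sides-along {b = true} {true} q r (inj₁ (s , t)) = inj₂ (trans r t , trans q s)
    sides-along {b = true} {true} q r (inj₂ (s , t)) = inj₁ (trans r t , trans q s)

    -- zⱼ₊₁ has degree two, so the two edges there have the same two faces.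
    b-sides′ : ∀ {j} → j < n → Sides (E (suc (j * 2))) (farFace (E (suc j * 2))) nothing
    b-sides′ {j} j<n with suc j ℕ.<? n
    ... | no ≮n = subst (λ x → Sides (E (suc (j * 2))) x nothing) (sym beyond) (inj₁ last-bare)
      where
      1+j≡n : suc j ≡ n
      1+j≡n = ℕ.≤-antisym j<n (ℕ.≮⇒≥ ≮n)
      beyond : farFace (E (suc j * 2)) ≡ nothing
      beyond = farFace-nothing _ (proj₁ bare) (proj₂ bare)
        where bare = E-end-faces {suc j * 2} (inj₁ (nth-beyond 0<2n (ℕ.≤-reflexive (trans 2n≡n2 (cong (_* 2) (sym 1+j≡n))))))
      last-bare : face (E (suc (j * 2)) , false) ≡ nothing × face (E (suc (j * 2)) , true) ≡ nothing
      last-bare = E-end-faces (inj₂ (trans (cong suc (toℕ-nth 0<2n (suc-double< j<n)))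
        (trans (cong (_* 2) 1+j≡n) (sym 2n≡n2))))
    ... | yes 1+j<n with end-at (E-ends (suc-double< j<n)) | end-at (swap (E-ends (double< 1+j<n)))
    ... | b , at | b′ , at′ = sides-along {E (suc j * 2)} {b = b′} {b}
        (trans (cong face (sym σd′)) (face-σ (E (suc j * 2) , b′)))
        (trans (sym (face-σ (E (suc (j * 2)) , b))) (cong face σd))
        (farFace-sides _ (E-face (double< 1+j<n)))
      where
      distinct : (E (suc (j * 2)) , b) ≢ (E (suc j * 2) , b′)
      distinct eq = ℕ.<⇒≢ (ℕ.n<1+n _) (E-injective (suc-double< j<n) (double< 1+j<n) (cong proj₁ eq))
      σd : σ (E (suc (j * 2)) , b) ≡ (E (suc j * 2) , b′)
      σd = rotates {d = _ , b} {_ , b′} (deg-inner (s≤s z≤n) 1+j<n) at at′ distinct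
      σd′ : σ (E (suc j * 2) , b′) ≡ (E (suc (j * 2)) , b)
      σd′ = rotates {d = _ , b′} {_ , b} (deg-inner (s≤s z≤n) 1+j<n) at′ at (≢-sym distinct)

    first-edge : ∀ d → vert d ≡ P 0 → proj₁ d ≡ E 0
    first-edge d at with end-at (swap (E-ends 0<2n))
    ... | b , at′ = cong proj₁ (leaf {d = d} {_ , b} (trans (cong deg (sym (P-toℕ zero))) deg-first) at at′)

    last-edge : ∀ {j} → suc j ≡ n → ∀ d → vert d ≡ P (suc j * 2) → proj₁ d ≡ E (suc (j * 2))
    last-edge {j} 1+j≡n d at with end-at (E-ends (suc-double< (ℕ.≤-reflexive 1+j≡n)))
    ... | b , at′ = cong proj₁ (leaf {d = d} {_ , b} (trans (cong deg (trans (cong P index) (sym (P-toℕ (fromℕ (2 * n)))))) deg-last) at at′)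
      where
      index : suc j * 2 ≡ toℕ (fromℕ (2 * n))
      index = trans (cong (_* 2) 1+j≡n) (trans (sym 2n≡n2) (sym (Fin.toℕ-fromℕ (2 * n))))

    OnPath : Fin nE → Set
    OnPath e = ∃ λ j → j < n × (e ≡ E (j * 2) ⊎ e ≡ E (suc (j * 2)))

    -- The even-indexed path vertices have degree one at the ends and two in between, and path edges
    -- already account for all these darts.
    edge-at : ∀ {j} → j ≤ n → ∀ d → vert d ≡ P (j * 2) → OnPath (proj₁ d)
    edge-at {zero} _ d at = 0 , 1≤n , inj₁ (first-edge d at)
    edge-at {suc j} j<n d at with suc j ℕ.<? n
    ... | no ≮n = j , j<n , inj₂ (last-edge (ℕ.≤-antisym j<n (ℕ.≮⇒≥ ≮n)) d at)
    ... | yes 1+j<n with end-at (E-ends (suc-double< j<n)) | end-at (swap (E-ends (double< 1+j<n)))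
    ... | b , at₁ | b′ , at₂
      with only-two {d = _ , b} {_ , b′} (deg-inner (s≤s z≤n) 1+j<n) at₁ at₂
             (λ eq → ℕ.<⇒≢ (ℕ.n<1+n _) (E-injective (suc-double< j<n) (double< 1+j<n) (cong proj₁ eq))) d at
    ... | inj₁ eq = j , j<n , inj₂ (cong proj₁ eq)
    ... | inj₂ eq = suc j , 1+j<n , inj₁ (cong proj₁ eq)

  strip : Strip n
  strip = record
    { w = λ j → P (suc (j * 2))
    ; z = λ j → P (j * 2)
    ; a = λ j → E (j * 2)
    ; b = λ j → E (suc (j * 2))
    ; g = λ j → farFace (E (j * 2))
    ; 0<n = 1≤n
    ; a-ends = λ j<n → E-ends (double< j<n)
    ; b-ends = λ j<n → E-ends (suc-double< j<n)
    ; a-sides = λ j<n → farFace-sides _ (E-face (double< j<n))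
    ; b-sides = b-sides′
    ; g-first = farFace-nothing _ (proj₁ first-bare) (proj₂ first-bare)
    ; g-last = farFace-nothing _ (proj₁ last-bare) (proj₂ last-bare)
    ; w-injective = λ {i} {j} i<n j<n eq → ℕ.*-cancelʳ-≡ i j 2 (ℕ.suc-injective
        (P-injective (ℕ.<⇒≤ (suc-double< i<n)) (ℕ.<⇒≤ (suc-double< j<n)) eq))
    ; z-injective = λ {i} {j} i≤n j≤n eq → ℕ.*-cancelʳ-≡ i j 2 (P-injective (double≤ i≤n) (double≤ j≤n) eq)
    ; w≢z = λ {i} {j} i<n j≤n eq → double≢suc-double j i
        (sym (P-injective (ℕ.<⇒≤ (suc-double< i<n)) (double≤ j≤n) eq))
    ; z-edge = λ e j≤n → [ edge-at j≤n (e , false) , edge-at j≤n (e , true) ]′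
    }
    where
    first-bare = E-end-faces {0} (inj₁ (toℕ-nth 0<2n 0<2n))
    -- Index `n * 2` is out of range, so `E` gives the first path edge, whose two sides are
    -- unbounded, just as `g n` has to be.
    last-bare = E-end-faces {n * 2} (inj₁ (nth-beyond 0<2n (ℕ.≤-reflexive 2n≡n2)))

  private
    evenOrig⇔ : ∀ v → evenOrig v ≡ true ⇔ (∃ λ j → j ≤ n × v ≡ P (j * 2))
    evenOrig⇔ v = mk⇔ to from
      where
      to : evenOrig v ≡ true → ∃ λ j → j ≤ n × v ≡ P (j * 2)
      to q with anyF-true {P = λ i → isEven (toℕ i) ∧ (p i ==ᶠ v)} q
      ... | i , r with ∧-true {isEven (toℕ i)} r | halve (toℕ i)
      ... | even , at | inj₁ (j , eq , _) = j
        , ℕ.*-cancelʳ-≤ j n 2 (subst (j * 2 ≤_) 2n≡n2 (subst (_≤ 2 * n) eq (s≤s⁻¹ (Fin.toℕ<n i))))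
        , trans (sym (==ᶠ⇒≡ at)) (trans (P-toℕ i) (cong P eq))
      ... | even , _ | inj₂ (_ , _ , odd) = contradiction (trans (sym even) odd) true≢false
      from : (∃ λ j → j ≤ n × v ≡ P (j * 2)) → evenOrig v ≡ true
      from (j , j≤n , refl) = anyF-intro {P = λ i → isEven (toℕ i) ∧ (p i ==ᶠ v)} (nth (suc (2 * n)) (s≤s z≤n) (j * 2)) (∧-intro
        (trans (cong isEven (toℕ-nth (s≤s z≤n) (s≤s (double≤ j≤n)))) (isEven-double j)) (==ᶠ-refl _))

    removed-even : ∀ e → mRemoved true e ≡ true ⇔ (∃ λ j → j < n × e ≡ E (j * 2))
    removed-even e = mk⇔ to from
      where
      to : mRemoved true e ≡ true → ∃ λ j → j < n × e ≡ E (j * 2)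
      to q with anyF-true {P = λ k → (isEven (toℕ k) ==ᵇ true) ∧ (pe k ==ᶠ e)} q
      ... | k , r with ∧-true {isEven (toℕ k) ==ᵇ true} r | halve (toℕ k)
      ... | _ , at | inj₁ (j , eq , _) = j
        , ℕ.*-cancelʳ-< 2 j n (subst (j * 2 <_) 2n≡n2 (subst (_< 2 * n) eq (Fin.toℕ<n k)))
        , trans (sym (==ᶠ⇒≡ at)) (cong pe (trans (sym (nth-toℕ 0<2n k)) (cong (nth _ 0<2n) eq)))
      ... | even , _ | inj₂ (_ , _ , odd) = contradiction (trans (sym even) (cong (_==ᵇ true) odd)) true≢false
      from : (∃ λ j → j < n × e ≡ E (j * 2)) → mRemoved true e ≡ true
      from (j , j<n , refl) = anyF-intro {P = λ k → (isEven (toℕ k) ==ᵇ true) ∧ (pe k ==ᶠ e)} (nth (2 * n) 0<2n (j * 2)) (∧-intro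
        (cong (_==ᵇ true) (trans (cong isEven (toℕ-nth 0<2n (double< j<n))) (isEven-double j))) (==ᶠ-refl _))

    removed-odd : ∀ e → mRemoved false e ≡ true ⇔ (∃ λ j → j < n × e ≡ E (suc (j * 2)))
    removed-odd e = mk⇔ to from
      where
      to : mRemoved false e ≡ true → ∃ λ j → j < n × e ≡ E (suc (j * 2))
      to q with anyF-true {P = λ k → (isEven (toℕ k) ==ᵇ false) ∧ (pe k ==ᶠ e)} q
      ... | k , r with ∧-true {isEven (toℕ k) ==ᵇ false} r | halve (toℕ k)
      ... | _ , at | inj₂ (j , eq , _) = j
        , ℕ.*-cancelʳ-< 2 j n (subst (j * 2 <_) 2n≡n2 (ℕ.<-trans (ℕ.n<1+n _) (subst (_< 2 * n) eq (Fin.toℕ<n k))))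
        , trans (sym (==ᶠ⇒≡ at)) (cong pe (trans (sym (nth-toℕ 0<2n k)) (cong (nth _ 0<2n) eq)))
      ... | odd , _ | inj₁ (_ , _ , even) = contradiction (trans (sym odd) (cong (_==ᵇ false) even)) true≢false
      from : (∃ λ j → j < n × e ≡ E (suc (j * 2))) → mRemoved false e ≡ true
      from (j , j<n , refl) = anyF-intro {P = λ k → (isEven (toℕ k) ==ᵇ false) ∧ (pe k ==ᶠ e)} (nth (2 * n) 0<2n (suc (j * 2))) (∧-intro
        (cong (_==ᵇ false) (trans (cong isEven (toℕ-nth 0<2n (suc-double< j<n))) (cong not (isEven-double j)))) (==ᶠ-refl _))

    keepKind : Bool → Kind → Bool
    keepKind c (orig v) = not (evenOrig v)
    keepKind c (fc f) = true
    keepKind c (ed e) = not (mRemoved c e)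

    keep-kind : ∀ c x → keepWith c x ≡ keepKind c (kind x)
    keep-kind c x with kind x
    ... | orig v = refl
    ... | fc f = refl
    ... | ed e = refl

    keep-place : ∀ c k → keepWith c (place k) ≡ keepKind c k
    keep-place c k = trans (keep-kind c (place k)) (cong (keepKind c) (kind-place k))

    not-true⇔ : ∀ {x y : Bool} {Q : ℕ → Set} {R : ℕ → Set} → x ≡ not y → y ≡ true ⇔ (∃ λ j → Q j × R j) →
                x ≡ true ⇔ (∀ {j} → Q j → ¬ R j)
    not-true⇔ {y = false} refl equiv = mk⇔
      (λ _ {j} q r → contradiction (Equivalence.from equiv (j , q , r)) λ ()) (λ _ → refl)
    not-true⇔ {y = true} refl equiv = mk⇔ (λ ())
      (λ none → contradiction (proj₂ (proj₂ (Equivalence.to equiv refl))) (none (proj₁ (proj₂ (Equivalence.to equiv refl)))))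

    reindex : ∀ {Q : ℕ → Set} (h : ℕ → ℕ) {C : ℕ → Set} → (∀ {j} → C j → C (h j)) → (∀ {j} → C j → h (h j) ≡ j) →
              (∃ λ j → C j × Q j) ⇔ (∃ λ j → C j × Q (h j))
    reindex {Q} h closed involutive = mk⇔
      (λ (j , c , q) → h j , closed c , subst Q (sym (involutive c)) q) (λ (j , c , q) → h j , closed c , q)

  keeps⁺ : Keeps strip keep⁺
  keeps⁺ = record
    { keep-vertex = λ v → not-true⇔ (keep-place true (orig v)) (evenOrig⇔ v)
    ; keep-face = λ f → keep-place true (fc f)
    ; keep-edge = λ e → not-true⇔ (keep-place true (ed e)) (removed-even e) }

  private
    complement : ∀ {j} → j ≤ n → n ∸ j ≤ n
    complement {j} _ = ℕ.m∸n≤m n j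

    down : ∀ {j} → j < n → n ∸ suc j < n
    down j<n = ℕ.∸-monoʳ-< (s≤s z≤n) j<n

  keeps⁻ : Keeps (reverse strip) keep⁻
  keeps⁻ = record
    { keep-vertex = λ v → not-true⇔ (keep-place false (orig v))
        (reindex {λ j → v ≡ P (j * 2)} (n ∸_) complement ℕ.m∸[m∸n]≡n ⇔-∘ evenOrig⇔ v)
    ; keep-face = λ f → keep-place false (fc f)
    ; keep-edge = λ e → not-true⇔ (keep-place false (ed e))
        (reindex {λ j → e ≡ E (suc (j * 2))} (λ j → n ∸ suc j) down ∸-suc-involutive ⇔-∘ removed-odd e) }

  -- The way back ends on the strip reversed twice, whose indices agree with the original ones only
  -- within range; hence G⁺ is described over it anew.
  keeps⁺⁺ : Keeps (reverse (reverse strip)) keep⁺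
  keeps⁺⁺ = record
    { keep-vertex = λ v → not-true⇔ (keep-place true (orig v))
        (reindex {λ j → v ≡ P ((n ∸ j) * 2)} (n ∸_) complement ℕ.m∸[m∸n]≡n
          ⇔-∘ (reindex {λ j → v ≡ P (j * 2)} (n ∸_) complement ℕ.m∸[m∸n]≡n ⇔-∘ evenOrig⇔ v))
    ; keep-face = λ f → keep-place true (fc f)
    ; keep-edge = λ e → not-true⇔ (keep-place true (ed e))
        (reindex {λ j → e ≡ E ((n ∸ suc j) * 2)} (λ j → n ∸ suc j) down ∸-suc-involutive
          ⇔-∘ (reindex {λ j → e ≡ E (j * 2)} (λ j → n ∸ suc j) down ∸-suc-involutive ⇔-∘ removed-even e)) }

  bijection : PM keep⁺ ↔ PM keep⁻
  bijection = mk↔ₛ′ forth back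
    -- Reversal only reorders the strip edges, so an edge off one of the strips is off all of them.
    (λ M → vertexMatched-injective keeps⁻ (forth (back M)) M λ e off → trans
      (transport-kind keeps⁺ keeps⁻ (back M) (off ∘ mirrored strip) off)
      (transport-kind keeps⁻ keeps⁺⁺ M off (off ∘ mirrored strip ∘ back-twice)))
    (λ M → vertexMatched-injective keeps⁺ (back (forth M)) M λ e off → trans
      (transport-kind keeps⁻ keeps⁺⁺ (forth M) (off ∘ reverse-onStrip strip) (off ∘ back-twice))
      (transport-kind keeps⁺ keeps⁻ M off (off ∘ reverse-onStrip strip)))
    where
    forth = transport keeps⁺ keeps⁻
    back = transport keeps⁻ keeps⁺⁺
    back-twice : ∀ {e} → Strip.OnStrip (reverse (reverse strip)) e → Strip.OnStrip strip e
    back-twice = reverse-onStrip strip ∘ reverse-onStrip (reverse strip)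

theorem2p1 : (G : PlaneGraph) → (n : ℕ) → 1 ≤ n →
    (p : Fin (suc (2 * n)) → Fin (PlaneGraph.nV G)) →
    (pe : Fin (2 * n) → Fin (PlaneGraph.nE G)) →
    (∀ i j → p i ≡ p j → i ≡ j) →
    (∀ k → (PlaneGraph.tl G (pe k) ≡ p (inject₁ k) × PlaneGraph.hd G (pe k) ≡ p (suc k))
    ⊎ (PlaneGraph.tl G (pe k) ≡ p (suc k) × PlaneGraph.hd G (pe k) ≡ p (inject₁ k))) →
    PlaneGraph.deg G (p zero) ≡ 1 →
    PlaneGraph.deg G (p (fromℕ (2 * n))) ≡ 1 →
    (∀ k → (toℕ k ≡ 0 ⊎ suc (toℕ k) ≡ 2 * n) →
    PlaneGraph.face G (pe k , false) ≡ nothing × PlaneGraph.face G (pe k , true) ≡ nothing) →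
    (∀ k → 1 ≤ toℕ k → suc (suc (toℕ k)) ≤ 2 * n →
    PlaneGraph.face G (pe k , false) ≡ nothing ⊎ PlaneGraph.face G (pe k , true) ≡ nothing) →
    (∀ i → isEven (toℕ i) ≡ true → 0 < toℕ i → toℕ i < 2 * n → PlaneGraph.deg G (p i) ≡ 2) →
    PerfectMatching (Refinement.H G) (Refinement.Path.keep⁺ G n p pe)
    ↔ PerfectMatching (Refinement.H G) (Refinement.Path.keep⁻ G n p pe)
theorem2p1 G n 1≤n p pe p-injective pe-ends deg-first deg-last end-faces inner-faces deg-even =
  PathStrip.bijection G n 1≤n p pe p-injective pe-ends deg-first deg-last end-faces inner-faces deg-even
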